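{- Let $m\ge 1$ be an integer. For scheduling with uncertain processing times on $m$ machines with the objective of minimizing the total completion time, let $\beta=2$ and, with $r_k=u_k/t_k$, let $\mathbb P_k=0$ if $r_k<1$, $\mathbb P_k=1$ if $r_k>3$, and $$\mathbb P_k=\frac{(\beta+1)(r_k-1)}{\beta\left(\max\{\frac{2}{r_k}+1,\ \frac{\beta}{r_k},\ (1+\frac1\beta)(1+\frac1{r_k})\}-\max\{2,\ \beta,\ 1+\frac1\beta\}+r_k-1\right)+r_k-1}$$ if $r_k\in[1,3]$. Then the algorithm $\beta$-RPCPM with these testing probabilities has expected competitive ratio at most $$2.152271\cdot\left(\frac12+\frac1{2m}\right)+1.434847\cdot\left(1-\frac1m\right),$$ which is $2.152271$ when $m=1$ and tends to approximately $2.510983$ as $m$ tends to infinity.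
   Context: Problem. There are $n$ jobs, all available at time $0$, and $m$ identical machines, each of which runs one task at a time. Job $j$ has a testing time $t_j> 0$, an upper limit $u_j> 0$, and a real processing time $p_j\in[0,u_j]$. A job may be executed untested, which takes $u_j$ time units, or it may be tested (taking $t_j$ time units) and afterwards, once the test is finished, executed in $p_j$ time units; other tasks may run between the test and the execution, and the test and the execution of a job may be on different machines. The completion time of a job is the time at which its execution (or execution-untested) ends, and the cost of a schedule is the sum of the completion times of all jobs. An online algorithm knows all $t_j,u_j$ from the start, but learns $p_j$ only when the test of $j$ is finished. $\mathrm{OPT}$ knows all $p_j$ in advance (but must still test $j$ in order to run it in time $p_j$), and its cost is the minimum cost of any schedule. The expected competitive ratio of a randomized online algorithm $A$ is the smallest $c$ such that $\mathbb E[\mathrm{cost}(A)]\le c\cdot\mathrm{cost}(\mathrm{OPT})$ on all instances. Algorithm $\beta$-RPCPM with testing probabilities $\mathbb P_j$. Maintain a priority queue of tasks, smaller weight meaning higher priority (ties broken arbitrarily). Initially, for each job $j$, independently: with probability $\mathbb P_j$ insert a testing task of weight $\beta t_j$ (job $j$ is tested), and with probability $1-\mathbb P_j$ insert an execution-untested task of weight $u_j$ (job $j$ is not tested). All machines are idle at time $0$. Whenever a machine becomes idle: if the task it has just finished was the testing task of a job $i$, insert the execution task of $i$ (of duration $p_i$) with weight $t_i+p_i$ into the queue; then extract a task of smallest weight from the queue (if it is nonempty) and run it, without interruption, on this machine. -}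

module Defs where

open import Level using (_⊔_) renaming (suc to lsuc)
open import Algebra.Bundles using (CommutativeRing)
open import Algebra.Core using (Op₁; Op₂)
open import Algebra.Structures using (IsCommutativeRing)
open import Data.Bool.Base using (Bool; true; false; if_then_else_)
open import Data.Fin.Base using (Fin; zero; suc)
open import Data.Fin.Subset using (Subset; _∈_; _∉_)
open import Data.List.Base as List using (List; []; _∷_; _++_)
open import Data.List.Relation.Unary.All using (All)
open import Data.List.Relation.Binary.Permutation.Propositional using (_↭_)
open import Data.Nat.Base as ℕ using (ℕ; NonZero)
open import Data.Product.Base using (_×_; ∃)
open import Data.Sum.Base using (_⊎_)
open import Data.Vec.Base as Vec using (Vec; lookup; replicate; _[_]≔_)
import Data.Vec.Relation.Unary.All as VecAll
open import Function.Base using (_∘_)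
open import Relation.Binary.Bundles using (DecTotalOrder; StrictTotalOrder)
open import Relation.Binary.Core using (Rel)
open import Relation.Binary.PropositionalEquality.Core using (_≡_; _≢_)
open import Relation.Binary.Structures using (IsDecTotalOrder)
open import Relation.Nullary.Decidable.Core using (does)
open import Relation.Nullary.Negation.Core using (¬_)

record OrderedField c ℓ₁ ℓ₂ : Set (lsuc (c ⊔ ℓ₁ ⊔ ℓ₂)) where
  infix  8 _⁻¹
  infix  8 -_
  infixl 7 _*_
  infixl 6 _+_
  infix  4 _≈_ _≤_
  field
    Carrier           : Set c
    _≈_               : Rel Carrier ℓ₁
    _≤_               : Rel Carrier ℓ₂
    _+_ _*_           : Op₂ Carrier
    -_                : Op₁ Carrier
    _⁻¹               : Op₁ Carrier
    0# 1#             : Carrier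
    isCommutativeRing : IsCommutativeRing _≈_ _+_ _*_ -_ 0# 1#
    isDecTotalOrder   : IsDecTotalOrder _≈_ _≤_
    1≉0               : ¬ (1# ≈ 0#)
    -- The value of 0# ⁻¹ is unspecified.
    ⁻¹-inverseʳ       : ∀ x → ¬ (x ≈ 0#) → x * x ⁻¹ ≈ 1#
    +-monoʳ-≤         : ∀ x {y z} → y ≤ z → x + y ≤ x + z
    *-nonneg          : ∀ {x y} → 0# ≤ x → 0# ≤ y → 0# ≤ x * y

  commutativeRing : CommutativeRing c ℓ₁
  commutativeRing = record { isCommutativeRing = isCommutativeRing }

  decTotalOrder : DecTotalOrder c ℓ₁ ℓ₂
  decTotalOrder = record { isDecTotalOrder = isDecTotalOrder }

  open CommutativeRing commutativeRing public using (_-_; semiring)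

  open import Algebra.Properties.Semiring.Mult semiring public
    using () renaming (_×_ to _·_)

  fromℕ : ℕ → Carrier
  fromℕ n = n · 1#

-- The role of the real numbers is played by an arbitrary Archimedean
-- ordered field.  Classically these are exactly the ordered subfields
-- of ℝ, and ℝ itself is one of them.

record ArchimedeanField c ℓ₁ ℓ₂ : Set (lsuc (c ⊔ ℓ₁ ⊔ ℓ₂)) where
  field
    orderedField : OrderedField c ℓ₁ ℓ₂

  open OrderedField orderedField public

  field
    archimedean : ∀ x → ∃ λ n → x ≤ fromℕ n

module Scheduling {c ℓ₁ ℓ₂} (K : ArchimedeanField c ℓ₁ ℓ₂) where

  open ArchimedeanField K public
  open import Relation.Binary.Properties.DecTotalOrder decTotalOrder public
    using (_<_; <-strictTotalOrder)
  open StrictTotalOrder <-strictTotalOrder public using (_<?_)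
  open import Algebra.Construct.NaturalChoice.Max
    (DecTotalOrder.totalOrder decTotalOrder) public
    using () renaming (_⊔_ to max)
  open import Algebra.Properties.Semiring.Sum semiring public using (sum)

  infixl 7 _/_

  _/_ : Op₂ Carrier
  x / y = x * y ⁻¹

  ∣_∣ : Op₁ Carrier
  ∣ x ∣ = max x (- x)

  -- decimal a k is a · 10⁻ᵏ.
  decimal : ℕ → ℕ → Carrier
  decimal a k = fromℕ a / fromℕ (10 ℕ.^ k)

  -- Sequences are indexed by the positive integers.
  TendsTo : (∀ m → .{{NonZero m}} → Carrier) → Carrier → Set _
  TendsTo f L = ∀ ε → 0# < ε →
    ∃ λ N → ∀ m → .{{_ : NonZero m}} → N ℕ.≤ m → ∣ f m - L ∣ < ε

  record Instance (n : ℕ) : Set (c ⊔ ℓ₁ ⊔ ℓ₂) where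
    field
      t u p : Fin n → Carrier
      t>0   : ∀ j → 0# < t j
      u>0   : ∀ j → 0# < u j
      p≥0   : ∀ j → 0# ≤ p j
      p≤u   : ∀ j → p j ≤ u j

  data Task (n : ℕ) : Set where
    test exec untested : Fin n → Task n

  -- A subset ω of the jobs is the set of jobs that are tested.  Required
  -- ω k says that task k has to be run, and lastTask ω j is the task
  -- whose end is the completion of job j.

  Required : ∀ {n} → Subset n → Task n → Set
  Required ω (test j)     = j ∈ ω
  Required ω (exec j)     = j ∈ ω
  Required ω (untested j) = j ∉ ω

  lastTask : ∀ {n} → Subset n → Fin n → Task n
  lastTask ω j = if lookup ω j then exec j else untested j

  -- Only the values at required tasks are meaningful.
  record Schedule (m n : ℕ) : Set c where
    field
      machine : Task n → Fin m
      start   : Task n → Carrier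

  module _ {n} (I : Instance n) where
    open Instance I

    duration : Task n → Carrier
    duration (test j)     = t j
    duration (exec j)     = p j
    duration (untested j) = u j

    module _ {m} (S : Schedule m n) where
      open Schedule S

      end : Task n → Carrier
      end k = start k + duration k

      cost : Subset n → Carrier
      cost ω = sum λ j → end (lastTask ω j)

      record Feasible (ω : Subset n) : Set (c ⊔ ℓ₁ ⊔ ℓ₂) where
        field
          start≥0    : ∀ k → Required ω k → 0# ≤ start k
          test-first : ∀ j → j ∈ ω → end (test j) ≤ start (exec j)
          disjoint   : ∀ k l → Required ω k → Required ω l → k ≢ l →
                       machine k ≡ machine l →
                       end k ≤ start l ⊎ end l ≤ start k

    -- The algorithm.  A machine is idle from time 0, or runs a task up to
    -- a given time, or has become idle when the queue was empty.  In the
    -- last case it never resumes work: a task is inserted later only by a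
    -- machine that at once extracts a task again, so that the queue stays
    -- empty.

    data Status : Set c where
      fresh   : Status
      running : Task n → Carrier → Status
      retired : Status

    data _IdleAt_ : Status → Carrier → Set c where
      fresh   : fresh IdleAt 0#
      running : ∀ {k e} → running k e IdleAt e

    inserted : Status → List (Task n)
    inserted (running (test i) _) = exec i ∷ []
    inserted _                    = []

    NextIdle : ∀ {m} → Vec Status m → Fin m → Carrier → Set (c ⊔ ℓ₂)
    NextIdle M i e = lookup M i IdleAt e ×
                     (∀ i′ e′ → lookup M i′ IdleAt e′ → e ≤ e′)

    initialQueue : Subset n → List (Task n)
    initialQueue ω =
      List.tabulate λ j → if lookup ω j then test j else untested j

    module _ (β : Carrier) where

      weight : Task n → Carrier
      weight (test j)     = β * t j
      weight (exec j)     = t j + p j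
      weight (untested j) = u j

      -- Run S q M: starting with queue q and machines M, the algorithm
      -- can carry out the remaining part of the schedule S.  The choice
      -- among tasks of equal weight, and among machines that become idle
      -- at the same time, is arbitrary.
      data Run {m} (S : Schedule m n) :
               List (Task n) → Vec Status m → Set (c ⊔ ℓ₁ ⊔ ℓ₂) where
        finish   : ∀ {q M} → VecAll.All (_≡ retired) M → Run S q M
        retire   : ∀ {q M} i e → NextIdle M i e →
                   inserted (lookup M i) ++ q ≡ [] →
                   Run S [] (M [ i ]≔ retired) →
                   Run S q M
        dispatch : ∀ {q M} i e → NextIdle M i e →
                   ∀ k q′ → k ∷ q′ ↭ inserted (lookup M i) ++ q →
                   All (λ l → weight k ≤ weight l) q′ →
                   Schedule.machine S k ≡ i →
                   Schedule.start S k ≈ e →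
                   Run S q′ (M [ i ]≔ running k (e + duration k)) →
                   Run S q M

      -- S is a possible outcome of the algorithm when ω is the set of
      -- jobs for which a testing task was inserted initially.
      RPCPM : ∀ {m} → Subset n → Schedule m n → Set (c ⊔ ℓ₁ ⊔ ℓ₂)
      RPCPM {m} ω S = Run S (initialQueue ω) (replicate m fresh)

  -- The expectation of X ω for a random set ω that contains each j
  -- independently with probability ℙ j.
  𝔼 : ∀ {n} → (Fin n → Carrier) → (Subset n → Carrier) → Carrier
  𝔼 {ℕ.zero}  ℙ X = X Vec.[]
  𝔼 {ℕ.suc n} ℙ X =
    ℙ zero        * 𝔼 (ℙ ∘ suc) (X ∘ (true  Vec.∷_)) +
    (1# - ℙ zero) * 𝔼 (ℙ ∘ suc) (X ∘ (false Vec.∷_))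

  -- On m machines, β-RPCPM whose testing probabilities are given by ℙ has
  -- expected competitive ratio at most ρ.  The schedules A ω are the
  -- outcomes of the coin tosses under an arbitrary way of breaking ties.
  -- As the cost of OPT is the least cost of a feasible schedule, the bound
  -- by ρ times the cost of OPT is a bound by ρ times the cost of every
  -- feasible schedule, with any set τ of tested jobs.
  ExpectedCompetitiveRatio≤ :
    ℕ → Carrier → (∀ {n} → Instance n → Fin n → Carrier) → Carrier → Set _
  ExpectedCompetitiveRatio≤ m β ℙ ρ =
    ∀ {n} (I : Instance n) →
    (A : Subset n → Schedule m n) → (∀ ω → RPCPM I β ω (A ω)) →
    (τ : Subset n) (S : Schedule m n) → Feasible I S τ →
    𝔼 (ℙ I) (λ ω → cost I (A ω) ω) ≤ ρ * cost I S τ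

  two three : Carrier
  two   = fromℕ 2
  three = fromℕ 3

  testProbability : Carrier → Carrier → Carrier
  testProbability β r =
    if does (r <? 1#) then 0# else
    if does (three <? r) then 1# else
    ((β + 1#) * (r - 1#)) /
    (β * ( max (max (two / r + 1#) (β / r)) ((1# + 1# / β) * (1# + 1# / r))
         - max (max two β) (1# + 1# / β)
         + r - 1#)
     + r - 1#)

  testProbabilities : Carrier → ∀ {n} → Instance n → Fin n → Carrier
  testProbabilities β I k = testProbability β (u k / t k)
    where open Instance I

  ratio : ∀ m → .{{NonZero m}} → Carrier
  ratio m =
    decimal 2152271 6 * (1# / two + 1# / (two * fromℕ m)) +
    decimal 1434847 6 * (1# - 1# / fromℕ m)

-- Let xⱼ = min (uⱼ, tⱼ + pⱼ) be the work that OPT at least has to spend on job j.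
--
-- As an insertion into the queue is followed at once by an extraction, the queue
-- never holds a task that weighs less than one dispatched earlier.  Hence a
-- tested job either is executed right after its test, or waits for its execution
-- behind lighter tasks only, and in both cases no machine idles while it waits.
-- So m C ≤ m (own work) + (work on other jobs ahead of j), and for a pair of jobs
-- the two amounts of work ahead of each other add up to at most half the charge
-- of either job, where the charge is 3 u if the job is untested and
-- max (4 t + 2 p, 3 (t + p)) if it is tested.  The testing probabilities balance
-- the extreme cases p = 0 and p = u, so that the expected charge is at most 3 a x
-- with a = 1.434847; it is at least three times the expected own work.
--
-- Conversely 2 m OPT ≥ m Σ xⱼ + Σ min (xᵢ, xⱼ), the last sum being over all ordered
-- pairs, i = j included.  Jobs split into two tasks are handled by mean busy times, and the
-- bound follows from the positive semidefiniteness of the kernel min (1/wᵢ, 1/wⱼ).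
-- Together with OPT ≥ Σ xⱼ this gives the claimed ratio by linear arithmetic.

module Submission where

open import Defs
open import Algebra.Bundles using (CommutativeRing)
import Algebra.Construct.NaturalChoice.Max as NaturalMax
import Algebra.Construct.NaturalChoice.MaxOp as MaxOp
import Algebra.Construct.NaturalChoice.Min as NaturalMin
import Algebra.Construct.NaturalChoice.MinOp as MinOp
import Algebra.Properties.Ring as RingProperties
import Algebra.Properties.Semiring.Mult as SemiringMult
import Algebra.Properties.Semiring.Sum as SemiringSum
import Algebra.Solver.CommutativeMonoid as MonoidSolver
import Algebra.Solver.Ring.NaturalCoefficients.Default as NaturalSolver
open import Data.Bool.Base using (Bool; true; false; if_then_else_)
open import Data.Empty using (⊥-elim)
open import Data.Fin.Base using (Fin; zero; suc)
import Data.Fin.Properties as Fin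
open import Data.Fin.Subset using (Subset) renaming (_∈_ to _∈ₛ_; _∉_ to _∉ₛ_)
open import Data.List.Base using (List; []; _∷_; _++_; concatMap; length; tabulate)
open import Data.List.Membership.Propositional using (_∈_)
open import Data.List.Membership.Propositional.Properties
  using (∈-++⁻; ∈-tabulate⁺; ∈-tabulate⁻; ∈-concat⁺′; ∈-map⁺)
open import Data.List.Properties using (++-identityʳ; ++-conicalˡ; ++-conicalʳ; concatMap-++)
open import Data.List.Relation.Binary.Disjoint.Propositional using (Disjoint)
open import Data.List.Relation.Binary.Permutation.Propositional as Perm
  using (_↭_; ↭-refl; ↭-sym; ↭-trans; ↭-reflexive; ↭⇒↭ₛ; module PermutationReasoning)
import Data.List.Relation.Binary.Permutation.Propositional.Properties as Perm
import Data.List.Relation.Binary.Permutation.Setoid.Properties as SetoidPerm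
open import Data.List.Relation.Unary.All as All using (All; []; _∷_)
import Data.List.Relation.Unary.All.Properties as All
open import Data.List.Relation.Unary.AllPairs using (AllPairs; []; _∷_)
import Data.List.Relation.Unary.AllPairs.Properties as AllPairs
open import Data.List.Relation.Unary.Any using (here; there)
open import Data.List.Relation.Unary.Linked.Properties using (Linked⇒AllPairs)
open import Data.List.Relation.Unary.Unique.Propositional using (Unique)
import Data.List.Relation.Unary.Unique.Propositional.Properties as Unique
import Data.List.Sort as Sort
open import Data.Nat.Base as ℕ using (ℕ; NonZero)
import Data.Nat.Properties as ℕ
open import Data.Product.Base using (_×_; ∃; _,_; proj₁; proj₂)
open import Data.Sum.Base using (_⊎_; inj₁; inj₂; [_,_]′)
open import Data.Vec.Base using (Vec; []; _∷_; lookup; _[_]≔_; replicate)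
open import Data.Vec.Properties
  using (lookup⇒[]=; []=⇒lookup; lookup∘update; lookup∘update′; []≔-idempotent; lookup-replicate)
import Data.Vec.Relation.Unary.All as VecAll
import Data.Vec.Relation.Unary.All.Properties as VecAll
open import Function.Base using (_∘_)
import Level
import Relation.Binary.Construct.On as On
open import Relation.Binary.Bundles using (DecTotalOrder)
open import Relation.Binary.Definitions using (DecidableEquality; tri<; tri≈; tri>)
import Relation.Binary.Properties.DecTotalOrder as DecTotalOrderProperties
open import Relation.Binary.PropositionalEquality as ≡ using (_≡_; _≢_)
import Relation.Binary.Reasoning.PartialOrder as ≤-Reasoning
open import Relation.Nullary.Decidable using (does; yes; no; map′; dec-true; dec-false)
open import Relation.Nullary.Negation.Core using (¬_)

-- The coin tosses of two jobs interact in every pair, while a testing probability controls one job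
-- only. That the delay within a pair is bounded by the charge of either job removes the
-- interaction: the pair is billed to the job with the smaller `x`, a choice independent of the
-- coins, so a single marginal expectation yields `three * a * min (x j) (x i)`, the shape of the
-- lower bound on OPT. In the lower bound let v be the reciprocal of the work of a task's job. Two
-- tasks of lengths d, d' on one machine contribute at least 2 d d' min (v, v') to the weighted
-- moments, whichever comes first; on different machines they contribute nothing together.
-- Semidefiniteness supplies the missing pairs at the price of the factor m, and w w' min (1/w,
-- 1/w') = min (w, w') leads back to jobs. With r = u/t and D = 3 r + 3/r - 4, the testing
-- probability for r in [1, 3] is 3 (r - 1) / D, and both extreme cases come down to the same
-- inequality 3 r - 1 ≤ a D. The constant 2.152271 is 3 a / 2, rounded up.

-- Inequalities in ordered fields.

module OrderedFieldProperties {c ℓ₁ ℓ₂} (F : OrderedField c ℓ₁ ℓ₂) where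
  open OrderedField F
  open CommutativeRing commutativeRing public
    using ( refl; sym; trans; reflexive; setoid; ring; commutativeSemiring; zeroˡ; zeroʳ
          ; +-cong; +-congˡ; +-congʳ; +-assoc; +-comm; +-identityˡ; +-identityʳ; -‿inverseʳ; -‿inverseˡ
          ; *-cong; *-congˡ; *-congʳ; *-assoc; *-comm; *-identityˡ; *-identityʳ; distribˡ; distribʳ )
  open DecTotalOrder decTotalOrder public
    using (_≟_; poset; totalOrder; antisym; total)
    renaming (refl to ≤-refl; trans to ≤-trans; reflexive to ≤-reflexive;
              ≤-respˡ-≈ to ≤-respˡ; ≤-respʳ-≈ to ≤-respʳ)
  open DecTotalOrderProperties decTotalOrder using (_<_)
  open DecTotalOrderProperties decTotalOrder public using (≮⇒≥)
  open RingProperties ring public using (-‿distribˡ-*; -‿distribʳ-*; -‿involutive)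
  open SemiringMult semiring public using (×-homo-+; ×1-homo-*)
  open NaturalSolver commutativeSemiring public using (Polynomial; solve; _:=_; _:+_; _:*_; con)
  open NaturalMin totalOrder public using () renaming (_⊓_ to min)
  open MaxOp (NaturalMax.maxOperator totalOrder) public using (x≤x⊔y; x≤y⊔x; ⊔-lub)
  open NaturalMax totalOrder public using (x≤y⇒x⊔y≈y; x≤y⇒y⊔x≈y)
  open MinOp (NaturalMin.minOperator totalOrder) public using (x⊓y≤x; x⊓y≤y; ⊓-sel; ⊓-glb; ⊓-mono-≤)
  open NaturalMin totalOrder public using (x≤y⇒x⊓y≈x; x≤y⇒y⊓x≈x)
  open ≤-Reasoning poset

  -- Evaluates to fromℕ k, unlike con k.
  num : ∀ {n} → ℕ → Polynomial n
  num ℕ.zero    = con 0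
  num (ℕ.suc k) = con 1 :+ num k

  <⇒≤ : ∀ {x y} → x < y → x ≤ y
  <⇒≤ = proj₁

  <⇒≉ : ∀ {x} → 0# < x → ¬ (x ≈ 0#)
  <⇒≉ (_ , ≉) eq = ≉ (sym eq)

  +-monoˡ-≤ : ∀ z {x y} → x ≤ y → x + z ≤ y + z
  +-monoˡ-≤ z {x} {y} x≤y = begin
    x + z  ≈⟨ +-comm x z ⟩
    z + x  ≤⟨ +-monoʳ-≤ z x≤y ⟩
    z + y  ≈⟨ +-comm z y ⟩
    y + z  ∎

  +-mono-≤ : ∀ {x y u v} → x ≤ y → u ≤ v → x + u ≤ y + v
  +-mono-≤ {x} {y} {u} {v} x≤y u≤v = ≤-trans (+-monoˡ-≤ u x≤y) (+-monoʳ-≤ y u≤v)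

  +-cancelʳ-≤ : ∀ z {x y} → x + z ≤ y + z → x ≤ y
  +-cancelʳ-≤ z {x} {y} le = begin
    x               ≈⟨ +-identityʳ x ⟨
    x + 0#          ≈⟨ +-congˡ (-‿inverseʳ z) ⟨
    x + (z - z)     ≈⟨ +-assoc x z (- z) ⟨
    x + z - z       ≤⟨ +-monoˡ-≤ (- z) le ⟩
    y + z - z       ≈⟨ +-assoc y z (- z) ⟩
    y + (z - z)     ≈⟨ +-congˡ (-‿inverseʳ z) ⟩
    y + 0#          ≈⟨ +-identityʳ y ⟩
    y               ∎

  -- Linear arithmetic: x ≤ y follows from l ≤ r when y - x equals r - l,
  -- an identity that is stated without subtraction, as the solver works in
  -- semirings.
  linear : ∀ {x y l r} → l ≤ r → x + r ≈ y + l → x ≤ y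
  linear {x} {y} {l} {r} l≤r eq = +-cancelʳ-≤ l (begin
    x + l  ≤⟨ +-monoʳ-≤ x l≤r ⟩
    x + r  ≈⟨ eq ⟩
    y + l  ∎)

  linear-≈ : ∀ {x y l r} → l ≈ r → x + r ≈ y + l → x ≈ y
  linear-≈ {x} {y} {l} {r} l≈r eq = antisym
    (linear (≤-reflexive l≈r) eq)
    (linear (≤-reflexive (sym l≈r)) (sym eq))

  x≤x+y : ∀ {x y} → 0# ≤ y → x ≤ x + y
  x≤x+y {x} {y} 0≤y = ≤-respˡ (+-identityʳ x) (+-monoʳ-≤ x 0≤y)

  +-nonneg : ∀ {x y} → 0# ≤ x → 0# ≤ y → 0# ≤ x + y
  +-nonneg 0≤x 0≤y = ≤-trans 0≤x (x≤x+y 0≤y)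

  x-y+y≈x : ∀ x y → x - y + y ≈ x
  x-y+y≈x x y = trans (+-assoc x (- y) y) (trans (+-congˡ (-‿inverseˡ y)) (+-identityʳ x))

  x≤y⇒0≤y-x : ∀ {x y} → x ≤ y → 0# ≤ y - x
  x≤y⇒0≤y-x {x} {y} x≤y = +-cancelʳ-≤ x (begin
    0# + x     ≈⟨ +-identityˡ x ⟩
    x          ≤⟨ x≤y ⟩
    y          ≈⟨ x-y+y≈x y x ⟨
    y - x + x  ∎)

  *-monoˡ-≤ : ∀ {x y z} → 0# ≤ x → y ≤ z → x * y ≤ x * z
  *-monoˡ-≤ {x} {y} {z} 0≤x y≤z = begin
    x * y                ≤⟨ x≤x+y (*-nonneg 0≤x (x≤y⇒0≤y-x y≤z)) ⟩
    x * y + x * (z - y)  ≈⟨ distribˡ x y (z - y) ⟨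
    x * (y + (z - y))    ≈⟨ *-congˡ (trans (+-comm y (z - y)) (x-y+y≈x z y)) ⟩
    x * z                ∎

  *-monoʳ-≤ : ∀ {x y z} → 0# ≤ x → y ≤ z → y * x ≤ z * x
  *-monoʳ-≤ {x} {y} {z} 0≤x y≤z = begin
    y * x  ≈⟨ *-comm y x ⟩
    x * y  ≤⟨ *-monoˡ-≤ 0≤x y≤z ⟩
    x * z  ≈⟨ *-comm x z ⟩
    z * x  ∎

  *-square-nonneg : ∀ x → 0# ≤ x * x
  *-square-nonneg x with total 0# x
  ... | inj₁ 0≤x = *-nonneg 0≤x 0≤x
  ... | inj₂ x≤0 = begin
    0#         ≤⟨ *-nonneg 0≤-x 0≤-x ⟩
    - x * - x  ≈⟨ -‿distribˡ-* x (- x) ⟨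
    - (x * - x) ≈⟨ -‿distribʳ-* x (- x) ⟩
    x * - - x  ≈⟨ *-congˡ (-‿involutive x) ⟩
    x * x      ∎
    where
    0≤-x : 0# ≤ - x
    0≤-x = ≤-respʳ (+-identityˡ (- x)) (x≤y⇒0≤y-x x≤0)

  xy+xy≤xx+yy : ∀ x y → x * y + x * y ≤ x * x + y * y
  xy+xy≤xx+yy x y = linear (*-square-nonneg (x - y))
    (trans (+-congʳ (+-cong (*-congʳ x≈) (*-congʳ x≈)))
      (trans (solve 2 (λ d y → (d :+ y) :* y :+ (d :+ y) :* y :+ d :* d
                           := (d :+ y) :* (d :+ y) :+ y :* y :+ con 0)
                    refl (x - y) y)
             (+-congʳ (+-congʳ (*-cong (sym x≈) (sym x≈))))))
    where
    x≈ : x ≈ x - y + y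
    x≈ = sym (x-y+y≈x x y)

  0≤1 : 0# ≤ 1#
  0≤1 = ≤-respʳ (*-identityˡ 1#) (*-square-nonneg 1#)

  0<1 : 0# < 1#
  0<1 = 0≤1 , λ eq → 1≉0 (sym eq)

  <-≤-trans : ∀ {x y z} → x < y → y ≤ z → x < z
  <-≤-trans (x≤y , x≉y) y≤z =
    ≤-trans x≤y y≤z , λ x≈z → x≉y (antisym x≤y (≤-respʳ (sym x≈z) y≤z))

  ≤-<-trans : ∀ {x y z} → x ≤ y → y < z → x < z
  ≤-<-trans x≤y (y≤z , y≉z) =
    ≤-trans x≤y y≤z , λ x≈z → y≉z (antisym y≤z (≤-respˡ x≈z x≤y))

  +-positive : ∀ {x y} → 0# < x → 0# ≤ y → 0# < x + y
  +-positive 0<x 0≤y = <-≤-trans 0<x (x≤x+y 0≤y)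

  x<x+y : ∀ {x y} → 0# < y → x < x + y
  x<x+y {x} {y} (0≤y , 0≉y) = x≤x+y 0≤y , λ eq → 0≉y (linear-≈ eq
    (trans (+-identityˡ (x + y)) (+-comm x y)))

  ⁻¹-nonneg : ∀ {x} → 0# < x → 0# ≤ x ⁻¹
  ⁻¹-nonneg {x} 0<x with total 0# (x ⁻¹)
  ... | inj₁ le = le
  ... | inj₂ x⁻¹≤0 = ⊥-elim (1≉0 (antisym 1≤0 0≤1))
    where
    1≤0 : 1# ≤ 0#
    1≤0 = begin
      1#        ≈⟨ ⁻¹-inverseʳ x (<⇒≉ 0<x) ⟨
      x * x ⁻¹  ≤⟨ *-monoˡ-≤ (<⇒≤ 0<x) x⁻¹≤0 ⟩
      x * 0#    ≈⟨ zeroʳ x ⟩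
      0#        ∎

  *⁻¹-cancel : ∀ {x} → 0# < x → ∀ y → x ⁻¹ * (x * y) ≈ y
  *⁻¹-cancel {x} 0<x y = begin-equality
    x ⁻¹ * (x * y)  ≈⟨ *-assoc (x ⁻¹) x y ⟨
    x ⁻¹ * x * y    ≈⟨ *-congʳ (*-comm (x ⁻¹) x) ⟩
    x * x ⁻¹ * y    ≈⟨ *-congʳ (⁻¹-inverseʳ x (<⇒≉ 0<x)) ⟩
    1# * y          ≈⟨ *-identityˡ y ⟩
    y               ∎

  *-cancelˡ-≤ : ∀ {x y z} → 0# < x → x * y ≤ x * z → y ≤ z
  *-cancelˡ-≤ {x} {y} {z} 0<x xy≤xz = begin
    y               ≈⟨ *⁻¹-cancel 0<x y ⟨
    x ⁻¹ * (x * y)  ≤⟨ *-monoˡ-≤ (⁻¹-nonneg 0<x) xy≤xz ⟩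
    x ⁻¹ * (x * z)  ≈⟨ *⁻¹-cancel 0<x z ⟩
    z               ∎

  *-cancelˡ-≈ : ∀ {x y z} → 0# < x → x * y ≈ x * z → y ≈ z
  *-cancelˡ-≈ 0<x eq =
    antisym (*-cancelˡ-≤ 0<x (≤-reflexive eq)) (*-cancelˡ-≤ 0<x (≤-reflexive (sym eq)))

  *-positive : ∀ {x y} → 0# < x → 0# < y → 0# < x * y
  *-positive {x} {y} 0<x 0<y = *-nonneg (<⇒≤ 0<x) (<⇒≤ 0<y) ,
    λ eq → proj₂ 0<y (*-cancelˡ-≈ 0<x (trans (zeroʳ x) eq))

  ⁻¹-positive : ∀ {x} → 0# < x → 0# < x ⁻¹
  ⁻¹-positive {x} 0<x = ⁻¹-nonneg 0<x ,
    λ eq → 1≉0 (trans (sym (⁻¹-inverseʳ x (<⇒≉ 0<x))) (trans (*-congˡ (sym eq)) (zeroʳ x)))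

  fromℕ-nonneg : ∀ n → 0# ≤ fromℕ n
  fromℕ-nonneg ℕ.zero    = ≤-refl
  fromℕ-nonneg (ℕ.suc n) = +-nonneg 0≤1 (fromℕ-nonneg n)

  fromℕ-positive : ∀ n → .{{_ : NonZero n}} → 0# < fromℕ n
  fromℕ-positive (ℕ.suc n) = +-positive 0<1 (fromℕ-nonneg n)

  fromℕ-mono-≤ : ∀ {a b} → a ℕ.≤ b → fromℕ a ≤ fromℕ b
  fromℕ-mono-≤ {b = b} ℕ.z≤n = fromℕ-nonneg b
  fromℕ-mono-≤ (ℕ.s≤s a≤b)   = +-monoʳ-≤ 1# (fromℕ-mono-≤ a≤b)

  fromℕ-homo-* : ∀ a b → fromℕ (a ℕ.* b) ≈ fromℕ a * fromℕ b
  fromℕ-homo-* = ×1-homo-*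

  fromℕ-homo-+ : ∀ a b → fromℕ (a ℕ.+ b) ≈ fromℕ a + fromℕ b
  fromℕ-homo-+ = ×-homo-+ 1#

  -- The product `(b - a) * (y - x)` is nonnegative.
  rearrangement : ∀ {a b x y} → a ≤ b → x ≤ y → a * y + b * x ≤ a * x + b * y
  rearrangement {a} {b} {x} {y} a≤b x≤y = linear (*-monoˡ-≤ (x≤y⇒0≤y-x a≤b) x≤y)
    (trans (+-congʳ (+-congˡ (*-congʳ b≈)))
      (trans (solve 4 (λ a d x y →
          a :* y :+ (d :+ a) :* x :+ d :* y := a :* x :+ (d :+ a) :* y :+ d :* x) refl a (b - a) x y)
        (+-congʳ (+-congˡ (*-congʳ (sym b≈))))))
    where
    b≈ : b ≈ b - a + a
    b≈ = sym (x-y+y≈x b a)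

  -- Completing the square: the discriminant of a x² - b x + k is not positive.
  discriminant : ∀ {a b k} → 0# < a → b * b ≤ fromℕ 4 * (a * k) →
                 ∀ x → b * x ≤ a * (x * x) + k
  discriminant {a} {b} {k} 0<a b²≤4ak x = *-cancelˡ-≤ (*-positive (fromℕ-positive 4) 0<a)
    (linear (+-mono-≤ (xy+xy≤xx+yy (fromℕ 2 * (a * x)) b) b²≤4ak)
      (solve 4 (λ a b k x →
          num 4 :* a :* (b :* x) :+
            (num 2 :* (a :* x) :* (num 2 :* (a :* x)) :+ b :* b :+ num 4 :* (a :* k))
        := num 4 :* a :* (a :* (x :* x) :+ k) :+
            (num 2 :* (a :* x) :* b :+ num 2 :* (a :* x) :* b :+ b :* b)) refl a b k x))

  -- Finite sums, sums over all indices but one, and the Cauchy-Schwarz inequality.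

  open SemiringSum semiring using (sum)
  open SemiringSum semiring public
    using (sum-cong-≋; sum-replicate-zero; ∑-distrib-+; ∑-comm; *-distribˡ-sum; *-distribʳ-sum)

  sum-mono-≤ : ∀ {n} {f g : Fin n → Carrier} → (∀ i → f i ≤ g i) → sum f ≤ sum g
  sum-mono-≤ {ℕ.zero}  f≤g = ≤-refl
  sum-mono-≤ {ℕ.suc n} f≤g = +-mono-≤ (f≤g zero) (sum-mono-≤ λ i → f≤g (suc i))

  sum-nonneg : ∀ {n} {f : Fin n → Carrier} → (∀ i → 0# ≤ f i) → 0# ≤ sum f
  sum-nonneg {ℕ.zero}  f≥0 = ≤-refl
  sum-nonneg {ℕ.suc n} f≥0 = +-nonneg (f≥0 zero) (sum-nonneg λ i → f≥0 (suc i))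

  sum-δ : ∀ {n} (i : Fin n) (f : Fin n → Carrier) → sum (λ k → if does (i Fin.≟ k) then f k else 0#) ≈ f i
  sum-δ {ℕ.suc n} zero    f = trans (+-congˡ (sum-replicate-zero n)) (+-identityʳ (f zero))
  sum-δ {ℕ.suc n} (suc i) f = trans (+-identityˡ _) (sum-δ i (f ∘ suc))

  -- The entry at `j` is zeroed instead of dropped, so that the laws of sums over `Fin n` apply to
  -- `others` as they stand.
  except : ∀ {n} → Fin n → (Fin n → Carrier) → Fin n → Carrier
  except j f i = if does (j Fin.≟ i) then 0# else f i

  others : ∀ {n} → Fin n → (Fin n → Carrier) → Carrier
  others j f = sum (except j f)

  sum-remove-at : ∀ {n} (j : Fin n) f → sum f ≈ f j + others j f
  sum-remove-at j f = trans (sum-cong-≋ split) (trans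
    (∑-distrib-+ (λ i → if does (j Fin.≟ i) then f i else 0#) (except j f))
    (+-congʳ (sum-δ j f)))
    where
    split : ∀ i → f i ≈ (if does (j Fin.≟ i) then f i else 0#) + except j f i
    split i with does (j Fin.≟ i)
    ... | true  = sym (+-identityʳ (f i))
    ... | false = sym (+-identityˡ (f i))

  others-nonneg : ∀ {n} (j : Fin n) {f} → (∀ i → 0# ≤ f i) → 0# ≤ others j f
  others-nonneg j {f} f≥0 = sum-nonneg except≥0
    where
    except≥0 : ∀ i → 0# ≤ except j f i
    except≥0 i with does (j Fin.≟ i)
    ... | true  = ≤-refl
    ... | false = f≥0 i

  others-mono-≤ : ∀ {n} (j : Fin n) {f g} → (∀ i → j ≢ i → f i ≤ g i) → others j f ≤ others j g
  others-mono-≤ j {f} {g} f≤g = sum-mono-≤ le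
    where
    le : ∀ i → except j f i ≤ except j g i
    le i with j Fin.≟ i
    ... | yes _  = ≤-refl
    ... | no j≢i = f≤g i j≢i

  others-+ : ∀ {n} (j : Fin n) f g → others j (λ i → f i + g i) ≈ others j f + others j g
  others-+ j f g = trans (sum-cong-≋ λ i → if-+ (does (j Fin.≟ i)) (f i) (g i)) (∑-distrib-+ (except j f) (except j g))
    where
    if-+ : ∀ b x y → (if b then 0# else (x + y)) ≈ (if b then 0# else x) + (if b then 0# else y)
    if-+ true  x y = sym (+-identityˡ 0#)
    if-+ false x y = refl

  others-* : ∀ {n} (j : Fin n) y f → others j (λ i → y * f i) ≈ y * others j f
  others-* j y f = trans (sum-cong-≋ λ i → if-* (does (j Fin.≟ i)) (f i)) (sym (*-distribˡ-sum y (except j f)))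
    where
    if-* : ∀ b x → (if b then 0# else (y * x)) ≈ y * (if b then 0# else x)
    if-* true  x = sym (zeroʳ y)
    if-* false x = refl

  others-transpose : ∀ {n} (f : Fin n → Fin n → Carrier) →
                     sum (λ j → others j (f j)) ≈ sum (λ j → others j λ i → f i j)
  others-transpose f = trans (∑-comm λ j i → except j (f j) i)
    (sum-cong-≋ λ j → sum-cong-≋ λ i → flip-≟ i j)
    where
    flip-≟ : ∀ i j → except i (f i) j ≈ except j (λ i → f i j) i
    flip-≟ i j with i Fin.≟ j | j Fin.≟ i
    ... | yes _  | yes _  = refl
    ... | no _   | no _   = refl
    ... | yes eq | no neq = ⊥-elim (neq (≡.sym eq))
    ... | no neq | yes eq = ⊥-elim (neq (≡.sym eq))

  cross≤squares : ∀ {n} x (f : Fin n → Carrier) →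
                  x * sum f + x * sum f ≤ fromℕ n * (x * x) + sum (λ i → f i * f i)
  cross≤squares {ℕ.zero} x f = ≤-reflexive
    (solve 1 (λ x → x :* con 0 :+ x :* con 0 := con 0 :* (x :* x) :+ con 0) refl x)
  cross≤squares {ℕ.suc n} x f = linear (+-mono-≤ (xy+xy≤xx+yy x (f zero)) (cross≤squares x (f ∘ suc)))
    (solve 5 (λ x y S N Q →
        x :* (y :+ S) :+ x :* (y :+ S) :+ (x :* x :+ y :* y :+ (N :* (x :* x) :+ Q))
      := (con 1 :+ N) :* (x :* x) :+ (y :* y :+ Q) :+ (x :* y :+ x :* y :+ (x :* S :+ x :* S)))
      refl x (f zero) (sum (f ∘ suc)) (fromℕ n) (sum λ i → f (suc i) * f (suc i)))

  -- Cauchy-Schwarz against the constant vector; `cross≤squares` absorbs the products of the new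
  -- entry with the old ones. The factor `n` becomes the number of machines in the lower bound.
  sum²≤n*sum-squares : ∀ {n} (f : Fin n → Carrier) →
                       sum f * sum f ≤ fromℕ n * sum (λ i → f i * f i)
  sum²≤n*sum-squares {ℕ.zero} f = ≤-reflexive (solve 0 (con 0 :* con 0 := con 0 :* con 0) refl)
  sum²≤n*sum-squares {ℕ.suc n} f =
    linear (+-mono-≤ (cross≤squares (f zero) (f ∘ suc)) (sum²≤n*sum-squares (f ∘ suc)))
    (solve 4 (λ y S N Q →
        (y :+ S) :* (y :+ S) :+ (N :* (y :* y) :+ Q :+ N :* Q)
      := (con 1 :+ N) :* (y :* y :+ Q) :+ (y :* S :+ y :* S :+ S :* S))
      refl (f zero) (sum (f ∘ suc)) (fromℕ n) (sum λ i → f (suc i) * f (suc i)))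

  -- Sums over lists and positive semidefinite kernels.

  module _ {a} {A : Set a} where

    ∑ : (A → Carrier) → List A → Carrier
    ∑ f []       = 0#
    ∑ f (x ∷ xs) = f x + ∑ f xs

    ∑-mono-≤ : ∀ {f g xs} → All (λ x → f x ≤ g x) xs → ∑ f xs ≤ ∑ g xs
    ∑-mono-≤ []         = ≤-refl
    ∑-mono-≤ (le ∷ les) = +-mono-≤ le (∑-mono-≤ les)

    ∑-cong : ∀ {f g xs} → All (λ x → f x ≈ g x) xs → ∑ f xs ≈ ∑ g xs
    ∑-cong []         = refl
    ∑-cong (eq ∷ eqs) = +-cong eq (∑-cong eqs)

    ∑-cong′ : ∀ {f g} → (∀ x → f x ≈ g x) → ∀ xs → ∑ f xs ≈ ∑ g xs
    ∑-cong′ f≈g xs = ∑-cong (All.universal f≈g xs)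

    ∑-distrib-+′ : ∀ f g xs → ∑ (λ x → f x + g x) xs ≈ ∑ f xs + ∑ g xs
    ∑-distrib-+′ f g []       = sym (+-identityˡ 0#)
    ∑-distrib-+′ f g (x ∷ xs) = trans (+-congˡ (∑-distrib-+′ f g xs))
      (solve 4 (λ a b s t → a :+ b :+ (s :+ t) := a :+ s :+ (b :+ t))
        refl (f x) (g x) (∑ f xs) (∑ g xs))

    *-distribˡ-∑ : ∀ y f xs → y * ∑ f xs ≈ ∑ (λ x → y * f x) xs
    *-distribˡ-∑ y f []       = zeroʳ y
    *-distribˡ-∑ y f (x ∷ xs) = trans (distribˡ y (f x) (∑ f xs)) (+-congˡ (*-distribˡ-∑ y f xs))

    ∑-++ : ∀ f xs ys → ∑ f (xs ++ ys) ≈ ∑ f xs + ∑ f ys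
    ∑-++ f []       ys = sym (+-identityˡ (∑ f ys))
    ∑-++ f (x ∷ xs) ys = trans (+-congˡ (∑-++ f xs ys)) (sym (+-assoc (f x) (∑ f xs) (∑ f ys)))

    ∑-↭ : ∀ f {xs ys} → xs ↭ ys → ∑ f xs ≈ ∑ f ys
    ∑-↭ f Perm.refl = refl
    ∑-↭ f (Perm.prep x p) = +-congˡ (∑-↭ f p)
    ∑-↭ f (Perm.swap {xs} {ys} x y p) = trans (+-congˡ (+-congˡ (∑-↭ f p)))
      (solve 3 (λ x y s → x :+ (y :+ s) := y :+ (x :+ s)) refl (f x) (f y) (∑ f ys))
    ∑-↭ f (Perm.trans p q) = trans (∑-↭ f p) (∑-↭ f q)

    ∑∑ : (A → A → Carrier) → List A → Carrier
    ∑∑ φ xs = ∑ (λ x → ∑ (φ x) xs) xs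

    ∑∑-cong : ∀ {φ ψ} → (∀ x y → φ x y ≈ ψ x y) → ∀ xs → ∑∑ φ xs ≈ ∑∑ ψ xs
    ∑∑-cong φ≈ψ xs = ∑-cong′ (λ x → ∑-cong′ (φ≈ψ x) xs) xs

    ∑∑-distrib-+ : ∀ φ ψ xs → ∑∑ (λ x y → φ x y + ψ x y) xs ≈ ∑∑ φ xs + ∑∑ ψ xs
    ∑∑-distrib-+ φ ψ xs = trans
      (∑-cong′ (λ x → ∑-distrib-+′ (φ x) (ψ x) xs) xs)
      (∑-distrib-+′ (λ x → ∑ (φ x) xs) (λ x → ∑ (ψ x) xs) xs)

    *-distribˡ-∑∑ : ∀ y φ xs → y * ∑∑ φ xs ≈ ∑∑ (λ x x′ → y * φ x x′) xs
    *-distribˡ-∑∑ y φ xs = trans (*-distribˡ-∑ y (λ x → ∑ (φ x) xs) xs)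
      (∑-cong′ (λ x → *-distribˡ-∑ y (φ x) xs) xs)

    ∑∑-↭ : ∀ φ {xs ys} → xs ↭ ys → ∑∑ φ xs ≈ ∑∑ φ ys
    ∑∑-↭ φ {xs} {ys} p = trans (∑-cong′ (λ x → ∑-↭ (φ x) p) xs) (∑-↭ (λ x → ∑ (φ x) ys) p)

    ∑∑-∷ : ∀ φ x xs →
           ∑∑ φ (x ∷ xs) ≈ φ x x + ∑ (φ x) xs + ∑ (λ y → φ y x) xs + ∑∑ φ xs
    ∑∑-∷ φ x xs = trans (+-congˡ (∑-distrib-+′ (λ y → φ y x) (λ y → ∑ (φ y) xs) xs))
      (sym (+-assoc _ _ _))

    ∑-concatMap-tabulate : ∀ {b} {B : Set b} (g : A → Carrier) (e : B → List A) {n} (f : Fin n → B) →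
      ∑ g (concatMap e (tabulate f)) ≈ sum λ i → ∑ g (e (f i))
    ∑-concatMap-tabulate g e {ℕ.zero}  f = refl
    ∑-concatMap-tabulate g e {ℕ.suc n} f = trans (∑-++ g (e (f zero)) _)
      (+-congˡ (∑-concatMap-tabulate g e (f ∘ suc)))

    module _ (φ : A → A → Carrier) (∑∑φ≥0 : ∀ xs → 0# ≤ ∑∑ φ xs) (v : A → Carrier) where

      φ*min : A → A → Carrier
      φ*min x y = φ x y * min (v x) (v y)

      -- The Schur product with the kernel `min`, taken apart layer by layer. In a sorted list the
      -- head `x` has the least `v`, so its row and its column carry exactly the factor `v x`, and
      -- the remaining square carries at least that factor by induction. Nonnegativity of `∑∑ φ`,
      -- applied to each suffix, serves to raise the factor from `y` to `v x`.
      ∑∑φ*min≥y*∑∑φ : ∀ {y xs} → AllPairs (λ x x′ → v x ≤ v x′) xs → All (λ x → y ≤ v x) xs →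
                      y * ∑∑ φ xs ≤ ∑∑ φ*min xs
      ∑∑φ*min≥y*∑∑φ {y} [] [] = ≤-reflexive (zeroʳ y)
      ∑∑φ*min≥y*∑∑φ {y} {x ∷ xs} (x≤xs ∷ sorted) (y≤x ∷ _) = begin
        y * ∑∑ φ (x ∷ xs)
          ≤⟨ *-monoʳ-≤ (∑∑φ≥0 (x ∷ xs)) y≤x ⟩
        v x * ∑∑ φ (x ∷ xs)
          ≈⟨ *-congˡ (∑∑-∷ φ x xs) ⟩
        v x * (φ x x + ∑ (φ x) xs + ∑ (λ z → φ z x) xs + ∑∑ φ xs)
          ≈⟨ solve 5 (λ v d r c q → v :* (d :+ r :+ c :+ q) := v :* d :+ v :* r :+ v :* c :+ v :* q)
               refl (v x) (φ x x) (∑ (φ x) xs) (∑ (λ z → φ z x) xs) (∑∑ φ xs) ⟩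
        v x * φ x x + v x * ∑ (φ x) xs + v x * ∑ (λ z → φ z x) xs + v x * ∑∑ φ xs
          ≤⟨ +-monoʳ-≤ _ (∑∑φ*min≥y*∑∑φ sorted x≤xs) ⟩
        v x * φ x x + v x * ∑ (φ x) xs + v x * ∑ (λ z → φ z x) xs + ∑∑ φ*min xs
          ≈⟨ +-congʳ (+-cong (+-cong diagonal row) column) ⟩
        φ*min x x + ∑ (φ*min x) xs + ∑ (λ z → φ*min z x) xs + ∑∑ φ*min xs
          ≈⟨ ∑∑-∷ φ*min x xs ⟨
        ∑∑ φ*min (x ∷ xs) ∎
        where
        diagonal : v x * φ x x ≈ φ*min x x
        diagonal = trans (*-comm (v x) (φ x x)) (*-congˡ (sym (x≤y⇒x⊓y≈x ≤-refl)))

        row : v x * ∑ (φ x) xs ≈ ∑ (φ*min x) xs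
        row = trans (*-distribˡ-∑ (v x) (φ x) xs)
          (∑-cong (All.map (λ le → trans (*-comm _ _) (*-congˡ (sym (x≤y⇒x⊓y≈x le)))) x≤xs))

        column : v x * ∑ (λ z → φ z x) xs ≈ ∑ (λ z → φ*min z x) xs
        column = trans (*-distribˡ-∑ (v x) (λ z → φ z x) xs)
          (∑-cong (All.map (λ le → trans (*-comm _ _) (*-congˡ (sym (x≤y⇒y⊓x≈x le)))) x≤xs))

      private
        module S = Sort (On.decTotalOrder decTotalOrder v)

      ∑∑φ*min≥0 : (∀ x → 0# ≤ v x) → ∀ xs → 0# ≤ ∑∑ φ*min xs
      ∑∑φ*min≥0 v≥0 xs = begin
        0#                        ≈⟨ zeroˡ _ ⟨
        0# * ∑∑ φ (S.sort xs)     ≤⟨ ∑∑φ*min≥y*∑∑φ (Linked⇒AllPairs ≤-trans (S.sort-↗ xs))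
                                        (All.universal v≥0 _) ⟩
        ∑∑ φ*min (S.sort xs)      ≈⟨ ∑∑-↭ φ*min (S.sort-↭ xs) ⟩
        ∑∑ φ*min xs               ∎

    module _ {m} (κ : A → Fin m) (d : A → Carrier) where

      -- Oriented so that the row of `x` is `d x * load (κ x)` without turning an equality around.
      same : A → A → Carrier
      same x y = if does (κ y Fin.≟ κ x) then 1# else 0#

      load : Fin m → List A → Carrier
      load k = ∑ λ x → if does (κ x Fin.≟ k) then d x else 0#

      -- With constant `h` this says that the loads of the classes add up to the total; with `h` the
      -- load itself, it produces the sum of the squared loads.
      ∑-by-class : ∀ (h : Fin m → Carrier) xs → ∑ (λ x → d x * h (κ x)) xs ≈ sum (λ k → load k xs * h k)
      ∑-by-class h []       = sym (trans (sum-cong-≋ (λ k → zeroˡ (h k))) (sum-replicate-zero m))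
      ∑-by-class h (x ∷ xs) = begin-equality
        d x * h (κ x) + ∑ (λ y → d y * h (κ y)) xs
          ≈⟨ +-cong (sym (sum-δ (κ x) λ k → d x * h k)) (∑-by-class h xs) ⟩
        sum (λ k → if does (κ x Fin.≟ k) then d x * h k else 0#) + sum (λ k → load k xs * h k)
          ≈⟨ ∑-distrib-+ (λ k → if does (κ x Fin.≟ k) then d x * h k else 0#) (λ k → load k xs * h k) ⟨
        sum (λ k → (if does (κ x Fin.≟ k) then d x * h k else 0#) + load k xs * h k)
          ≈⟨ sum-cong-≋ (λ k → trans (+-congʳ (if-* (does (κ x Fin.≟ k)) k)) (sym (distribʳ (h k) _ _))) ⟩
        sum (λ k → load k (x ∷ xs) * h k) ∎
        where
        if-* : ∀ b k → (if b then d x * h k else 0#) ≈ (if b then d x else 0#) * h k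
        if-* true  k = refl
        if-* false k = sym (zeroˡ (h k))

      ∑²≤m*∑∑-same : ∀ xs → ∑∑ (λ x y → d x * d y) xs ≤ fromℕ m * ∑∑ (λ x y → same x y * (d x * d y)) xs
      ∑²≤m*∑∑-same xs = begin
        ∑∑ (λ x y → d x * d y) xs
          ≈⟨ ∑-cong′ (λ x → sym (*-distribˡ-∑ (d x) d xs)) xs ⟩
        ∑ (λ x → d x * ∑ d xs) xs
          ≈⟨ ∑-by-class (λ _ → ∑ d xs) xs ⟩
        sum (λ k → load k xs * ∑ d xs)
          ≈⟨ *-distribʳ-sum (∑ d xs) (λ k → load k xs) ⟨
        sum (λ k → load k xs) * ∑ d xs
          ≈⟨ *-congˡ (trans (∑-cong′ (λ x → sym (*-identityʳ (d x))) xs)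
               (trans (∑-by-class (λ _ → 1#) xs) (sum-cong-≋ λ k → *-identityʳ (load k xs)))) ⟩
        sum (λ k → load k xs) * sum (λ k → load k xs)
          ≤⟨ sum²≤n*sum-squares (λ k → load k xs) ⟩
        fromℕ m * sum (λ k → load k xs * load k xs)
          ≈⟨ *-congˡ (∑-by-class (λ k → load k xs) xs) ⟨
        fromℕ m * ∑ (λ x → d x * load (κ x) xs) xs
          ≈⟨ *-congˡ (∑-cong′ (λ x → trans (*-distribˡ-∑ (d x) _ xs)
               (∑-cong′ (λ y → *-if (does (κ y Fin.≟ κ x)) x y) xs)) xs) ⟩
        fromℕ m * ∑∑ (λ x y → same x y * (d x * d y)) xs ∎
        where
        *-if : ∀ b x y → d x * (if b then d y else 0#) ≈ (if b then 1# else 0#) * (d x * d y)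
        *-if true  x y = sym (*-identityˡ _)
        *-if false x y = trans (zeroʳ (d x)) (sym (zeroˡ _))

      -- The kernel m same - 1 is positive semidefinite by the Cauchy-Schwarz
      -- inequality, and stays so when multiplied by min (v x) (v y).
      ∑∑-min≤m*∑∑-same-min : ∀ (v : A → Carrier) → (∀ x → 0# ≤ v x) → ∀ xs →
        ∑∑ (λ x y → d x * d y * min (v x) (v y)) xs ≤
        fromℕ m * ∑∑ (λ x y → same x y * (d x * d y) * min (v x) (v y)) xs
      ∑∑-min≤m*∑∑-same-min v v≥0 xs = linear (∑∑φ*min≥0 φ ∑∑φ≥0 v v≥0 xs)
        (trans (trans (sym (∑∑-distrib-+ dd-min (φ*min φ ∑∑φ≥0 v) xs))
                      (trans (∑∑-cong split-min xs) (sym (*-distribˡ-∑∑ (fromℕ m) _ xs))))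
               (sym (+-identityʳ _)))
        where
        dd dd-min φ : A → A → Carrier
        dd x y = d x * d y
        dd-min x y = dd x y * min (v x) (v y)
        φ x y = fromℕ m * (same x y * dd x y) - dd x y

        split : ∀ x y → φ x y + dd x y ≈ fromℕ m * (same x y * dd x y)
        split x y = x-y+y≈x _ (dd x y)

        ∑∑φ≥0 : ∀ xs → 0# ≤ ∑∑ φ xs
        ∑∑φ≥0 xs = +-cancelʳ-≤ (∑∑ dd xs) (begin
          0# + ∑∑ dd xs         ≈⟨ +-identityˡ _ ⟩
          ∑∑ dd xs              ≤⟨ ∑²≤m*∑∑-same xs ⟩
          fromℕ m * ∑∑ (λ x y → same x y * dd x y) xs
                                ≈⟨ *-distribˡ-∑∑ (fromℕ m) _ xs ⟩
          ∑∑ (λ x y → fromℕ m * (same x y * dd x y)) xs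
                                ≈⟨ ∑∑-cong split xs ⟨
          ∑∑ (λ x y → φ x y + dd x y) xs
                                ≈⟨ ∑∑-distrib-+ φ dd xs ⟩
          ∑∑ φ xs + ∑∑ dd xs    ∎)

        split-min : ∀ x y → dd-min x y + φ x y * min (v x) (v y) ≈
                            fromℕ m * (same x y * dd x y * min (v x) (v y))
        split-min x y = trans (trans (sym (distribʳ μ (dd x y) (φ x y)))
                                     (*-congʳ (trans (+-comm (dd x y) (φ x y)) (split x y))))
                              (*-assoc (fromℕ m) _ μ)
          where
          μ = min (v x) (v y)

-- The tasks that a set of tested jobs requires.

module RequiredTasks {c ℓ₁ ℓ₂} (K : ArchimedeanField c ℓ₁ ℓ₂) where
  open Scheduling K
  open OrderedFieldProperties (ArchimedeanField.orderedField K)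

  Unique-resp-↭ : ∀ {a} {A : Set a} {xs ys : List A} → xs ↭ ys → Unique xs → Unique ys
  Unique-resp-↭ p = SetoidPerm.Unique-resp-↭ (≡.setoid _) (↭⇒↭ₛ p)

  job : ∀ {n} → Task n → Fin n
  job (test j)     = j
  job (exec j)     = j
  job (untested j) = j

  -- All the tasks that a queue entry stands for: the execution of a tested job enters the queue
  -- only after its test.
  withExecution : ∀ {n} → Task n → List (Task n)
  withExecution (test j)     = test j ∷ exec j ∷ []
  withExecution (exec j)     = exec j ∷ []
  withExecution (untested j) = untested j ∷ []

  initialTask : ∀ {n} → Subset n → Fin n → Task n
  initialTask ω j = if lookup ω j then test j else untested j

  tasks : ∀ {n} → Subset n → List (Task n)
  tasks ω = concatMap withExecution (tabulate (initialTask ω))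

  All-tasks : ∀ {n} {p} {P : Task n → Set p} (ω : Subset n) →
              (∀ j → All P (withExecution (initialTask ω j))) → All P (tasks ω)
  All-tasks ω Pj = All.concat⁺ (All.map⁺ (All.tabulate⁺ Pj))

  ∈⇒lookup : ∀ {n} {ω : Subset n} {j} → j ∈ₛ ω → lookup ω j ≡ true
  ∈⇒lookup = []=⇒lookup

  lookup⇒∈ : ∀ {n} {ω : Subset n} {j} → lookup ω j ≡ true → j ∈ₛ ω
  lookup⇒∈ {ω = ω} {j} = lookup⇒[]= j ω

  lookup⇒∉ : ∀ {n} {ω : Subset n} {j} → lookup ω j ≡ false → j ∉ₛ ω
  lookup⇒∉ eq j∈ω with () ← ≡.trans (≡.sym eq) (∈⇒lookup j∈ω)

  tasks-required : ∀ {n} (ω : Subset n) → All (Required ω) (tasks ω)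
  tasks-required ω = All-tasks ω required
    where
    required : ∀ j → All (Required ω) (withExecution (initialTask ω j))
    required j with lookup ω j in eq
    ... | true  = lookup⇒∈ eq ∷ lookup⇒∈ eq ∷ []
    ... | false = lookup⇒∉ eq ∷ []

  job-withExecution : ∀ {n} (k : Task n) → All (λ l → job l ≡ job k) (withExecution k)
  job-withExecution (test j)     = ≡.refl ∷ ≡.refl ∷ []
  job-withExecution (exec j)     = ≡.refl ∷ []
  job-withExecution (untested j) = ≡.refl ∷ []

  job-initialTask : ∀ {n} (ω : Subset n) j → job (initialTask ω j) ≡ j
  job-initialTask ω j with lookup ω j
  ... | true  = ≡.refl
  ... | false = ≡.refl

  tasks-unique : ∀ {n} (ω : Subset n) → Unique (tasks ω)
  tasks-unique ω = Unique.concat⁺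
    (All.map⁺ (All.tabulate⁺ λ j → unique (initialTask ω j)))
    (AllPairs.map⁺ (AllPairs.tabulate⁺ disjoint))
    where
    unique : ∀ k → Unique (withExecution k)
    unique (test j)     = ((λ ()) ∷ []) ∷ [] ∷ []
    unique (exec j)     = [] ∷ []
    unique (untested j) = [] ∷ []

    job-of : ∀ {k} j → k ∈ withExecution (initialTask ω j) → job k ≡ j
    job-of j k∈ = ≡.trans (All.lookup (job-withExecution (initialTask ω j)) k∈) (job-initialTask ω j)

    disjoint : ∀ {i j} → i ≢ j →
               Disjoint (withExecution (initialTask ω i)) (withExecution (initialTask ω j))
    disjoint i≢j (k∈i , k∈j) = i≢j (≡.trans (≡.sym (job-of _ k∈i)) (job-of _ k∈j))

  module _ {n} (I : Instance n) where
    open Instance I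

    work : Bool → Fin n → Carrier
    work b j = if b then t j + p j else u j

    duration-nonneg : ∀ k → 0# ≤ duration I k
    duration-nonneg (test j)     = <⇒≤ (t>0 j)
    duration-nonneg (exec j)     = p≥0 j
    duration-nonneg (untested j) = <⇒≤ (u>0 j)

    work-positive : ∀ b j → 0# < work b j
    work-positive true  j = +-positive (t>0 j) (p≥0 j)
    work-positive false j = u>0 j

    ∑-tasks : ∀ ω (g : Task n → Carrier) →
              ∑ g (tasks ω) ≈ sum λ j → ∑ g (withExecution (initialTask ω j))
    ∑-tasks ω g = ∑-concatMap-tabulate g withExecution (initialTask ω)

    ∑-tasks-by-job : ∀ ω (g : Fin n → Carrier) →
      ∑ (λ k → duration I k * g (job k)) (tasks ω) ≈ sum λ j → work (lookup ω j) j * g j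
    ∑-tasks-by-job ω g = trans (∑-tasks ω _) (sum-cong-≋ by-job)
      where
      by-job : ∀ j → ∑ (λ k → duration I k * g (job k)) (withExecution (initialTask ω j)) ≈
                     work (lookup ω j) j * g j
      by-job j with lookup ω j
      ... | true  = trans (+-congˡ (+-identityʳ _)) (sym (distribʳ (g j) (t j) (p j)))
      ... | false = +-identityʳ _

-- The lower bound of Eastman, Even and Isaacs on the cost of OPT, by mean busy
-- times: a job of work w that completes at C satisfies 2 C ≥ w + 2 M, where
-- w M is the integral of the time over the execution of its tasks.
module LowerBound {c ℓ₁ ℓ₂} (K : ArchimedeanField c ℓ₁ ℓ₂) where
  open Scheduling K
  open OrderedFieldProperties (ArchimedeanField.orderedField K)
  open RequiredTasks K
  open ≤-Reasoning poset hiding (start)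

  module _ {n} (I : Instance n) {m} (S : Schedule m n) where
    open Instance I
    open Schedule S

    private
      d = duration I

    twiceMoment : Task n → Carrier
    twiceMoment k = two * (d k * start k) + d k * d k

    module _ (v : Task n → Carrier) (v≥0 : ∀ k → 0# ≤ v k) where

      kernel : Task n → Task n → Carrier
      kernel k l = same machine d k l * (d k * d l) * min (v k) (v l)

      private
        weighted≥0 : ∀ k → 0# ≤ v k * d k
        weighted≥0 k = *-nonneg (v≥0 k) (duration-nonneg I k)

        min≤v : ∀ {κ} k l → κ ≤ v k → 0# ≤ d l → κ * (d l * d k) ≤ v k * d k * d l
        min≤v {κ} k l κ≤v 0≤d = begin
          κ * (d l * d k)    ≤⟨ *-monoʳ-≤ (*-nonneg 0≤d (duration-nonneg I k)) κ≤v ⟩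
          v k * (d l * d k)  ≈⟨ solve 3 (λ v a b → v :* (a :* b) := v :* b :* a) refl (v k) (d l) (d k) ⟩
          v k * d k * d l    ∎

        -- For `k` before `l` it is the moment of `l` that pays for both ordered pairs, so here and
        -- in `column≤` the minimum is bounded by `v l`.
        row≤ : ∀ k l → kernel k l ≤ v l * d l * (if does (machine k Fin.≟ machine l) then d k else 0#)
        row≤ k l with machine l Fin.≟ machine k | machine k Fin.≟ machine l
        ... | yes _  | yes _  = ≤-trans
          (≤-reflexive (solve 3 (λ a b μ → con 1 :* (a :* b) :* μ := μ :* (a :* b)) refl (d k) (d l) _))
          (min≤v l k (x⊓y≤y (v k) (v l)) (duration-nonneg I k))
        ... | no  _  | no  _  = ≤-reflexive
          (solve 4 (λ a b μ v → con 0 :* (a :* b) :* μ := v :* b :* con 0) refl (d k) (d l) _ (v l))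
        ... | yes eq | no neq = ⊥-elim (neq (≡.sym eq))
        ... | no neq | yes eq = ⊥-elim (neq (≡.sym eq))

        column≤ : ∀ k l → kernel l k ≤ v l * d l * (if does (machine k Fin.≟ machine l) then d k else 0#)
        column≤ k l with does (machine k Fin.≟ machine l)
        ... | true  = ≤-trans
          (≤-reflexive (solve 3 (λ a b μ → con 1 :* (b :* a) :* μ := μ :* (a :* b)) refl (d k) (d l) _))
          (min≤v l k (x⊓y≤x (v l) (v k)) (duration-nonneg I k))
        ... | false = ≤-reflexive
          (solve 4 (λ a b μ v → con 0 :* (b :* a) :* μ := v :* b :* con 0) refl (d k) (d l) _ (v l))

        diagonal≤ : ∀ k → kernel k k ≤ v k * d k * d k
        diagonal≤ k with does (machine k Fin.≟ machine k)
        ... | true  = ≤-trans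
          (≤-reflexive (solve 2 (λ a μ → con 1 :* (a :* a) :* μ := μ :* (a :* a)) refl (d k) _))
          (min≤v k k (x⊓y≤x (v k) (v k)) (duration-nonneg I k))
        ... | false = ≤-respˡ
          (sym (trans (*-congʳ (zeroˡ _)) (zeroˡ _)))
          (*-nonneg (weighted≥0 k) (duration-nonneg I k))

      -- Induction along the order of execution. `busy i` is the time that machine `i` has spent on
      -- tasks before `ks`, and the second summand on the left records what the pairs with those
      -- tasks contribute. Moving `k` from the list into `busy′` turns its row and column into an
      -- increase of that summand.
      kernel≤moments : (busy : Fin m → Carrier) → ∀ {ks} →
        AllPairs (λ k l → machine k ≡ machine l → end I S k ≤ start l) ks →
        All (λ k → busy (machine k) ≤ start k) ks →
        ∑∑ kernel ks + two * ∑ (λ k → v k * d k * busy (machine k)) ks ≤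
        ∑ (λ k → v k * twiceMoment k) ks
      kernel≤moments busy [] [] = ≤-reflexive (trans (+-identityˡ _) (zeroʳ two))
      kernel≤moments busy {k ∷ ks} (after-k ∷ ordered) (busy≤k ∷ busy≤) =
        linear
          (+-mono-≤ (+-mono-≤ (+-mono-≤ (+-mono-≤
            (kernel≤moments busy′ ordered (All.zipWith busy′≤ (after-k , busy≤)))
            (∑-mono-≤ (All.universal (row≤ k) ks)))
            (∑-mono-≤ (All.universal (column≤ k) ks)))
            (diagonal≤ k))
            (*-monoˡ-≤ (weighted≥0 k) (+-mono-≤ busy≤k busy≤k)))
          (trans (+-congʳ (+-congʳ (∑∑-∷ kernel k ks)))
          (trans
            (solve 11 (λ diag row col ov v d b s L M R →
                diag :+ row :+ col :+ ov :+ num 2 :* (v :* d :* b :+ L) :+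
                  (R :+ M :+ M :+ v :* d :* d :+ v :* d :* (s :+ s))
              := v :* (num 2 :* (d :* s) :+ d :* d) :+ R :+
                  (ov :+ num 2 :* (L :+ M) :+ row :+ col :+ diag :+ v :* d :* (b :+ b)))
              refl (kernel k k) (∑ (kernel k) ks) (∑ (λ l → kernel l k) ks) (∑∑ kernel ks)
              (v k) (d k) (busy (machine k)) (start k)
              (∑ (λ l → v l * d l * busy (machine l)) ks) (∑ added ks) (∑ (λ l → v l * twiceMoment l) ks))
            (+-congˡ (+-congʳ (+-congʳ (+-congʳ (+-congʳ (+-congˡ (*-congˡ (sym split))))))))))
        where
        busy′ : Fin m → Carrier
        busy′ i = busy i + (if does (machine k Fin.≟ i) then d k else 0#)

        added : Task n → Carrier
        added l = v l * d l * (if does (machine k Fin.≟ machine l) then d k else 0#)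

        split : ∑ (λ l → v l * d l * busy′ (machine l)) ks ≈
                ∑ (λ l → v l * d l * busy (machine l)) ks + ∑ added ks
        split = trans (∑-cong′ (λ l → distribˡ _ _ _) ks) (∑-distrib-+′ _ added ks)

        busy′≤ : ∀ {l} → (machine k ≡ machine l → end I S k ≤ start l) × busy (machine l) ≤ start l →
                 busy′ (machine l) ≤ start l
        busy′≤ {l} (k-first , le) with machine k Fin.≟ machine l
        ... | yes eq = ≤-trans
          (+-monoˡ-≤ (d k) (≤-respˡ (reflexive (≡.cong busy eq)) busy≤k)) (k-first eq)
        ... | no  _  = ≤-respˡ (sym (+-identityʳ _)) le

    module _ {ω : Subset n} (feasible : Feasible I S ω) where
      open Feasible feasible

      private
        e = end I S
        w : Fin n → Carrier
        w j = work I (lookup ω j) j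
        w>0 : ∀ j → 0# < w j
        w>0 j = work-positive I (lookup ω j) j
        v : Task n → Carrier
        v k = w (job k) ⁻¹
        v≥0 : ∀ k → 0# ≤ v k
        v≥0 k = ⁻¹-nonneg (w>0 (job k))
        module S = Sort (On.decTotalOrder decTotalOrder (λ k → start k + e k))

        w-cancel : ∀ j x → w j * (w j ⁻¹ * x) ≈ x
        w-cancel j x = trans (solve 3 (λ a b x → a :* (b :* x) := b :* (a :* x)) refl (w j) (w j ⁻¹) x)
          (*⁻¹-cancel (w>0 j) x)

        v-cancel : ∀ j {b} → lookup ω j ≡ b → ∀ x → w j ⁻¹ * (work I b j * x) ≈ x
        v-cancel j ≡.refl = *⁻¹-cancel (w>0 j)

      -- Tasks of duration 0 are why the list is sorted by start + end.
      sorted⇒consecutive : ∀ {k l} → e k ≤ start l ⊎ e l ≤ start k →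
                           start k + e k ≤ start l + e l → e k ≤ start l
      sorted⇒consecutive         (inj₁ le) _   = le
      sorted⇒consecutive {k} {l} (inj₂ le) key = linear (+-mono-≤ key le)
        (solve 4 (λ sk ek sl el → ek :+ (sl :+ el :+ sk) := sl :+ (sk :+ ek :+ el))
          refl (start k) (e k) (start l) (e l))

      -- An untested job attains equality. For a tested job the two sides, scaled by the work,
      -- differ by `2 t` times the gap between the end of the test and the start of the execution.
      job-moments : ∀ j →
        ∑ (λ k → v k * twiceMoment k) (withExecution (initialTask ω j)) + w j ≤ two * e (lastTask ω j)
      job-moments j with lookup ω j in eq
      ... | false = ≤-reflexive (trans
        (+-congʳ (trans (+-identityʳ _) (trans
          (*-congˡ (solve 2 (λ u s → num 2 :* (u :* s) :+ u :* u := u :* (num 2 :* s :+ u))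
            refl (u j) (start (untested j))))
          (v-cancel j eq _))))
        (solve 2 (λ u s → num 2 :* s :+ u :+ u := num 2 :* (s :+ u)) refl (u j) (start (untested j))))
      ... | true = begin
        V * M₁ + (V * M₂ + 0#) + W    ≈⟨ +-congˡ (v-cancel j eq W) ⟨
        V * M₁ + (V * M₂ + 0#) + V * (W * W)
          ≈⟨ solve 4 (λ v a b c → v :* a :+ (v :* b :+ con 0) :+ v :* c := v :* (a :+ b :+ c))
               refl V M₁ M₂ (W * W) ⟩
        V * (M₁ + M₂ + W * W)
          ≤⟨ *-monoˡ-≤ (v≥0 (exec j)) (linear (*-monoˡ-≤ (<⇒≤ (+-positive (t>0 j) (<⇒≤ (t>0 j))))
               (test-first j (lookup⇒∈ eq)))
             (solve 4 (λ t p s₁ s₂ →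
                 num 2 :* (t :* s₁) :+ t :* t :+ (num 2 :* (p :* s₂) :+ p :* p) :+
                   (t :+ p) :* (t :+ p) :+ (t :+ t) :* s₂
               := (t :+ p) :* (num 2 :* (s₂ :+ p)) :+ (t :+ t) :* (s₁ :+ t))
               refl (t j) (p j) (start (test j)) (start (exec j)))) ⟩
        V * (W * (two * e (exec j)))  ≈⟨ v-cancel j eq _ ⟩
        two * e (exec j)              ∎
        where
        V  = v (exec j)
        W  = t j + p j
        M₁ = twiceMoment (test j)
        M₂ = twiceMoment (exec j)

      moments+work≤2cost : ∑ (λ k → v k * twiceMoment k) (tasks ω) + sum w ≤ two * cost I S ω
      moments+work≤2cost = begin
        ∑ (λ k → v k * twiceMoment k) (tasks ω) + sum w
          ≈⟨ +-congʳ (∑-tasks I ω _) ⟩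
        sum (λ j → ∑ (λ k → v k * twiceMoment k) (withExecution (initialTask ω j))) + sum w
          ≈⟨ ∑-distrib-+ _ w ⟨
        sum (λ j → ∑ (λ k → v k * twiceMoment k) (withExecution (initialTask ω j)) + w j)
          ≤⟨ sum-mono-≤ job-moments ⟩
        sum (λ j → two * e (lastTask ω j))
          ≈⟨ *-distribˡ-sum two (λ j → e (lastTask ω j)) ⟨
        two * cost I S ω ∎

      work≤cost : sum w ≤ cost I S ω
      work≤cost = sum-mono-≤ work≤
        where
        work≤ : ∀ j → w j ≤ e (lastTask ω j)
        work≤ j with lookup ω j in eq
        ... | false = ≤-respˡ (+-identityˡ _) (+-monoˡ-≤ (u j) (start≥0 (untested j) (lookup⇒∉ eq)))
        ... | true  = +-monoˡ-≤ (p j) (begin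
          t j                     ≈⟨ +-identityˡ (t j) ⟨
          0# + t j                ≤⟨ +-monoˡ-≤ (t j) (start≥0 (test j) (lookup⇒∈ eq)) ⟩
          start (test j) + t j    ≤⟨ test-first j (lookup⇒∈ eq) ⟩
          start (exec j)          ∎)

      kernel≤twice-moments : ∑∑ (kernel v v≥0) (tasks ω) ≤ ∑ (λ k → v k * twiceMoment k) (tasks ω)
      kernel≤twice-moments = begin
        ∑∑ κ (tasks ω)
          ≈⟨ ∑∑-↭ κ sorted↭ ⟨
        ∑∑ κ sorted
          ≈⟨ +-identityʳ _ ⟨
        ∑∑ κ sorted + 0#
          ≈⟨ +-congˡ (trans (*-congˡ (trans (∑-cong′ (λ k → zeroʳ (v k * d k)) sorted) (∑-0 sorted))) (zeroʳ two)) ⟨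
        ∑∑ κ sorted + two * ∑ (λ k → v k * d k * 0#) sorted
          ≤⟨ kernel≤moments v v≥0 (λ _ → 0#) consecutive (All.map (start≥0 _) required) ⟩
        ∑ (λ k → v k * twiceMoment k) sorted
          ≈⟨ ∑-↭ _ sorted↭ ⟩
        ∑ (λ k → v k * twiceMoment k) (tasks ω) ∎
        where
        κ = kernel v v≥0
        sorted = S.sort (tasks ω)
        sorted↭ = S.sort-↭ (tasks ω)

        required : All (Required ω) sorted
        required = Perm.All-resp-↭ (↭-sym sorted↭) (tasks-required ω)

        ∑-0 : ∀ ks → ∑ {A = Task n} (λ _ → 0#) ks ≈ 0#
        ∑-0 []       = refl
        ∑-0 (_ ∷ ks) = trans (+-identityˡ _) (∑-0 ks)

        go : ∀ {ks} → All (Required ω) ks → Unique ks → AllPairs (λ k l → start k + e k ≤ start l + e l) ks →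
             AllPairs (λ k l → machine k ≡ machine l → e k ≤ start l) ks
        go []          _            _            = []
        go (rk ∷ rks) (k≢ ∷ uniq) (le ∷ les) =
          All.zipWith (λ { (rl , k≢l , key) eq → sorted⇒consecutive (disjoint _ _ rk rl k≢l eq) key })
            (rks , All.zip (k≢ , le))
          ∷ go rks uniq les

        consecutive : AllPairs (λ k l → machine k ≡ machine l → e k ≤ start l) sorted
        consecutive = go required (Unique-resp-↭ (↭-sym sorted↭) (tasks-unique ω))
          (Linked⇒AllPairs ≤-trans (S.sort-↗ (tasks ω)))

      ∑∑-min-work : sum (λ i → sum λ j → min (w i) (w j)) ≤
                    ∑∑ (λ k l → d k * d l * min (v k) (v l)) (tasks ω)
      ∑∑-min-work = begin
        sum (λ i → sum λ j → min (w i) (w j))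
          ≤⟨ sum-mono-≤ (λ i → sum-mono-≤ (λ j → min≤ i j)) ⟩
        sum (λ i → sum λ j → w i * (w j * min (w i ⁻¹) (w j ⁻¹)))
          ≈⟨ sum-cong-≋ (λ i → *-distribˡ-sum (w i) (λ j → w j * min (w i ⁻¹) (w j ⁻¹))) ⟨
        sum (λ i → w i * sum λ j → w j * min (w i ⁻¹) (w j ⁻¹))
          ≈⟨ ∑-tasks-by-job I ω _ ⟨
        ∑ (λ k → d k * sum λ j → w j * min (v k) (w j ⁻¹)) (tasks ω)
          ≈⟨ ∑-cong′ (λ k → *-congˡ (∑-tasks-by-job I ω (λ j → min (v k) (w j ⁻¹)))) (tasks ω) ⟨
        ∑ (λ k → d k * ∑ (λ l → d l * min (v k) (v l)) (tasks ω)) (tasks ω)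
          ≈⟨ ∑-cong′ (λ k → trans (*-distribˡ-∑ (d k) _ (tasks ω))
               (∑-cong′ (λ l → sym (*-assoc (d k) (d l) _)) (tasks ω))) (tasks ω) ⟩
        ∑∑ (λ k l → d k * d l * min (v k) (v l)) (tasks ω) ∎
        where
        min≤ : ∀ i j → min (w i) (w j) ≤ w i * (w j * min (w i ⁻¹) (w j ⁻¹))
        -- The inner `min` unfolds by this comparison, so the product becomes `w j` or `w i`, each
        -- of which is at least `min (w i) (w j)`.
        min≤ i j with total (w i ⁻¹) (w j ⁻¹)
        ... | inj₁ _ = ≤-respʳ (sym (trans (*-congˡ (*-comm (w j) _)) (w-cancel i (w j)))) (x⊓y≤y (w i) (w j))
        ... | inj₂ _ = ≤-respʳ
          (sym (trans (*-congˡ (trans (sym (*-identityʳ _)) (trans (*-assoc _ _ _) (w-cancel j 1#))))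
            (*-identityʳ _)))
          (x⊓y≤x (w i) (w j))

      lower-bound : fromℕ m * sum w + sum (λ i → sum λ j → min (w i) (w j)) ≤
                    fromℕ m * (two * cost I S ω)
      lower-bound = begin
        fromℕ m * sum w + sum (λ i → sum λ j → min (w i) (w j))
          ≤⟨ +-monoʳ-≤ _ (≤-trans ∑∑-min-work (∑∑-min≤m*∑∑-same-min machine d v v≥0 (tasks ω))) ⟩
        fromℕ m * sum w + fromℕ m * ∑∑ (kernel v v≥0) (tasks ω)
          ≈⟨ distribˡ (fromℕ m) _ _ ⟨
        fromℕ m * (sum w + ∑∑ (kernel v v≥0) (tasks ω))
          ≤⟨ *-monoˡ-≤ (fromℕ-nonneg m) (≤-trans (+-monoʳ-≤ _ kernel≤twice-moments)
               (≤-respˡ (+-comm _ _) moments+work≤2cost)) ⟩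
        fromℕ m * (two * cost I S ω) ∎

-- Runs of the algorithm and their histories.

module ListScheduling {c ℓ₁ ℓ₂} (K : ArchimedeanField c ℓ₁ ℓ₂) where
  open Scheduling K
  open OrderedFieldProperties (ArchimedeanField.orderedField K)
  open RequiredTasks K
  open PermutationReasoning hiding (start)

  concatMap-↭ : ∀ {a b} {A : Set a} {B : Set b} (g : A → List B) {xs ys} →
                xs ↭ ys → concatMap g xs ↭ concatMap g ys
  concatMap-↭ g Perm.refl         = ↭-refl
  concatMap-↭ g (Perm.prep x p)   = Perm.++⁺ˡ (g x) (concatMap-↭ g p)
  concatMap-↭ g (Perm.swap x y p) =
    ↭-trans (Perm.++⁺ˡ (g x) (Perm.++⁺ˡ (g y) (concatMap-↭ g p))) (Perm.shifts (g x) (g y))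
  concatMap-↭ g (Perm.trans p q)  = ↭-trans (concatMap-↭ g p) (concatMap-↭ g q)

  module _ {n} (I : Instance n) (β : Carrier) {m} (S : Schedule m n) where
    open Instance I
    open Schedule S

    private
      d = duration I
      e = end I S
      wt = weight I β

    -- In a history the task dispatched last comes first.
    Immediate : Task n → Set _
    Immediate k = ∃ λ j → k ≡ exec j × start k ≈ e (test j)

    -- The second alternative is the load argument of list scheduling: a task taken from the queue
    -- starts at the least idle time, and the idle times of the `m` machines add up to at most the
    -- work dispatched so far.
    Dispatched : List (Task n) → Task n → Set _
    Dispatched h k =
      (Immediate k ⊎ (fromℕ m * start k ≤ ∑ d h × All (λ l → wt l ≤ wt k) h)) ×
      (∀ j → k ≡ exec j → test j ∈ h)

    data History : List (Task n) → Set (c Level.⊔ ℓ₁ Level.⊔ ℓ₂) where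
      []  : History []
      _∷_ : ∀ {k h} → Dispatched h k → History h → History (k ∷ h)

    -- Executions owed by tests that are running: these are neither in the queue nor in the history.
    pending : ∀ {m} → Vec (Status I) m → List (Task n)
    pending []      = []
    pending (s ∷ M) = inserted I s ++ pending M

    -- For `fresh` the value 0 is the actual idle time. For `retired` it is a mere default, which is
    -- why the bound in `busy` comes with the absence of retired machines.
    idleTime : Status I → Carrier
    idleTime (running _ f) = f
    idleTime _             = 0#

    totalIdleTime : ∀ {m} → Vec (Status I) m → Carrier
    totalIdleTime []      = 0#
    totalIdleTime (s ∷ M) = idleTime s + totalIdleTime M

    pending-↭ : ∀ {m} (M : Vec (Status I) m) i →
                pending M ↭ inserted I (lookup M i) ++ pending (M [ i ]≔ retired)
    pending-↭ (s ∷ M) zero    = ↭-refl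
    pending-↭ (s ∷ M) (suc i) = begin
      inserted I s ++ pending M              ↭⟨ Perm.++⁺ˡ (inserted I s) (pending-↭ M i) ⟩
      inserted I s ++ (ins ++ rest)          ↭⟨ Perm.shifts (inserted I s) ins ⟩
      ins ++ (inserted I s ++ rest)          ∎
      where
      ins  = inserted I (lookup M i)
      rest = pending (M [ i ]≔ retired)

    totalIdleTime-≔ : ∀ {m} (M : Vec (Status I) m) i s →
      totalIdleTime (M [ i ]≔ s) + idleTime (lookup M i) ≈ totalIdleTime M + idleTime s
    totalIdleTime-≔ (r ∷ M) zero    s =
      solve 3 (λ r s x → s :+ x :+ r := r :+ x :+ s) refl (idleTime r) (idleTime s) (totalIdleTime M)
    totalIdleTime-≔ (r ∷ M) (suc i) s =
      trans (+-assoc _ _ _) (trans (+-congˡ (totalIdleTime-≔ M i s)) (sym (+-assoc _ _ _)))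

    m*x≤totalIdleTime : ∀ {m} (M : Vec (Status I) m) {x} → (∀ i → x ≤ idleTime (lookup M i)) →
                        fromℕ m * x ≤ totalIdleTime M
    m*x≤totalIdleTime []      {x} le = ≤-reflexive (zeroˡ x)
    m*x≤totalIdleTime (s ∷ M) {x} le = ≤-respˡ (sym (trans (distribʳ x 1# _) (+-congʳ (*-identityˡ x))))
      (+-mono-≤ (le zero) (m*x≤totalIdleTime M (λ i → le (suc i))))

    idleAt⇒idleTime : ∀ {s x} → _IdleAt_ I s x → idleTime s ≡ x
    idleAt⇒idleTime fresh   = ≡.refl
    idleAt⇒idleTime running = ≡.refl

    idleAt-idleTime : ∀ s → s ≢ retired → _IdleAt_ I s (idleTime s)
    idleAt-idleTime fresh         _  = fresh
    idleAt-idleTime (running _ _) _  = running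
    idleAt-idleTime retired       ≢r = ⊥-elim (≢r ≡.refl)

    module _ (ω : Subset n) where

      -- ordered is the heart of the analysis: an insertion is followed at once
      -- by the extraction of a task of smallest weight, so that no task in the
      -- queue ever weighs less than a task dispatched before.
      record Invariant (h q : List (Task n)) (M : Vec (Status I) m) : Set (c Level.⊔ ℓ₁ Level.⊔ ℓ₂) where
        field
          history     : History h
          conserved   : concatMap withExecution q ++ pending M ++ h ↭ tasks ω
          ordered     : ∀ {l k} → l ∈ h → k ∈ q → wt l ≤ wt k
          tested      : ∀ {j} → exec j ∈ q → test j ∈ h
          run         : ∀ {i k f} → lookup M i ≡ running k f → f ≈ e k × k ∈ h
          busy        : q ≡ [] ⊎ ((∀ i → lookup M i ≢ retired) × totalIdleTime M ≤ ∑ d h)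

      concatMap-inserted : ∀ s → concatMap withExecution (inserted I s) ≡ inserted I s
      concatMap-inserted fresh                    = ≡.refl
      concatMap-inserted retired                  = ≡.refl
      concatMap-inserted (running (test j) f)     = ≡.refl
      concatMap-inserted (running (exec j) f)     = ≡.refl
      concatMap-inserted (running (untested j) f) = ≡.refl

      withExecution-∷ : ∀ k f → withExecution k ≡ k ∷ inserted I (running k f)
      withExecution-∷ (test j)     f = ≡.refl
      withExecution-∷ (exec j)     f = ≡.refl
      withExecution-∷ (untested j) f = ≡.refl

      ∈-inserted : ∀ {s k} → k ∈ inserted I s → ∃ λ j → ∃ λ f → s ≡ running (test j) f × k ≡ exec j
      ∈-inserted {running (test j) f} (here ≡.refl) = j , f , ≡.refl , ≡.refl

      retire-invariant : ∀ {h q M} i → inserted I (lookup M i) ++ q ≡ [] → Invariant h q M →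
                         Invariant h [] (M [ i ]≔ retired)
      retire-invariant {h} {q} {M} i empty inv = record
        { history   = history
        ; conserved = ↭-trans (Perm.++⁺ʳ h pending-retired)
          (≡.subst (λ q → concatMap withExecution q ++ pending M ++ h ↭ tasks ω) q≡[] conserved)
        ; ordered   = λ _ ()
        ; tested    = λ ()
        ; run       = run′
        ; busy      = inj₁ ≡.refl
        }
        where
        open Invariant inv
        q≡[] : q ≡ []
        q≡[] = ++-conicalʳ (inserted I (lookup M i)) q empty

        pending-retired : pending (M [ i ]≔ retired) ↭ pending M
        pending-retired = ↭-sym (≡.subst (λ ins → pending M ↭ ins ++ pending (M [ i ]≔ retired))
          (++-conicalˡ (inserted I (lookup M i)) q empty) (pending-↭ M i))

        run′ : ∀ {i′ k f} → lookup (M [ i ]≔ retired) i′ ≡ running k f → f ≈ e k × k ∈ h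
        run′ {i′} eq with i′ Fin.≟ i
        ... | yes ≡.refl with () ← ≡.trans (≡.sym (lookup∘update i M retired)) eq
        ... | no  i′≢i = run (≡.trans (≡.sym (lookup∘update′ i′≢i M retired)) eq)

      dispatch-invariant : ∀ {h q M} i f → NextIdle I M i f →
        ∀ k q′ → k ∷ q′ ↭ inserted I (lookup M i) ++ q → All (λ l → wt k ≤ wt l) q′ →
        start k ≈ f → Invariant h q M → Invariant (k ∷ h) q′ (M [ i ]≔ running k (f + d k))
      dispatch-invariant {h} {q} {M} i f (idle , earliest) k q′ perm lightest start≈f inv = record
        { history   = dispatched ∷ history
        ; conserved = conserved′
        ; ordered   = ordered′
        ; tested    = tested′
        ; run       = run′
        ; busy      = busy′
        }
        where
        open Invariant inv
        ins = inserted I (lookup M i)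
        s   = running k (f + d k)
        M′  = M [ i ]≔ s

        origin : ∀ {l} → l ∈ k ∷ q′ → l ∈ ins ⊎ l ∈ q
        origin l∈ = ∈-++⁻ ins (Perm.∈-resp-↭ perm l∈)

        exec-tested : ∀ {j} → exec j ∈ ins ⊎ exec j ∈ q → test j ∈ h
        exec-tested (inj₂ ∈q) = tested ∈q
        exec-tested (inj₁ ∈ins) with _ , _ , eq , ≡.refl ← ∈-inserted ∈ins = proj₂ (run eq)

        immediate : k ∈ ins → Immediate k
        immediate k∈ins with j , f′ , eq , k≡ ← ∈-inserted k∈ins =
          j , k≡ , trans start≈f (trans (reflexive (idle-running eq)) (proj₁ (run eq)))
          where
          idle-running : ∀ {l f′} → lookup M i ≡ running l f′ → f ≡ f′
          idle-running eq = ≡.trans (≡.sym (idleAt⇒idleTime idle)) (≡.cong idleTime eq)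

        m*start≤ : (∀ i → lookup M i ≢ retired) → totalIdleTime M ≤ ∑ d h → fromℕ m * start k ≤ ∑ d h
        m*start≤ ≢retired le = ≤-trans
          (≤-respˡ (*-congˡ (sym start≈f)) (m*x≤totalIdleTime M λ i′ →
            earliest i′ _ (idleAt-idleTime (lookup M i′) (≢retired i′))))
          le

        dispatched : Dispatched h k
        dispatched = how , λ { j ≡.refl → exec-tested (origin (here ≡.refl)) }
          where
          how : Immediate k ⊎ (fromℕ m * start k ≤ ∑ d h × All (λ l → wt l ≤ wt k) h)
          how with origin (here ≡.refl) | busy
          ... | inj₁ k∈ins | _                      = inj₁ (immediate k∈ins)
          ... | inj₂ ()    | inj₁ ≡.refl
          ... | inj₂ k∈q   | inj₂ (≢retired , load≤) =
            inj₂ (m*start≤ ≢retired load≤ , All.tabulate λ l∈h → ordered l∈h k∈q)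

        -- If l was inserted now, then k was either taken from the queue or is l
        -- itself, in which case there is another copy of l in the queue.
        ordered′ : ∀ {l l′} → l ∈ k ∷ h → l′ ∈ q′ → wt l ≤ wt l′
        ordered′ (here ≡.refl) l′∈q′ = All.lookup lightest l′∈q′
        ordered′ {l} {l′} (there l∈h) l′∈q′ with origin (there l′∈q′) | origin (here ≡.refl)
        ... | inj₂ l′∈q   | _        = ordered l∈h l′∈q
        ... | inj₁ _      | inj₂ k∈q = ≤-trans (ordered l∈h k∈q) (All.lookup lightest l′∈q′)
        ... | inj₁ l′∈ins | inj₁ k∈ins with ∈-inserted l′∈ins | ∈-inserted k∈ins
        ...   | j , f₁ , eq₁ , ≡.refl | j′ , f₂ , eq₂ , ≡.refl
          with ≡.refl ← ≡.trans (≡.sym eq₁) eq₂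
          = ordered l∈h (Perm.∈-resp-↭
              (Perm.drop-∷ (≡.subst (λ s → exec j ∷ q′ ↭ inserted I s ++ q) eq₁ perm)) l′∈q′)

        tested′ : ∀ {j} → exec j ∈ q′ → test j ∈ k ∷ h
        tested′ ∈q′ = there (exec-tested (origin (there ∈q′)))

        run′ : ∀ {i′ l f′} → lookup M′ i′ ≡ running l f′ → f′ ≈ e l × l ∈ k ∷ h
        run′ {i′} eq with i′ Fin.≟ i
        ... | yes ≡.refl with ≡.refl ← ≡.trans (≡.sym (lookup∘update i M s)) eq =
          +-congʳ (sym start≈f) , here ≡.refl
        ... | no i′≢i with ≈end , l∈h ← run (≡.trans (≡.sym (lookup∘update′ i′≢i M s)) eq) = ≈end , there l∈h

        busy′ : q′ ≡ [] ⊎ ((∀ i → lookup M′ i ≢ retired) × totalIdleTime M′ ≤ d k + ∑ d h)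
        busy′ with busy
        -- An empty queue stays empty: the only task that can be dispatched is the execution
        -- inserted at this moment.
        ... | inj₁ ≡.refl = inj₁ (drained perm)
          where
          drained : k ∷ q′ ↭ ins ++ [] → q′ ≡ []
          drained p with lookup M i
          ... | running (test j) _ with ≡.refl ← Perm.↭-singleton-inv p = ≡.refl
          ... | fresh                  = ⊥-elim (Perm.¬x∷xs↭[] p)
          ... | retired                = ⊥-elim (Perm.¬x∷xs↭[] p)
          ... | running (exec _) _     = ⊥-elim (Perm.¬x∷xs↭[] p)
          ... | running (untested _) _ = ⊥-elim (Perm.¬x∷xs↭[] p)
        -- Only machine `i` changes, from idle time `f` to `f + d k`, so the total grows by just the
        -- work that joins the history.
        ... | inj₂ (≢retired , load≤) = inj₂ (≢retired′ ,
          linear (+-mono-≤ load≤ (≤-reflexive idle-times))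
            (solve 5 (λ x T′ T f d → T′ :+ (x :+ (T :+ (f :+ d))) := d :+ x :+ (T :+ (T′ :+ f)))
              refl (∑ d h) (totalIdleTime M′) (totalIdleTime M) f (d k)))
          where
          ≢retired′ : ∀ i′ → lookup M′ i′ ≢ retired
          ≢retired′ i′ eq with i′ Fin.≟ i
          ... | yes ≡.refl with () ← ≡.trans (≡.sym (lookup∘update i M s)) eq
          ... | no  i′≢i = ≢retired i′ (≡.trans (≡.sym (lookup∘update′ i′≢i M s)) eq)

          idle-times : totalIdleTime M′ + f ≈ totalIdleTime M + (f + d k)
          idle-times = trans (+-congˡ (reflexive (≡.sym (idleAt⇒idleTime idle)))) (totalIdleTime-≔ M i s)

        conserved′ : concatMap withExecution q′ ++ pending M′ ++ k ∷ h ↭ tasks ω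
        conserved′ = ↭-trans (begin
          cm q′ ++ pending M′ ++ k ∷ h
            ↭⟨ Perm.++⁺ˡ (cm q′) (Perm.++⁺ʳ (k ∷ h) pending′) ⟩
          cm q′ ++ (inserted I s ++ rest) ++ k ∷ h
            ↭⟨ ↭Solver.solve 5 (λ q′ ins′ rest k h → (q′ ⊕ (ins′ ⊕ rest) ⊕ (k ⊕ h)) ⊜ (((k ⊕ ins′) ⊕ q′) ⊕ rest ⊕ h))
                 ↭-refl (cm q′) (inserted I s) rest (k ∷ []) h ⟩
          ((k ∷ inserted I s) ++ cm q′) ++ rest ++ h
            ≡⟨ ≡.cong (λ ks → (ks ++ cm q′) ++ rest ++ h) (withExecution-∷ k (f + d k)) ⟨
          cm (k ∷ q′) ++ rest ++ h
            ↭⟨ Perm.++⁺ʳ (rest ++ h) (concatMap-↭ withExecution perm) ⟩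
          cm (ins ++ q) ++ rest ++ h
            ≡⟨ ≡.cong (_++ rest ++ h) (≡.trans (concatMap-++ withExecution ins q)
                 (≡.cong (_++ cm q) (concatMap-inserted (lookup M i)))) ⟩
          (ins ++ cm q) ++ rest ++ h
            ↭⟨ ↭Solver.solve 4 (λ ins q rest h → ((ins ⊕ q) ⊕ rest ⊕ h) ⊜ (q ⊕ (ins ⊕ rest) ⊕ h))
                 ↭-refl ins (cm q) rest h ⟩
          cm q ++ (ins ++ rest) ++ h
            ↭⟨ Perm.++⁺ˡ (cm q) (Perm.++⁺ʳ h (pending-↭ M i)) ⟨
          cm q ++ pending M ++ h ∎) conserved
          where
          module ↭Solver = MonoidSolver (Perm.++-commutativeMonoid {A = Task n})
          open ↭Solver using (_⊕_; _⊜_)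
          cm   = concatMap withExecution
          rest = pending (M [ i ]≔ retired)

          -- Retiring machine `i` overwrites the update, so `M` and `M′` leave the same rest.
          pending′ : pending M′ ↭ inserted I s ++ rest
          pending′ = ≡.subst₂ (λ r N → pending M′ ↭ inserted I r ++ pending N)
            (lookup∘update i M s) ([]≔-idempotent M i) (pending-↭ M′ i)

      -- At the end nothing is queued or pending, and `conserved` then says that the history lists
      -- each required task once.
      history-of-run : .{{NonZero m}} → ∀ {h q M} → Invariant h q M → Run I β S q M →
                       ∃ λ H → History H × H ↭ tasks ω
      history-of-run {h} {q} {M} inv (finish all-retired) =
        h , history , ≡.subst (λ ks → ks ↭ tasks ω)
          (≡.cong₂ (λ q p → concatMap withExecution q ++ p ++ h) q≡[] (no-pending all-retired)) conserved
        where
        open Invariant inv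
        no-pending : ∀ {m} {M : Vec (Status I) m} → VecAll.All (_≡ retired) M → pending M ≡ []
        no-pending VecAll.[]              = ≡.refl
        no-pending (≡.refl VecAll.∷ rest) = no-pending rest

        some-machine : ∀ {m} → .{{NonZero m}} → Fin m
        some-machine {ℕ.suc m} = zero

        q≡[] : q ≡ []
        q≡[] with busy
        ... | inj₁ eq = eq
        -- There is at least one machine, and it is retired; so the queue must have run empty.
        ... | inj₂ (≢retired , _) = ⊥-elim (≢retired some-machine (VecAll.lookup⁺ all-retired some-machine))
      history-of-run inv (retire i f _ empty r) = history-of-run (retire-invariant i empty inv) r
      history-of-run inv (dispatch i f next k q′ perm lightest _ start≈f r) =
        history-of-run (dispatch-invariant i f next k q′ perm lightest start≈f inv) r

      initial-invariant : Invariant [] (initialQueue I ω) (replicate m fresh)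
      initial-invariant = record
        { history   = []
        ; conserved = ↭-reflexive (≡.trans
          (≡.cong (λ p → concatMap withExecution (initialQueue I ω) ++ p ++ []) (no-pending m))
          (++-identityʳ _))
        ; ordered   = λ ()
        ; tested    = λ exec∈ → ⊥-elim (no-exec exec∈)
        ; run       = λ {i} eq → ⊥-elim (not-running i eq)
        ; busy      = inj₂ ((λ i eq → not-retired i eq) , ≤-reflexive (no-time m))
        }
        where
        no-pending : ∀ m → pending (replicate m fresh) ≡ []
        no-pending ℕ.zero    = ≡.refl
        no-pending (ℕ.suc m) = no-pending m

        no-time : ∀ m → totalIdleTime (replicate m fresh) ≈ 0#
        no-time ℕ.zero    = refl
        no-time (ℕ.suc m) = trans (+-identityˡ _) (no-time m)

        no-exec : ∀ {j} → ¬ (exec j ∈ initialQueue I ω)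
        no-exec exec∈ with i , eq ← ∈-tabulate⁻ exec∈ with lookup ω i | eq
        ... | true  | ()
        ... | false | ()

        not-running : ∀ i {k f} → ¬ (lookup (replicate m fresh) i ≡ running k f)
        not-running i eq with () ← ≡.trans (≡.sym (lookup-replicate i fresh)) eq

        not-retired : ∀ i → ¬ (lookup (replicate m fresh) i ≡ retired)
        not-retired i eq with () ← ≡.trans (≡.sym (lookup-replicate i fresh)) eq

-- Delays among jobs and the charges that pay for them.

module Charging {c ℓ₁ ℓ₂} (K : ArchimedeanField c ℓ₁ ℓ₂) where
  open Scheduling K
  open OrderedFieldProperties (ArchimedeanField.orderedField K)
  open RequiredTasks K
  open ListScheduling K
  open ≤-Reasoning poset hiding (start)

  infix 4 _≟ᵗ_

  _≟ᵗ_ : ∀ {n} → DecidableEquality (Task n)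
  test i     ≟ᵗ test j     = map′ (≡.cong test) (λ { ≡.refl → ≡.refl }) (i Fin.≟ j)
  exec i     ≟ᵗ exec j     = map′ (≡.cong exec) (λ { ≡.refl → ≡.refl }) (i Fin.≟ j)
  untested i ≟ᵗ untested j = map′ (≡.cong untested) (λ { ≡.refl → ≡.refl }) (i Fin.≟ j)
  test _     ≟ᵗ exec _     = no λ ()
  test _     ≟ᵗ untested _ = no λ ()
  exec _     ≟ᵗ test _     = no λ ()
  exec _     ≟ᵗ untested _ = no λ ()
  untested _ ≟ᵗ test _     = no λ ()
  untested _ ≟ᵗ exec _     = no λ ()

  -- Ranks count from the oldest task, so that they do not change as the history
  -- grows at its head.
  rank : ∀ {n} → List (Task n) → Task n → ℕ
  rank []      k = 0
  rank (l ∷ h) k = if does (k ≟ᵗ l) then length h else rank h k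

  rank-here : ∀ {n} (k : Task n) h → rank (k ∷ h) k ≡ length h
  rank-here k h rewrite dec-true (k ≟ᵗ k) ≡.refl = ≡.refl

  rank-there : ∀ {n} {k l : Task n} h → k ≢ l → rank (l ∷ h) k ≡ rank h k
  rank-there {k = k} {l} h k≢l rewrite dec-false (k ≟ᵗ l) k≢l = ≡.refl

  rank<length : ∀ {n} {k : Task n} {h} → k ∈ h → rank h k ℕ.< length h
  rank<length {k = k} {l ∷ h} k∈ with k ≟ᵗ l | k∈
  ... | yes _  | _         = ℕ.≤-refl
  ... | no k≢l | here eq   = ⊥-elim (k≢l eq)
  ... | no _   | there k∈h = ℕ.m<n⇒m<1+n (rank<length k∈h)

  rank-injective : ∀ {n} {k l : Task n} {h} → k ∈ h → l ∈ h → rank h k ≡ rank h l → k ≡ l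
  rank-injective {k = k} {l} {x ∷ h} k∈ l∈ eq with k ≟ᵗ x | l ≟ᵗ x | k∈ | l∈
  ... | yes ≡.refl | yes ≡.refl | _ | _ = ≡.refl
  ... | yes ≡.refl | no l≢x | _ | here l≡x  = ⊥-elim (l≢x l≡x)
  ... | yes ≡.refl | no _ | _ | there l∈h = ⊥-elim (ℕ.<-irrefl (≡.sym eq) (rank<length l∈h))
  ... | no k≢x | yes ≡.refl | here k≡x | _ = ⊥-elim (k≢x k≡x)
  ... | no _ | yes ≡.refl | there k∈h | _ = ⊥-elim (ℕ.<-irrefl eq (rank<length k∈h))
  ... | no k≢x | no _ | here k≡x | _ = ⊥-elim (k≢x k≡x)
  ... | no _ | no l≢x | there _ | here l≡x = ⊥-elim (l≢x l≡x)
  ... | no _ | no _ | there k∈h | there l∈h = rank-injective k∈h l∈h eq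

  module _ {n} (I : Instance n) (β : Carrier) {m} (S : Schedule m n) where
    open Instance I
    open Schedule S

    private
      d = duration I
      e = end I S
      wt = weight I β

    amount : List (Task n) → Task n → Task n → Carrier
    amount h k l = if does (rank h l ℕ.<? rank h k) then d l else 0#

    amount-before : ∀ h k l → rank h l ℕ.< rank h k → amount h k l ≡ d l
    amount-before h k l lt rewrite dec-true (rank h l ℕ.<? rank h k) lt = ≡.refl

    amount-after : ∀ h k l → ¬ (rank h l ℕ.< rank h k) → amount h k l ≡ 0#
    amount-after h k l ≮ rewrite dec-false (rank h l ℕ.<? rank h k) ≮ = ≡.refl

    amount-nonneg : ∀ h k l → 0# ≤ amount h k l
    amount-nonneg h k l with does (rank h l ℕ.<? rank h k)
    ... | true  = duration-nonneg I l
    ... | false = ≤-refl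

    amount≤ : ∀ h k l → amount h k l ≤ d l
    amount≤ h k l with does (rank h l ℕ.<? rank h k)
    ... | true  = ≤-refl
    ... | false = duration-nonneg I l

    Light : List (Task n) → Task n → Set _
    Light h k = ∀ {l} → l ∈ h → rank h l ℕ.< rank h k → wt l ≤ wt k

    Ready : List (Task n) → Task n → Set _
    Ready h k = fromℕ m * start k ≤ ∑ (amount h k) h × Light h k

    Ranked : List (Task n) → Task n → Set _
    Ranked h k = (Immediate I β S k ⊎ Ready h k) ×
                 (∀ {j} → k ≡ exec j → test j ∈ h × rank h (test j) ℕ.< rank h k)

    -- A history describes each task at the moment of its dispatch. As later dispatches do not alter
    -- ranks, the same facts hold relative to the complete history, in which tasks of different jobs
    -- can be compared. Uniqueness keeps the new head apart from the old tasks.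
    ranked : ∀ {h} → History I β S h → Unique h → ∀ {k} → k ∈ h → Ranked h k
    ranked {x ∷ h} (dispatched ∷ hist) (x≢ ∷ uniq) {k} k∈ = new-or-old dispatched k∈
      where
      rank-old : ∀ {l} → l ∈ h → rank (x ∷ h) l ≡ rank h l
      rank-old l∈h = rank-there h (λ l≡x → All.lookup x≢ l∈h (≡.sym l≡x))

      old<x : ∀ {l} → l ∈ h → rank (x ∷ h) l ℕ.< rank (x ∷ h) x
      old<x l∈h = ≡.subst₂ ℕ._<_ (≡.sym (rank-old l∈h)) (≡.sym (rank-here x h)) (rank<length l∈h)

      amount-old : ∀ {k l} → k ∈ h → l ∈ h → amount (x ∷ h) k l ≡ amount h k l
      amount-old k∈h l∈h rewrite rank-old k∈h | rank-old l∈h = ≡.refl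

      ready-x : fromℕ m * start x ≤ ∑ d h → All (λ l → wt l ≤ wt x) h → Ready (x ∷ h) x
      ready-x start≤ light = ≤-trans start≤ (≤-reflexive (sym (trans
          (+-cong (reflexive (amount-after (x ∷ h) x x (ℕ.<-irrefl ≡.refl)))
            (∑-cong (All.tabulate λ l∈h → reflexive (amount-before (x ∷ h) x _ (old<x l∈h)))))
          (+-identityˡ _)))) ,
        λ { (here ≡.refl) lt → ⊥-elim (ℕ.<-irrefl ≡.refl lt) ; (there l∈h) _ → All.lookup light l∈h }

      ready-old : ∀ {k} → k ∈ h → Ready h k → Ready (x ∷ h) k
      ready-old {k} k∈h (start≤ , light) = ≤-trans start≤ (≤-trans
          (≤-reflexive (∑-cong (All.tabulate λ l∈h → reflexive (≡.sym (amount-old k∈h l∈h)))))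
          (≤-respˡ (+-identityˡ _) (+-monoˡ-≤ _ (amount-nonneg (x ∷ h) k x)))) ,
        λ { (here ≡.refl) lt → ⊥-elim (ℕ.<-asym lt (old<x k∈h))
          ; (there l∈h) lt → light l∈h (≡.subst₂ ℕ._<_ (rank-old l∈h) (rank-old k∈h) lt) }

      new-or-old : Dispatched I β S h x → k ∈ x ∷ h → Ranked (x ∷ h) k
      new-or-old (inj₁ imm , tested) (here ≡.refl) =
        inj₁ imm , λ k≡ → there (tested _ k≡) , old<x (tested _ k≡)
      new-or-old (inj₂ (start≤ , light) , tested) (here ≡.refl) =
        inj₂ (ready-x start≤ light) , λ k≡ → there (tested _ k≡) , old<x (tested _ k≡)
      new-or-old _ (there k∈h) with how , tested ← ranked hist uniq k∈h =
        how′ how ,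
        λ k≡ → there (proj₁ (tested k≡)) ,
               ≡.subst₂ ℕ._<_ (≡.sym (rank-old (proj₁ (tested k≡)))) (≡.sym (rank-old k∈h)) (proj₂ (tested k≡))
        where
        how′ : Immediate I β S k ⊎ Ready h k → Immediate I β S k ⊎ Ready (x ∷ h) k
        how′ (inj₁ imm)   = inj₁ imm
        how′ (inj₂ ready) = inj₂ (ready-old k∈h ready)

    -- The task at whose start the waiting of job j ends.  The execution of a
    -- tested job either follows its test immediately, or had to wait itself.
    data Reference (h : List (Task n)) (j : Fin n) : Bool → Set (c Level.⊔ ℓ₂) where
      untested : Light h (untested j) → Reference h j false
      test     : Light h (test j) → Reference h j true
      exec     : Light h (exec j) → Reference h j true

    reference : ∀ {h j b} → Reference h j b → Task n
    reference {j = j} (untested _) = untested j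
    reference {j = j} (test _)     = test j
    reference {j = j} (exec _)     = exec j

    -- The time spent on tasks of job i that are dispatched before k.
    ahead : List (Task n) → Task n → Bool → Fin n → Carrier
    ahead h k true  i = amount h k (test i) + amount h k (exec i)
    ahead h k false i = amount h k (untested i)

    module _ {ω : Subset n} {H} (history : History I β S H) (H↭ : H ↭ tasks ω) where

      private
        ranked-H : ∀ {k} → k ∈ H → Ranked H k
        ranked-H = ranked history (Unique-resp-↭ (↭-sym H↭) (tasks-unique ω))

        initial∈H : ∀ {k} j → k ∈ withExecution (initialTask ω j) → k ∈ H
        initial∈H j k∈ = Perm.∈-resp-↭ (↭-sym H↭)
          (∈-concat⁺′ k∈ (∈-map⁺ withExecution (∈-tabulate⁺ j)))

      test∈H : ∀ {j} → lookup ω j ≡ true → test j ∈ H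
      test∈H {j} eq = initial∈H j (≡.subst
        (λ b → test j ∈ withExecution (if b then test j else untested j)) (≡.sym eq) (here ≡.refl))

      exec∈H : ∀ {j} → lookup ω j ≡ true → exec j ∈ H
      exec∈H {j} eq = initial∈H j (≡.subst
        (λ b → exec j ∈ withExecution (if b then test j else untested j)) (≡.sym eq) (there (here ≡.refl)))

      untested∈H : ∀ {j} → lookup ω j ≡ false → untested j ∈ H
      untested∈H {j} eq = initial∈H j (≡.subst
        (λ b → untested j ∈ withExecution (if b then test j else untested j)) (≡.sym eq) (here ≡.refl))

      test-before-exec : ∀ {j} → lookup ω j ≡ true → rank H (test j) ℕ.< rank H (exec j)
      test-before-exec eq = proj₂ (proj₂ (ranked-H (exec∈H eq)) ≡.refl)

      ∑-amount : ∀ k → ∑ (amount H k) H ≈ sum λ i → ahead H k (lookup ω i) i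
      ∑-amount k = trans (∑-↭ (amount H k) H↭) (trans (∑-tasks I ω (amount H k)) (sum-cong-≋ by-job))
        where
        by-job : ∀ i → ∑ (amount H k) (withExecution (initialTask ω i)) ≈ ahead H k (lookup ω i) i
        by-job i with lookup ω i
        ... | true  = +-congˡ (+-identityʳ _)
        ... | false = +-identityʳ _

      module _ .{{_ : NonZero m}} where

        private
          x≤m*x : ∀ {x} → 0# ≤ x → x ≤ fromℕ m * x
          x≤m*x {x} 0≤x = begin
            x             ≈⟨ *-identityˡ x ⟨
            1# * x        ≤⟨ *-monoʳ-≤ 0≤x (≤-respˡ (+-identityʳ 1#) (fromℕ-mono-≤ (ℕ.>-nonZero⁻¹ m))) ⟩
            fromℕ m * x   ∎

          waiting : ∀ {k j b} → lookup ω j ≡ b → Ready H k →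
            fromℕ m * start k ≤ ahead H k b j + others j (λ i → ahead H k (lookup ω i) i)
          waiting {k} {j} ≡.refl (start≤ , _) =
            ≤-respʳ (trans (∑-amount k) (sum-remove-at j λ i → ahead H k (lookup ω i) i)) start≤

          amount-self : ∀ k → amount H k k ≈ 0#
          amount-self k = reflexive (amount-after H k k (ℕ.<-irrefl ≡.refl))

          test-ready : ∀ {j} → lookup ω j ≡ true → Ready H (test j)
          test-ready eq with proj₁ (ranked-H (test∈H eq))
          ... | inj₂ ready = ready

          untested-ready : ∀ {j} → lookup ω j ≡ false → Ready H (untested j)
          untested-ready eq with proj₁ (ranked-H (untested∈H eq))
          ... | inj₂ ready = ready

        Completion : Fin n → Bool → Set _
        Completion j b = ∃ λ (r : Reference H j b) →
          fromℕ m * e (if b then exec j else untested j) ≤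
          fromℕ m * work I b j + others j (λ i → ahead H (reference r) (lookup ω i) i)

        -- The load bound for the reference task is split into own tasks and those of other jobs;
        -- what the own tasks contribute fits into `m` times the own work.
        completion : ∀ j b → lookup ω j ≡ b → Completion j b
        completion j false eq = untested (proj₂ (untested-ready eq)) ,
          linear (+-mono-≤ (waiting eq (untested-ready eq)) (≤-reflexive (amount-self (untested j))))
            (solve 5 (λ m s u a o → m :* (s :+ u) :+ (a :+ o :+ con 0) := m :* u :+ o :+ (m :* s :+ a))
              refl (fromℕ m) (start (untested j)) (u j) (amount H (untested j) (untested j)) _)
        completion j true eq with proj₁ (ranked-H (exec∈H eq))
        -- The execution starts when the test ends, so only work ahead of the test delays the job,
        -- and neither of the two own tasks is ahead of it.
        ... | inj₁ (_ , ≡.refl , start≈) = test (proj₂ (test-ready eq)) ,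
          linear (+-mono-≤ (+-mono-≤ (waiting eq (test-ready eq)) (≤-reflexive (amount-self (test j))))
                   (+-mono-≤ (≤-reflexive exec-after) (*-monoˡ-≤ (fromℕ-nonneg m) (≤-reflexive start≈))))
            (solve 8 (λ m s s′ t p a b o →
                m :* (s′ :+ p) :+ (a :+ b :+ o :+ con 0 :+ (con 0 :+ m :* (s :+ t)))
              := m :* (t :+ p) :+ o :+ (m :* s :+ a :+ (b :+ m :* s′)))
              refl (fromℕ m) (start (test j)) (start (exec j)) (t j) (p j)
              (amount H (test j) (test j)) (amount H (test j) (exec j)) _)
          where
          exec-after : amount H (test j) (exec j) ≈ 0#
          exec-after = reflexive (amount-after H _ _ (ℕ.<-asym (test-before-exec eq)))
        -- The own test may be part of the load ahead of the execution. It counts once there but `m`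
        -- times in the own work, hence `x≤m*x`.
        ... | inj₂ ready = exec (proj₂ ready) ,
          linear (+-mono-≤ (+-mono-≤ (waiting eq ready) (≤-reflexive (amount-self (exec j))))
                   (+-mono-≤ (amount≤ H (exec j) (test j)) (x≤m*x (<⇒≤ (t>0 j)))))
            (solve 7 (λ m s t p a b o →
                m :* (s :+ p) :+ (a :+ b :+ o :+ con 0 :+ (t :+ m :* t))
              := m :* (t :+ p) :+ o :+ (m :* s :+ b :+ (a :+ t)))
              refl (fromℕ m) (start (exec j)) (t j) (p j)
              (amount H (exec j) (test j)) (amount H (exec j) (exec j)) _)

  tasks-differ : ∀ {n} {k l : Task n} → job k ≢ job l → k ≢ l
  tasks-differ jobs≢ ≡.refl = jobs≢ ≡.refl

  module _ {n} (I : Instance n) where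
    open Instance I

    -- Each expression is twice the delay in a tight case of `pair-charge`. `3 u`: an untested job
    -- runs between the test and the execution of the other job, whose test takes `u / 2`.
    -- `4 t + 2 p`: an untested job of length `t + p` runs between test and execution. `3 (t + p)`:
    -- the execution, having waited, falls between the other test, of length `(t + p) / 2`, and the
    -- other execution.
    charge : Bool → Fin n → Carrier
    charge true  j = max (fromℕ 4 * t j + two * p j) (three * (t j + p j))
    charge false j = three * u j

    module _ {m} (S : Schedule m n) {ω : Subset n} {H} (history : History I two S H) (H↭ : H ↭ tasks ω) where

      private
        _≺_ : Task n → Task n → Set
        k ≺ l = rank H k ℕ.< rank H l

        α = amount I two S H

        Ref = Reference I two S H

        ref : ∀ {j b} → Ref j b → Task n
        ref = reference I two S

        untested∈ : ∀ {j} → lookup ω j ≡ false → untested j ∈ H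
        untested∈ = untested∈H I two S {ω} history H↭

        test∈ : ∀ {j} → lookup ω j ≡ true → test j ∈ H
        test∈ = test∈H I two S {ω} history H↭

        exec∈ : ∀ {j} → lookup ω j ≡ true → exec j ∈ H
        exec∈ = exec∈H I two S {ω} history H↭

        test≺exec : ∀ {j} → lookup ω j ≡ true → test j ≺ exec j
        test≺exec = test-before-exec I two S {ω} history H↭

        compare : ∀ {k l} → job k ≢ job l → k ∈ H → l ∈ H → k ≺ l ⊎ l ≺ k
        compare jobs≢ k∈ l∈ with ℕ.<-cmp (rank H _) (rank H _)
        ... | tri< lt _ _ = inj₁ lt
        ... | tri≈ _ eq _ = ⊥-elim (tasks-differ jobs≢ (rank-injective k∈ l∈ eq))
        ... | tri> _ _ gt = inj₂ gt

        all : ∀ k l → α k l ≤ duration I l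
        all = amount≤ I two S H

        none : ∀ {k l} → k ≺ l → α k l ≤ 0#
        none lt = ≤-reflexive (reflexive (amount-after I two S H _ _ (ℕ.<-asym lt)))

        4t+2p≤charge : ∀ j → fromℕ 4 * t j + two * p j ≤ charge true j
        4t+2p≤charge j = x≤x⊔y _ _

        3t+3p≤charge : ∀ j → three * (t j + p j) ≤ charge true j
        3t+3p≤charge j = x≤y⊔x _ _

        t≥0 : ∀ j → 0# ≤ t j
        t≥0 j = <⇒≤ (t>0 j)

        2x≤2y⇒x≤y : ∀ {x y} → two * x ≤ two * y → x ≤ y
        2x≤2y⇒x≤y = *-cancelˡ-≤ (fromℕ-positive 2)

        2x≤y⇒x≤y : ∀ {x y} → 0# ≤ x → two * x ≤ y → x ≤ y
        2x≤y⇒x≤y {x} {y} 0≤x le = linear (+-mono-≤ 0≤x le)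
          (solve 2 (λ x y → x :+ (x :+ y) := y :+ (con 0 :+ num 2 :* x)) refl x y)

        2t+2p≤charge : ∀ i → two * (t i + p i) ≤ charge true i
        2t+2p≤charge i = linear (+-mono-≤ (4t+2p≤charge i) (+-mono-≤ (t≥0 i) (t≥0 i)))
          (solve 3 (λ t p f → num 2 :* (t :+ p) :+ (f :+ (t :+ t)) :=
                              f :+ (num 4 :* t :+ num 2 :* p :+ (con 0 :+ con 0)))
            refl (t i) (p i) (charge true i))

        x≤2t : ∀ {x} i → x ≤ two * t i → two * x ≤ charge true i
        x≤2t {x} i le = linear (+-mono-≤ (4t+2p≤charge i) (+-mono-≤ (+-mono-≤ le le) (+-mono-≤ (p≥0 i) (p≥0 i))))
          (solve 4 (λ t p f x → num 2 :* x :+ (f :+ (num 2 :* t :+ num 2 :* t :+ (p :+ p))) :=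
                              f :+ (num 4 :* t :+ num 2 :* p :+ (x :+ x :+ (con 0 :+ con 0))))
            refl (t i) (p i) (charge true i) x)

        x≤t : ∀ {x} i → x ≤ t i → two * x ≤ charge true i
        x≤t {x} i le = x≤2t i (linear (+-mono-≤ le (t≥0 i))
          (solve 2 (λ t x → x :+ (t :+ t) := num 2 :* t :+ (x :+ con 0)) refl (t i) x))

        t+x : ∀ {x} i → x ≤ t i + p i → two * (t i + x) ≤ charge true i
        t+x {x} i le = linear (+-mono-≤ (4t+2p≤charge i) (+-mono-≤ le le))
          (solve 4 (λ t p f x → num 2 :* (t :+ x) :+ (f :+ (t :+ p :+ (t :+ p))) :=
                              f :+ (num 4 :* t :+ num 2 :* p :+ (x :+ x)))
            refl (t i) (p i) (charge true i) x)

        t+p+x : ∀ {x} i → x ≤ t i → two * (t i + p i + x) ≤ charge true i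
        t+p+x {x} i le = linear (+-mono-≤ (4t+2p≤charge i) (+-mono-≤ le le))
          (solve 4 (λ t p f x → num 2 :* (t :+ p :+ x) :+ (f :+ (t :+ t)) :=
                              f :+ (num 4 :* t :+ num 2 :* p :+ (x :+ x)))
            refl (t i) (p i) (charge true i) x)

        t+p+x′ : ∀ {x} i → two * x ≤ t i + p i → two * (t i + p i + x) ≤ charge true i
        t+p+x′ {x} i le = linear (+-mono-≤ (3t+3p≤charge i) le)
          (solve 4 (λ t p f x → num 2 :* (t :+ p :+ x) :+ (f :+ (t :+ p)) :=
                              f :+ (num 3 :* (t :+ p) :+ num 2 :* x))
            refl (t i) (p i) (charge true i) x)

        x≤u : ∀ {x} i → x ≤ u i → two * x ≤ charge false i
        x≤u {x} i le = linear (+-mono-≤ (+-mono-≤ le le) (<⇒≤ (u>0 i)))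
          (solve 2 (λ u x → num 2 :* x :+ (u :+ u :+ u) := num 3 :* u :+ (x :+ x :+ con 0)) refl (u i) x)

        u+x : ∀ {x} i → two * x ≤ u i → two * (u i + x) ≤ charge false i
        u+x {x} i le = linear le
          (solve 2 (λ u x → num 2 :* (u :+ x) :+ u := num 3 :* u :+ num 2 :* x) refl (u i) x)

        under : ∀ {x y z f} → x ≤ y → y ≈ z → two * z ≤ f → two * x ≤ f
        under x≤y y≈z 2z≤f = ≤-trans (*-monoˡ-≤ (fromℕ-nonneg 2) (≤-respʳ y≈z x≤y)) 2z≤f

        2x≤u : ∀ {x} i → 0# ≤ x → two * x ≤ u i → two * x ≤ charge false i
        2x≤u i 0≤x le = x≤u i (2x≤y⇒x≤y 0≤x le)

        first : ∀ a b → a + b + (0# + 0#) ≈ a + b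
        first = solve 2 (λ a b → a :+ b :+ (con 0 :+ con 0) := a :+ b) refl

        second : ∀ a b → 0# + 0# + (a + b) ≈ a + b
        second = solve 2 (λ a b → con 0 :+ con 0 :+ (a :+ b) := a :+ b) refl

        third : ∀ a → 0# + 0# + (a + 0#) ≈ a
        third = solve 1 (λ a → con 0 :+ con 0 :+ (a :+ con 0) := a) refl

        fourth : ∀ a b → a + 0# + (b + 0#) ≈ a + b
        fourth = solve 2 (λ a b → a :+ con 0 :+ (b :+ con 0) := a :+ b) refl

        fifth : ∀ a b → a + 0# + b ≈ a + b
        fifth a b = +-congʳ (+-identityʳ a)

      Delay : ∀ {i j b b′} → Ref i b → Ref j b′ → Carrier
      Delay {i} {j} {b} {b′} rᵢ rⱼ = ahead I two S H (ref rⱼ) b i + ahead I two S H (ref rᵢ) b′ j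

      -- Tasks of `i` ahead of the reference of `j` are counted in full. A task of `j` ahead of the
      -- reference of `i` weighs no more than that reference, by `lightᵢ`, and its weight bounds
      -- durations: `2 t` bounds the test twice over, `u` the untested execution, and the weight
      -- `t + p` of an execution pays for both tasks of `j`. The cases are the possible
      -- interleavings. Exchanging `i` and `j` gives the bound by the charge of `j`.
      pair-charge : ∀ {i j b b′} → i ≢ j → lookup ω i ≡ b → lookup ω j ≡ b′ →
        (rᵢ : Ref i b) (rⱼ : Ref j b′) → two * Delay rᵢ rⱼ ≤ charge b i
      pair-charge {i} i≢j bᵢ bⱼ (untested lightᵢ) (untested _)
        with compare i≢j (untested∈ bᵢ) (untested∈ bⱼ)
      ... | inj₁ i≺j = under (+-mono-≤ (all _ _) (none i≺j)) (+-identityʳ _) (x≤u i ≤-refl)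
      ... | inj₂ j≺i = under (+-mono-≤ (none j≺i) (all _ _)) (+-identityˡ _)
                         (x≤u i (lightᵢ (untested∈ bⱼ) j≺i))
      pair-charge {i} i≢j bᵢ bⱼ (test lightᵢ) (untested _)
        with compare i≢j (test∈ bᵢ) (untested∈ bⱼ)
      ... | inj₁ i≺j = under (+-mono-≤ (+-mono-≤ (all _ _) (all _ _)) (none i≺j)) (+-identityʳ _) (2t+2p≤charge i)
      ... | inj₂ j≺i = under
        (+-mono-≤ (+-mono-≤ (none j≺i) (none (ℕ.<-trans j≺i (test≺exec bᵢ)))) (all _ _))
        (trans (+-congʳ (+-identityʳ _)) (+-identityˡ _))
        (x≤2t i (lightᵢ (untested∈ bⱼ) j≺i))
      pair-charge {i} i≢j bᵢ bⱼ (exec lightᵢ) (untested _)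
        with compare i≢j (exec∈ bᵢ) (untested∈ bⱼ)
      ... | inj₁ i≺j = under (+-mono-≤ (+-mono-≤ (all _ _) (all _ _)) (none i≺j)) (+-identityʳ _) (2t+2p≤charge i)
      ... | inj₂ j≺i = under (+-mono-≤ (+-mono-≤ (all _ _) (none j≺i)) (all _ _)) (fifth _ _)
        (t+x i (lightᵢ (untested∈ bⱼ) j≺i))
      pair-charge {i} {j} i≢j bᵢ bⱼ (untested lightᵢ) (test _)
        with compare i≢j (untested∈ bᵢ) (test∈ bⱼ)
      ... | inj₁ i≺j = under
        (+-mono-≤ (all _ _) (+-mono-≤ (none i≺j) (none (ℕ.<-trans i≺j (test≺exec bⱼ)))))
        (trans (+-congˡ (+-identityʳ _)) (+-identityʳ _)) (x≤u i ≤-refl)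
      ... | inj₂ j≺i with compare i≢j (untested∈ bᵢ) (exec∈ bⱼ)
      ...   | inj₁ i≺j′ = under (+-mono-≤ (none j≺i) (+-mono-≤ (all _ _) (none i≺j′)))
        (trans (+-identityˡ _) (+-identityʳ _)) (2x≤u i (t≥0 j) (lightᵢ (test∈ bⱼ) j≺i))
      ...   | inj₂ j′≺i = under (+-mono-≤ (none j≺i) (+-mono-≤ (all _ _) (all _ _)))
        (+-identityˡ _) (x≤u i (lightᵢ (exec∈ bⱼ) j′≺i))
      pair-charge {i} i≢j bᵢ bⱼ (untested lightᵢ) (exec _)
        with compare i≢j (untested∈ bᵢ) (exec∈ bⱼ)
      ... | inj₂ j≺i = under (+-mono-≤ (none j≺i) (+-mono-≤ (all _ _) (all _ _)))
        (+-identityˡ _) (x≤u i (lightᵢ (exec∈ bⱼ) j≺i))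
      ... | inj₁ i≺j with compare i≢j (untested∈ bᵢ) (test∈ bⱼ)
      ...   | inj₁ i≺j′ = under (+-mono-≤ (all _ _) (+-mono-≤ (none i≺j′) (none i≺j)))
        (trans (+-congˡ (+-identityʳ _)) (+-identityʳ _)) (x≤u i ≤-refl)
      ...   | inj₂ j′≺i = under (+-mono-≤ (all _ _) (+-mono-≤ (all _ _) (none i≺j)))
        (+-congˡ (+-identityʳ _)) (u+x i (lightᵢ (test∈ bⱼ) j′≺i))
      pair-charge {i} i≢j bᵢ bⱼ (test lightᵢ) (test _)
        with compare i≢j (test∈ bᵢ) (test∈ bⱼ)
      ... | inj₁ i≺j = under
        (+-mono-≤ (+-mono-≤ (all _ _) (all _ _)) (+-mono-≤ (none i≺j) (none (ℕ.<-trans i≺j (test≺exec bⱼ)))))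
        (first _ _) (2t+2p≤charge i)
      ... | inj₂ j≺i with compare i≢j (test∈ bᵢ) (exec∈ bⱼ)
      ...   | inj₁ i≺j′ = under
        (+-mono-≤ (+-mono-≤ (none j≺i) (none (ℕ.<-trans j≺i (test≺exec bᵢ)))) (+-mono-≤ (all _ _) (none i≺j′)))
        (third _) (x≤t i (2x≤2y⇒x≤y (lightᵢ (test∈ bⱼ) j≺i)))
      ...   | inj₂ j′≺i = under
        (+-mono-≤ (+-mono-≤ (none j≺i) (none (ℕ.<-trans j≺i (test≺exec bᵢ)))) (+-mono-≤ (all _ _) (all _ _)))
        (second _ _) (x≤2t i (lightᵢ (exec∈ bⱼ) j′≺i))
      pair-charge {i} {j} i≢j bᵢ bⱼ (exec lightᵢ) (test _)
        with compare i≢j (exec∈ bᵢ) (test∈ bⱼ)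
      ... | inj₁ i≺j = under
        (+-mono-≤ (+-mono-≤ (all _ _) (all _ _)) (+-mono-≤ (none i≺j) (none (ℕ.<-trans i≺j (test≺exec bⱼ)))))
        (first _ _) (2t+2p≤charge i)
      ... | inj₂ j≺i with compare i≢j (exec∈ bᵢ) (exec∈ bⱼ)
      ...   | inj₁ i≺j′ = under
        (+-mono-≤ (+-mono-≤ (all _ _) (none j≺i)) (+-mono-≤ (all _ _) (none i≺j′)))
        (fourth _ _) (t+x i (2x≤y⇒x≤y (t≥0 j) (lightᵢ (test∈ bⱼ) j≺i)))
      ...   | inj₂ j′≺i = under
        (+-mono-≤ (+-mono-≤ (all _ _) (none j≺i)) (+-mono-≤ (all _ _) (all _ _)))
        (fifth _ _) (t+x i (lightᵢ (exec∈ bⱼ) j′≺i))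
      pair-charge {i} i≢j bᵢ bⱼ (test lightᵢ) (exec _)
        with compare i≢j (test∈ bᵢ) (exec∈ bⱼ)
      ... | inj₂ j≺i = under
        (+-mono-≤ (+-mono-≤ (none j≺i) (none (ℕ.<-trans j≺i (test≺exec bᵢ)))) (+-mono-≤ (all _ _) (all _ _)))
        (second _ _) (x≤2t i (lightᵢ (exec∈ bⱼ) j≺i))
      ... | inj₁ i≺j with compare i≢j (test∈ bᵢ) (test∈ bⱼ)
      ...   | inj₁ i≺j′ = under
        (+-mono-≤ (+-mono-≤ (all _ _) (all _ _)) (+-mono-≤ (none i≺j′) (none i≺j)))
        (first _ _) (2t+2p≤charge i)
      ...   | inj₂ j′≺i = under
        (+-mono-≤ (+-mono-≤ (all _ _) (all _ _)) (+-mono-≤ (all _ _) (none i≺j)))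
        (+-congˡ (+-identityʳ _)) (t+p+x i (2x≤2y⇒x≤y (lightᵢ (test∈ bⱼ) j′≺i)))
      pair-charge {i} i≢j bᵢ bⱼ (exec lightᵢ) (exec _)
        with compare i≢j (exec∈ bᵢ) (exec∈ bⱼ)
      ... | inj₂ j≺i = under
        (+-mono-≤ (+-mono-≤ (all _ _) (none j≺i)) (+-mono-≤ (all _ _) (all _ _)))
        (fifth _ _) (t+x i (lightᵢ (exec∈ bⱼ) j≺i))
      ... | inj₁ i≺j with compare i≢j (exec∈ bᵢ) (test∈ bⱼ)
      ...   | inj₁ i≺j′ = under
        (+-mono-≤ (+-mono-≤ (all _ _) (all _ _)) (+-mono-≤ (none i≺j′) (none i≺j)))
        (first _ _) (2t+2p≤charge i)
      ...   | inj₂ j′≺i = under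
        (+-mono-≤ (+-mono-≤ (all _ _) (all _ _)) (+-mono-≤ (all _ _) (none i≺j)))
        (+-congˡ (+-identityʳ _)) (t+p+x′ i (lightᵢ (test∈ bⱼ) j′≺i))

-- Linearity, monotonicity and marginals of the expectation.

module Expectation {c ℓ₁ ℓ₂} (K : ArchimedeanField c ℓ₁ ℓ₂) where
  open Scheduling K
  open OrderedFieldProperties (ArchimedeanField.orderedField K)

  1-x+x≈1 : ∀ x → 1# - x + x ≈ 1#
  1-x+x≈1 x = x-y+y≈x 1# x

  𝔼-cong : ∀ {n} ℙ {X Y : Subset n → Carrier} → (∀ ω → X ω ≈ Y ω) → 𝔼 ℙ X ≈ 𝔼 ℙ Y
  𝔼-cong {ℕ.zero}  ℙ X≈Y = X≈Y []
  𝔼-cong {ℕ.suc n} ℙ X≈Y =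
    +-cong (*-congˡ (𝔼-cong (ℙ ∘ suc) (X≈Y ∘ (true ∷_)))) (*-congˡ (𝔼-cong (ℙ ∘ suc) (X≈Y ∘ (false ∷_))))

  𝔼-mono-≤ : ∀ {n} ℙ → (∀ j → 0# ≤ ℙ j) → (∀ j → ℙ j ≤ 1#) → {X Y : Subset n → Carrier} →
             (∀ ω → X ω ≤ Y ω) → 𝔼 ℙ X ≤ 𝔼 ℙ Y
  𝔼-mono-≤ {ℕ.zero}  ℙ ℙ≥0 ℙ≤1 X≤Y = X≤Y []
  𝔼-mono-≤ {ℕ.suc n} ℙ ℙ≥0 ℙ≤1 X≤Y = +-mono-≤
    (*-monoˡ-≤ (ℙ≥0 zero) (𝔼-mono-≤ (ℙ ∘ suc) (ℙ≥0 ∘ suc) (ℙ≤1 ∘ suc) (X≤Y ∘ (true ∷_))))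
    (*-monoˡ-≤ (x≤y⇒0≤y-x (ℙ≤1 zero)) (𝔼-mono-≤ (ℙ ∘ suc) (ℙ≥0 ∘ suc) (ℙ≤1 ∘ suc) (X≤Y ∘ (false ∷_))))

  𝔼-+ : ∀ {n} ℙ (X Y : Subset n → Carrier) → 𝔼 ℙ (λ ω → X ω + Y ω) ≈ 𝔼 ℙ X + 𝔼 ℙ Y
  𝔼-+ {ℕ.zero}  ℙ X Y = refl
  𝔼-+ {ℕ.suc n} ℙ X Y = trans
    (+-cong (*-congˡ (𝔼-+ (ℙ ∘ suc) (X ∘ (true ∷_)) (Y ∘ (true ∷_))))
            (*-congˡ (𝔼-+ (ℙ ∘ suc) (X ∘ (false ∷_)) (Y ∘ (false ∷_)))))
    (solve 6 (λ p q a b c d → p :* (a :+ b) :+ q :* (c :+ d) := p :* a :+ q :* c :+ (p :* b :+ q :* d))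
      refl (ℙ zero) (1# - ℙ zero) _ _ _ _)

  𝔼-* : ∀ {n} ℙ y (X : Subset n → Carrier) → 𝔼 ℙ (λ ω → y * X ω) ≈ y * 𝔼 ℙ X
  𝔼-* {ℕ.zero}  ℙ y X = refl
  𝔼-* {ℕ.suc n} ℙ y X = trans
    (+-cong (*-congˡ (𝔼-* (ℙ ∘ suc) y (X ∘ (true ∷_)))) (*-congˡ (𝔼-* (ℙ ∘ suc) y (X ∘ (false ∷_)))))
    (solve 5 (λ p q y a b → p :* (y :* a) :+ q :* (y :* b) := y :* (p :* a :+ q :* b))
      refl (ℙ zero) (1# - ℙ zero) y _ _)

  𝔼-const : ∀ {n} (ℙ : Fin n → Carrier) x → 𝔼 ℙ (λ _ → x) ≈ x
  𝔼-const {ℕ.zero}  ℙ x = refl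
  𝔼-const {ℕ.suc n} ℙ x = trans (+-cong (*-congˡ (𝔼-const (ℙ ∘ suc) x)) (*-congˡ (𝔼-const (ℙ ∘ suc) x)))
    (trans (sym (distribʳ x _ _)) (trans (*-congʳ (trans (+-comm _ _) (1-x+x≈1 (ℙ zero)))) (*-identityˡ x)))

  𝔼-sum : ∀ {n k} ℙ (X : Fin k → Subset n → Carrier) →
          𝔼 ℙ (λ ω → sum λ i → X i ω) ≈ sum λ i → 𝔼 ℙ (X i)
  𝔼-sum {k = ℕ.zero}  ℙ X = 𝔼-const ℙ 0#
  𝔼-sum {k = ℕ.suc k} ℙ X = trans (𝔼-+ ℙ (X zero) (λ ω → sum λ i → X (suc i) ω)) (+-congˡ (𝔼-sum ℙ (X ∘ suc)))

  𝔼-others : ∀ {n k} ℙ j (X : Fin k → Subset n → Carrier) →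
             𝔼 ℙ (λ ω → others j λ i → X i ω) ≈ others j λ i → 𝔼 ℙ (X i)
  𝔼-others ℙ j X = trans (𝔼-sum ℙ λ i ω → except j (λ i → X i ω) i) (sum-cong-≋ 𝔼-if)
    where
    𝔼-if : ∀ i → 𝔼 ℙ (λ ω → except j (λ i → X i ω) i) ≈ except j (λ i → 𝔼 ℙ (X i)) i
    𝔼-if i with does (j Fin.≟ i)
    ... | true  = 𝔼-const ℙ 0#
    ... | false = refl

  𝔼-lookup : ∀ {n} ℙ j (g : Bool → Carrier) →
             𝔼 {n} ℙ (λ ω → g (lookup ω j)) ≈ ℙ j * g true + (1# - ℙ j) * g false
  𝔼-lookup ℙ zero g =
    +-cong (*-congˡ (𝔼-const (ℙ ∘ suc) (g true))) (*-congˡ (𝔼-const (ℙ ∘ suc) (g false)))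
  𝔼-lookup ℙ (suc j) g = trans
    (+-cong (*-congˡ (𝔼-lookup (ℙ ∘ suc) j g)) (*-congˡ (𝔼-lookup (ℙ ∘ suc) j g)))
    (trans (sym (distribʳ _ _ _)) (trans (*-congʳ (trans (+-comm _ _) (1-x+x≈1 (ℙ zero)))) (*-identityˡ _)))

-- The expected charge of one job under its testing probability.

module TestProbability {c ℓ₁ ℓ₂} (K : ArchimedeanField c ℓ₁ ℓ₂) where
  open Scheduling K
  open OrderedFieldProperties (ArchimedeanField.orderedField K)
  open Charging K using (charge)
  open Expectation K using (1-x+x≈1)
  open ≤-Reasoning poset

  0<two : 0# < two
  0<two = fromℕ-positive 2

  half : Carrier
  half = two ⁻¹

  two*half : two * half ≈ 1#
  two*half = ⁻¹-inverseʳ two (<⇒≉ 0<two)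

  denominator : Carrier → Carrier
  denominator r =
    two * ( max (max (two / r + 1#) (two / r)) ((1# + 1# / two) * (1# + 1# / r))
          - max (max two two) (1# + 1# / two)
          + r - 1#)
    + r - 1#

  module _ {r : Carrier} (1≤r : 1# ≤ r) (r≤3 : r ≤ three) where

    private
      y e g : Carrier
      y = r ⁻¹
      e = r - 1#
      g = three * y - 1#

      0<r : 0# < r
      0<r = <-≤-trans 0<1 1≤r

      ry≈1 : r * y ≈ 1#
      ry≈1 = ⁻¹-inverseʳ r (<⇒≉ 0<r)

      0≤y : 0# ≤ y
      0≤y = ⁻¹-nonneg 0<r

      e+1≈r : e + 1# ≈ r
      e+1≈r = x-y+y≈x r 1#

      g+1≈3y : g + 1# ≈ three * y
      g+1≈3y = x-y+y≈x (three * y) 1#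

      0≤e : 0# ≤ e
      0≤e = x≤y⇒0≤y-x 1≤r

      y≤1 : y ≤ 1#
      y≤1 = ≤-respʳ ry≈1 (≤-respˡ (*-identityˡ y) (*-monoʳ-≤ 0≤y 1≤r))

      0≤g : 0# ≤ g
      0≤g = x≤y⇒0≤y-x (≤-respˡ ry≈1 (*-monoʳ-≤ 0≤y r≤3))

      1+half≤2 : 1# + 1# / two ≤ two
      1+half≤2 = linear {l = half + 0#} {r = two * half}
        (linear {l = 0#} {r = half} (⁻¹-nonneg 0<two)
          (solve 1 (λ h → h :+ con 0 :+ h := num 2 :* h :+ con 0) refl half))
        (trans (+-congˡ two*half) (solve 1 (λ h → con 1 :+ con 1 :* h :+ con 1 := num 2 :+ (h :+ con 0)) refl half))

      max₂≈ : max (max two two) (1# + 1# / two) ≈ two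
      max₂≈ = trans (x≤y⇒y⊔x≈y (≤-respʳ (sym (x≤y⇒x⊔y≈y ≤-refl)) 1+half≤2)) (x≤y⇒x⊔y≈y ≤-refl)

      -- The last term exceeds `two / r + 1#` by `(1 - y) / 2`, which is nonnegative because
      -- `1 ≤ r`.
      max₁≈ : max (max (two / r + 1#) (two / r)) ((1# + 1# / two) * (1# + 1# / r)) ≈
              (1# + half) * (1# + y)
      max₁≈ = trans (x≤y⇒x⊔y≈y (≤-respˡ (sym (x≤y⇒y⊔x≈y (x≤x+y 0≤1))) le))
                    (*-cong (+-congˡ (*-identityˡ half)) (+-congˡ (*-identityˡ y)))
        where
        le : two / r + 1# ≤ (1# + 1# / two) * (1# + 1# / r)
        le = *-cancelˡ-≤ 0<two (linear
          (+-mono-≤ y≤1 (≤-reflexive (*-congʳ {x = 1# + y} (sym two*half))))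
          (solve 2 (λ y h →
              num 2 :* (num 2 :* y :+ con 1) :+ (con 1 :+ num 2 :* h :* (con 1 :+ y))
            := num 2 :* ((con 1 :+ con 1 :* h) :* (con 1 :+ con 1 :* y)) :+ (y :+ con 1 :* (con 1 :+ y)))
            refl y half))

    -- The two summands are the numerators of `P` and of `1 - P`, which makes both probabilities
    -- nonnegative and lets averages be computed after multiplication by the denominator.
    denominator≈ : denominator r ≈ three * e + g
    denominator≈ = linear-≈
      (+-cong (+-cong (+-cong (x-y+y≈x z₃′ 1#) (*-congˡ {x = two} (x-y+y≈x z₂′ 1#)))
                      (+-cong (*-congˡ {x = two} (x-y+y≈x X Y)) (*-congˡ {x = two} (sym max₂≈))))
              (+-cong (+-cong (*-congˡ {x = two} max₁≈) (*-congʳ {x = 1# + y} two*half))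
                      (+-cong (*-congˡ {x = three} (sym e+1≈r)) (sym g+1≈3y))))
      (solve 10 (λ z₃ z₂ z₁ X Y h y r e g →
          z₃ :+ (num 2 :* z₂ :+ r :+ num 2 :* (z₁ :+ r) :+ (num 2 :* X :+ num 2 :* Y) :+
            (num 2 :* ((con 1 :+ h) :* (con 1 :+ y)) :+ con 1 :* (con 1 :+ y) :+
              (num 3 :* (e :+ con 1) :+ (g :+ con 1))))
        := num 3 :* e :+ g :+
            (z₃ :+ con 1 :+ num 2 :* (z₂ :+ con 1) :+ (num 2 :* (z₁ :+ Y) :+ num 2 :* num 2) :+
              (num 2 :* X :+ num 2 :* h :* (con 1 :+ y) :+ (num 3 :* r :+ num 3 :* y))))
        refl (denominator r) z₂ (X - Y) X Y half y r e g)
      where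
      X Y z₂′ z₂ z₃′ : Carrier
      X   = max (max (two / r + 1#) (two / r)) ((1# + 1# / two) * (1# + 1# / r))
      Y   = max (max two two) (1# + 1# / two)
      z₂′ = X - Y + r
      z₂  = z₂′ - 1#
      z₃′ = two * z₂ + r

    -- This is `r + y ≥ 2`, by `rearrangement` and `r * y ≈ 1`. It keeps the denominator positive.
    two≤3e+g : two ≤ three * e + g
    two≤3e+g = linear
      (+-mono-≤ (+-mono-≤ (*-monoˡ-≤ (fromℕ-nonneg 3) (rearrangement 1≤r y≤1))
                          (≤-reflexive (*-congˡ {x = three} (sym ry≈1))))
                (≤-reflexive (+-cong (*-congˡ {x = three} (sym e+1≈r)) (sym g+1≈3y))))
      (solve 4 (λ r y e g →
          num 2 :+ (num 3 :* (con 1 :* y :+ r :* con 1) :+ num 3 :* (r :* y) :+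
            (num 3 :* (e :+ con 1) :+ (g :+ con 1)))
        := num 3 :* e :+ g :+ (num 3 :* (con 1 :* con 1 :+ r :* y) :+ num 3 :* con 1 :+
            (num 3 :* r :+ num 3 :* y)))
        refl r y e g)

    private
      D P Q : Carrier
      D = denominator r
      P = ((two + 1#) * (r - 1#)) / D
      Q = 1# - P

      0<D : 0# < D
      0<D = <-≤-trans 0<two (≤-respʳ (sym denominator≈) two≤3e+g)

      DP≈3e : D * P ≈ three * e
      DP≈3e = trans
        (solve 3 (λ d d⁻¹ e → d :* ((num 2 :+ con 1) :* e :* d⁻¹) := num 3 :* e :* (d :* d⁻¹))
          refl D (D ⁻¹) e)
        (trans (*-congˡ (⁻¹-inverseʳ D (<⇒≉ 0<D))) (*-identityʳ _))

      DQ≈g : D * Q ≈ g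
      DQ≈g = linear-≈ (+-cong (+-cong (*-congˡ {x = D} (1-x+x≈1 P)) denominator≈) (sym DP≈3e))
        (solve 5 (λ d p q e g → d :* q :+ (d :* con 1 :+ (num 3 :* e :+ g) :+ d :* p)
                              := g :+ (d :* (q :+ p) :+ d :+ num 3 :* e)) refl D P Q e g)

    middle-nonneg : 0# ≤ P
    middle-nonneg = *-cancelˡ-≤ 0<D (≤-respʳ (sym DP≈3e) (≤-respˡ (sym (zeroʳ D)) (*-nonneg (fromℕ-nonneg 3) 0≤e)))

    middle≤1 : P ≤ 1#
    middle≤1 = *-cancelˡ-≤ 0<D (begin
      D * P        ≈⟨ DP≈3e ⟩
      three * e    ≤⟨ x≤x+y 0≤g ⟩
      three * e + g ≈⟨ denominator≈ ⟨
      D            ≈⟨ *-identityʳ D ⟨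
      D * 1#       ∎)

    module _ {a : Carrier} (quadratic : three * (r * r) + fromℕ 4 * (a * r) ≤ a * (three * (r * r) + three) + r)
             {t u : Carrier} (0≤t : 0# ≤ t) (rt≈u : r * t ≈ u) where

      private
        -- This is `quadratic` divided by `r`. The next two inequalities are the same one in
        -- disguise, as `4 e + g r` and `3 e y + D` both equal `3 r - 1`: this is the balance
        -- achieved by the testing probability.
        3r≤aD+1 : three * r ≤ a * D + 1#
        3r≤aD+1 = *-cancelˡ-≤ 0<r (linear
          (+-mono-≤ (+-mono-≤ quadratic (≤-reflexive (*-congˡ {x = a * r} (sym denominator≈))))
            (≤-reflexive (+-cong (*-congˡ {x = three * (a * r)} (sym e+1≈r))
              (+-cong (*-congˡ {x = a * r} (sym g+1≈3y)) (*-congˡ {x = three * a} (sym ry≈1))))))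
          (solve 6 (λ r y e g a d →
              r :* (num 3 :* r) :+ (a :* (num 3 :* (r :* r) :+ num 3) :+ r :+ a :* r :* d :+
                (num 3 :* (a :* r) :* (e :+ con 1) :+ (a :* r :* (g :+ con 1) :+ num 3 :* a :* (r :* y))))
            := r :* (a :* d :+ con 1) :+ (num 3 :* (r :* r) :+ num 4 :* (a :* r) :+ a :* r :* (num 3 :* e :+ g) :+
                (num 3 :* (a :* r) :* r :+ (a :* r :* (num 3 :* y) :+ num 3 :* a :* con 1))))
            refl r y e g a D))

        4e+gr≤aD : fromℕ 4 * e + g * r ≤ a * D
        4e+gr≤aD = linear
          (+-mono-≤ 3r≤aD+1 (≤-reflexive (+-cong (*-congˡ {x = fromℕ 4} e+1≈r)
            (+-cong (*-congʳ {x = r} g+1≈3y) (*-congˡ {x = three} ry≈1)))))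
          (solve 6 (λ r y e g a d →
              num 4 :* e :+ g :* r :+ (a :* d :+ con 1 :+
                (num 4 :* r :+ (num 3 :* y :* r :+ num 3 :* con 1)))
            := a :* d :+ (num 3 :* r :+ (num 4 :* (e :+ con 1) :+ ((g :+ con 1) :* r :+ num 3 :* (r :* y)))))
            refl r y e g a D)

        3ey+D≤aD : three * e * y + D ≤ a * D
        3ey+D≤aD = linear
          (+-mono-≤ (+-mono-≤ 3r≤aD+1 (≤-reflexive denominator≈))
            (≤-reflexive (+-cong (*-congˡ {x = three * y + three} e+1≈r)
              (+-cong g+1≈3y (*-congˡ {x = three} ry≈1)))))
          (solve 6 (λ r y e g a d →
              num 3 :* e :* y :+ d :+ (a :* d :+ con 1 :+ (num 3 :* e :+ g) :+
                ((num 3 :* y :+ num 3) :* r :+ (num 3 :* y :+ num 3 :* con 1)))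
            := a :* d :+ (num 3 :* r :+ d :+ ((num 3 :* y :+ num 3) :* (e :+ con 1) :+
                (g :+ con 1 :+ num 3 :* (r :* y)))))
            refl r y e g a D)

        yu≈t : y * u ≈ t
        yu≈t = trans (*-congˡ (sym rt≈u)) (*⁻¹-cancel 0<r t)

        D-average : ∀ v w → D * (P * v + Q * w) ≈ three * e * v + g * w
        D-average v w = trans
          (solve 5 (λ d p q v w → d :* (p :* v :+ q :* w) := d :* p :* v :+ d :* q :* w) refl D P Q v w)
          (+-cong (*-congʳ DP≈3e) (*-congʳ DQ≈g))

      -- The extreme case is `p = 0`: replacing `u = r t` by `r w` loses nothing for `w = t`, and
      -- then everything is a multiple of `w`.
      middle≤tested : ∀ {w} → t ≤ w → P * (fromℕ 4 * w) + Q * (three * u) ≤ three * a * w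
      middle≤tested {w} t≤w = *-cancelˡ-≤ 0<D (begin
        D * (P * (fromℕ 4 * w) + Q * (three * u))
          ≈⟨ D-average _ _ ⟩
        three * e * (fromℕ 4 * w) + g * (three * u)
          ≤⟨ +-monoʳ-≤ _ (*-monoˡ-≤ 0≤g (*-monoˡ-≤ (fromℕ-nonneg 3)
               (≤-respˡ rt≈u (*-monoˡ-≤ (<⇒≤ 0<r) t≤w)))) ⟩
        three * e * (fromℕ 4 * w) + g * (three * (r * w))
          ≈⟨ solve 4 (λ e g r w → num 3 :* e :* (num 4 :* w) :+ g :* (num 3 :* (r :* w))
                               := num 3 :* w :* (num 4 :* e :+ g :* r)) refl e g r w ⟩
        three * w * (fromℕ 4 * e + g * r)
          ≤⟨ *-monoˡ-≤ (*-nonneg (fromℕ-nonneg 3) (≤-trans 0≤t t≤w)) 4e+gr≤aD ⟩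
        three * w * (a * D)
          ≈⟨ solve 3 (λ w a d → num 3 :* w :* (a :* d) := d :* (num 3 :* a :* w)) refl w a D ⟩
        D * (three * a * w) ∎)

      -- The extreme case is `p = u`, where the charge of the tested job is `3 (t + u)`. Writing `t`
      -- as `y u` makes everything a multiple of `u`.
      middle≤untested : P * (three * (t + u)) + Q * (three * u) ≤ three * a * u
      middle≤untested = *-cancelˡ-≤ 0<D (begin
        D * (P * (three * (t + u)) + Q * (three * u))
          ≈⟨ D-average _ _ ⟩
        three * e * (three * (t + u)) + g * (three * u)
          ≈⟨ solve 4 (λ e g t u → num 3 :* e :* (num 3 :* (t :+ u)) :+ g :* (num 3 :* u)
                               := num 3 :* (num 3 :* e :* t :+ (num 3 :* e :+ g) :* u)) refl e g t u ⟩
        three * (three * e * t + (three * e + g) * u)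
          ≈⟨ *-congˡ (+-cong (*-congˡ (sym yu≈t)) (*-congʳ (sym denominator≈))) ⟩
        three * (three * e * (y * u) + D * u)
          ≈⟨ solve 4 (λ e y d u → num 3 :* (num 3 :* e :* (y :* u) :+ d :* u)
                               := num 3 :* u :* (num 3 :* e :* y :+ d)) refl e y D u ⟩
        three * u * (three * e * y + D)
          ≤⟨ *-monoˡ-≤ (*-nonneg (fromℕ-nonneg 3) (≤-respʳ rt≈u (*-nonneg (<⇒≤ 0<r) 0≤t))) 3ey+D≤aD ⟩
        three * u * (a * D)
          ≈⟨ solve 3 (λ u a d → num 3 :* u :* (a :* d) := d :* (num 3 :* a :* u)) refl u a D ⟩
        D * (three * a * u) ∎)

  module _ {n} (I : Instance n) where
    open Instance I

    expectedCharge : Carrier → Fin n → Carrier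
    expectedCharge P j = P * charge I true j + (1# - P) * charge I false j

    optimalWork : Fin n → Carrier
    optimalWork j = min (u j) (t j + p j)

    IsGood : Carrier → Carrier → Fin n → Set _
    IsGood a P j = 0# ≤ P × P ≤ 1# × expectedCharge P j ≤ three * a * optimalWork j

    module _ {a : Carrier} (4≤3a : fromℕ 4 ≤ three * a)
      (quadratic : ∀ x → three * (x * x) + fromℕ 4 * (a * x) ≤ a * (three * (x * x) + three) + x)
      (j : Fin n) where

      private
        r = u j / t j
        T = t j
        U = u j
        W = t j + p j

        rt≈u : r * T ≈ U
        rt≈u = trans (*-assoc U (T ⁻¹) T)
          (trans (*-congˡ (trans (*-comm _ _) (⁻¹-inverseʳ T (<⇒≉ (t>0 j))))) (*-identityʳ U))

        0≤T : 0# ≤ T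
        0≤T = <⇒≤ (t>0 j)

        0≤U : 0# ≤ U
        0≤U = <⇒≤ (u>0 j)

        T≤W : T ≤ W
        T≤W = x≤x+y (p≥0 j)

        charge≤4W : charge I true j ≤ fromℕ 4 * W
        charge≤4W = ⊔-lub
          (linear (+-mono-≤ (p≥0 j) (p≥0 j)) (solve 2 (λ t p →
            num 4 :* t :+ num 2 :* p :+ (p :+ p) := num 4 :* (t :+ p) :+ (con 0 :+ con 0)) refl T (p j)))
          (linear (≤-trans 0≤T T≤W) (solve 2 (λ t p →
            num 3 :* (t :+ p) :+ (t :+ p) := num 4 :* (t :+ p) :+ con 0) refl T (p j)))

        3x≤4x : ∀ {x} → 0# ≤ x → three * x ≤ fromℕ 4 * x
        3x≤4x {x} 0≤x = linear 0≤x (solve 1 (λ x → num 3 :* x :+ x := num 4 :* x :+ con 0) refl x)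

        4x≤3ax : ∀ {x} → 0# ≤ x → fromℕ 4 * x ≤ three * a * x
        4x≤3ax 0≤x = *-monoʳ-≤ 0≤x 4≤3a

        ≤min : ∀ {x} → x ≤ three * a * U → x ≤ three * a * W → x ≤ three * a * optimalWork j
        ≤min x≤U x≤W with ⊓-sel U W
        ... | inj₁ eq = ≤-respʳ (*-congˡ (sym eq)) x≤U
        ... | inj₂ eq = ≤-respʳ (*-congˡ (sym eq)) x≤W

        0-average : ∀ x y → 0# * x + (1# - 0#) * y ≈ y
        0-average x y = trans (+-cong (zeroˡ x) (*-congʳ (trans (sym (+-identityʳ _)) (1-x+x≈1 0#))))
          (trans (+-identityˡ _) (*-identityˡ y))

        1-average : ∀ x y → 1# * x + (1# - 1#) * y ≈ x
        1-average x y = trans (+-cong (*-identityˡ x) (trans (*-congʳ (-‿inverseʳ 1#)) (zeroˡ y))) (+-identityʳ x)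

        -- Outside the interval [1, 3] the charge of the certain choice is at most four times the
        -- optimal work, here and in `always`, and `4 ≤ 3 a` is enough.
        never : r < 1# → IsGood a 0# j
        never r<1 = ≤-refl , 0≤1 , ≤-respˡ (sym (0-average _ _)) (≤-trans (3x≤4x 0≤U)
          (≤min (4x≤3ax 0≤U) (≤-trans
            (*-monoˡ-≤ (fromℕ-nonneg 4) (≤-trans U≤T T≤W)) (4x≤3ax (≤-trans 0≤T T≤W)))))
          where
          U≤T : U ≤ T
          U≤T = ≤-respˡ rt≈u (≤-respʳ (*-identityˡ T) (*-monoʳ-≤ 0≤T (<⇒≤ r<1)))

        always : three < r → IsGood a 1# j
        always 3<r = 0≤1 , ≤-refl , ≤-respˡ (sym (1-average _ _)) (≤min
          (≤-trans charge≤4U (4x≤3ax 0≤U)) (≤-trans charge≤4W (4x≤3ax (≤-trans 0≤T T≤W))))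
          where
          3T≤U : three * T ≤ U
          3T≤U = ≤-respʳ rt≈u (*-monoʳ-≤ 0≤T (<⇒≤ 3<r))

          charge≤4U : charge I true j ≤ fromℕ 4 * U
          charge≤4U = ⊔-lub
            (linear (+-mono-≤ (+-mono-≤ (+-mono-≤ 3T≤U 3T≤U) (+-mono-≤ (p≤u j) (p≤u j))) (+-mono-≤ 0≤T 0≤T))
              (solve 3 (λ t u p →
                  num 4 :* t :+ num 2 :* p :+ (u :+ u :+ (u :+ u) :+ (t :+ t))
                := num 4 :* u :+ (num 3 :* t :+ num 3 :* t :+ (p :+ p) :+ (con 0 :+ con 0))) refl T U (p j)))
            (linear (+-mono-≤ 3T≤U (*-monoˡ-≤ (fromℕ-nonneg 3) (p≤u j)))
              (solve 3 (λ t u p →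
                  num 3 :* (t :+ p) :+ (u :+ num 3 :* u)
                := num 4 :* u :+ (num 3 :* t :+ num 3 :* p)) refl T U (p j)))

        -- The charge is bounded twice: through `p ≤ u` for the comparison with `u`, and by
        -- `4 (t + p)` for the comparison with `t + p`.
        sometimes : (1≤r : 1# ≤ r) (r≤3 : r ≤ three) →
                    IsGood a (((two + 1#) * (r - 1#)) / denominator r) j
        sometimes 1≤r r≤3 = P≥0 , P≤1 , ≤min
          (≤-trans (average≤ charge≤3T+3U) (middle≤untested 1≤r r≤3 {a} (quadratic r) 0≤T rt≈u))
          (≤-trans (average≤ charge≤4W) (middle≤tested 1≤r r≤3 {a} (quadratic r) 0≤T rt≈u T≤W))
          where
          P≥0 = middle-nonneg 1≤r r≤3
          P≤1 = middle≤1 1≤r r≤3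

          average≤ : ∀ {x} → charge I true j ≤ x → expectedCharge _ j ≤ _ * x + (1# - _) * (three * U)
          average≤ le = +-monoˡ-≤ _ (*-monoˡ-≤ P≥0 le)

          T≤U : T ≤ U
          T≤U = ≤-respˡ (*-identityˡ T) (≤-respʳ rt≈u (*-monoʳ-≤ 0≤T 1≤r))

          charge≤3T+3U : charge I true j ≤ three * (T + U)
          charge≤3T+3U = ⊔-lub
            (linear (+-mono-≤ T≤U (+-mono-≤ (p≤u j) (p≤u j))) (solve 3 (λ t u p →
                num 4 :* t :+ num 2 :* p :+ (u :+ (u :+ u)) := num 3 :* (t :+ u) :+ (t :+ (p :+ p)))
                refl T U (p j)))
            (*-monoˡ-≤ (fromℕ-nonneg 3) (+-monoʳ-≤ T (p≤u j)))

      testProbability-good : IsGood a (testProbabilities two I j) j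
      testProbability-good = good
        where
        good : IsGood a (if does (r <? 1#) then 0# else if does (three <? r) then 1# else
                         ((two + 1#) * (r - 1#)) / denominator r) j
        good with r <? 1#
        ... | yes r<1 = never r<1
        ... | no  r≮1 with three <? r
        ...   | yes 3<r = always 3<r
        ...   | no  3≮r = sometimes (≮⇒≥ r≮1) (≮⇒≥ 3≮r)

-- Expected cost of the algorithm and cost of OPT in terms of the optimal work.

module Competitiveness {c ℓ₁ ℓ₂} (K : ArchimedeanField c ℓ₁ ℓ₂) where
  open Scheduling K
  open OrderedFieldProperties (ArchimedeanField.orderedField K)
  open RequiredTasks K
  open ListScheduling K
  open Charging K
  open Expectation K
  open TestProbability K
  open ≤-Reasoning poset hiding (start)

  module _ {n} (I : Instance n) where
    open Instance I

    private
      x = optimalWork I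

    x≤work : ∀ b j → x j ≤ work I b j
    x≤work true  j = x⊓y≤y (u j) (t j + p j)
    x≤work false j = x⊓y≤x (u j) (t j + p j)

    3work≤charge : ∀ b j → three * work I b j ≤ charge I b j
    3work≤charge true  j = x≤y⊔x _ _
    3work≤charge false j = ≤-refl

    x≥0 : ∀ j → 0# ≤ x j
    x≥0 j = ⊓-glb (<⇒≤ (u>0 j)) (<⇒≤ (work-positive I true j))

    ∑x≥0 : 0# ≤ sum x
    ∑x≥0 = sum-nonneg x≥0

    pairs≥0 : 0# ≤ sum λ j → others j λ i → min (x j) (x i)
    pairs≥0 = sum-nonneg λ j → others-nonneg j λ i → ⊓-glb (x≥0 j) (x≥0 i)

    -- Decided by the comparison that defines `min`, and by `x` alone: the choice is fixed before
    -- the coins are tossed, so the expected charge of `smaller j i` is a marginal.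
    smaller : Fin n → Fin n → Fin n
    smaller j i = [ (λ _ → j) , (λ _ → i) ]′ (total (x j) (x i))

    x-smaller : ∀ j i → x (smaller j i) ≈ min (x j) (x i)
    x-smaller j i with total (x j) (x i)
    ... | inj₁ _ = refl
    ... | inj₂ _ = refl

    module _ {m} .{{_ : NonZero m}} where

      private
        4m : Carrier → Carrier
        4m y = fromℕ 4 * (fromℕ m * y)

        pairs : (Fin n → Fin n → Carrier) → Carrier
        pairs f = sum λ j → others j (f j)

      -- The factor 4 arises because a pair of jobs occurs twice in the sum while its delay is at
      -- most half a charge.
      costBound : Subset n → Carrier
      costBound ω = sum λ j → 4m (work I (lookup ω j) j) +
                              others j λ i → charge I (lookup ω (smaller j i)) (smaller j i)

      cost≤costBound : ∀ ω (S : Schedule m n) → RPCPM I two ω S → 4m (cost I S ω) ≤ costBound ω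
      cost≤costBound ω S run with history-of-run I two S ω (initial-invariant I two S ω) run
      ... | H , history , H↭ = begin
        4m (cost I S ω)
          ≈⟨ *-congˡ (*-distribˡ-sum (fromℕ m) λ j → end I S (lastTask ω j)) ⟩
        fromℕ 4 * sum (λ j → fromℕ m * end I S (lastTask ω j))
          ≤⟨ *-monoˡ-≤ (fromℕ-nonneg 4) (sum-mono-≤ λ j → proj₂ (completed j)) ⟩
        fromℕ 4 * sum (λ j → fromℕ m * work I (lookup ω j) j + others j (delay j))
          ≈⟨ *-congˡ (∑-distrib-+ (λ j → fromℕ m * work I (lookup ω j) j) (λ j → others j (delay j))) ⟩
        fromℕ 4 * (sum (λ j → fromℕ m * work I (lookup ω j) j) + pairs delay)
          ≈⟨ trans (distribˡ (fromℕ 4) _ _)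
               (+-congʳ (*-distribˡ-sum (fromℕ 4) λ j → fromℕ m * work I (lookup ω j) j)) ⟩
        sum (λ j → 4m (work I (lookup ω j) j)) + fromℕ 4 * pairs delay
          ≤⟨ +-monoʳ-≤ _ delays ⟩
        sum (λ j → 4m (work I (lookup ω j) j)) + pairs charged
          ≈⟨ ∑-distrib-+ (λ j → 4m (work I (lookup ω j) j)) (λ j → others j (charged j)) ⟨
        costBound ω ∎
        where
        completed : ∀ j → Completion I two S {ω} history H↭ j (lookup ω j)
        completed j = completion I two S {ω} history H↭ j (lookup ω j) ≡.refl

        r : ∀ j → Reference I two S H j (lookup ω j)
        r j = proj₁ (completed j)

        delay charged : Fin n → Fin n → Carrier
        delay j i = ahead I two S H (reference I two S (r j)) (lookup ω i) i
        charged j i = charge I (lookup ω (smaller j i)) (smaller j i)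

        delay≤ : ∀ j i → j ≢ i → two * (delay j i + delay i j) ≤ charged j i
        delay≤ j i j≢i with total (x j) (x i)
        ... | inj₁ _ = ≤-respˡ (*-congˡ (+-comm _ _))
          (pair-charge I S {ω} history H↭ j≢i ≡.refl ≡.refl (r j) (r i))
        ... | inj₂ _ = pair-charge I S {ω} history H↭ (j≢i ∘ ≡.sym) ≡.refl ≡.refl (r i) (r j)

        delays : fromℕ 4 * pairs delay ≤ pairs charged
        delays = begin
          fromℕ 4 * pairs delay
            ≈⟨ solve 1 (λ d → num 4 :* d := num 2 :* (d :+ d)) refl (pairs delay) ⟩
          two * (pairs delay + pairs delay)
            ≈⟨ *-congˡ (+-congˡ (others-transpose delay)) ⟩
          two * (pairs delay + pairs (λ j i → delay i j))
            ≈⟨ *-congˡ (∑-distrib-+ (λ j → others j (delay j)) (λ j → others j λ i → delay i j)) ⟨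
          two * sum (λ j → others j (delay j) + others j (λ i → delay i j))
            ≈⟨ *-distribˡ-sum two (λ j → others j (delay j) + others j (λ i → delay i j)) ⟩
          sum (λ j → two * (others j (delay j) + others j (λ i → delay i j)))
            ≈⟨ sum-cong-≋ (λ j → trans (*-congˡ (sym (others-+ j (delay j) (λ i → delay i j))))
                                       (sym (others-* j two (λ i → delay j i + delay i j)))) ⟩
          pairs (λ j i → two * (delay j i + delay i j))
            ≤⟨ sum-mono-≤ (λ j → others-mono-≤ j (delay≤ j)) ⟩
          pairs charged ∎

      module _ {a : Carrier} (ℙ : Fin n → Carrier) (good : ∀ j → IsGood I a (ℙ j) j) where

        private
          ℙ≥0 : ∀ j → 0# ≤ ℙ j
          ℙ≥0 j = proj₁ (good j)

          ℙ≤1 : ∀ j → ℙ j ≤ 1#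
          ℙ≤1 j = proj₁ (proj₂ (good j))

        𝔼-charge≤ : ∀ j → 𝔼 ℙ (λ ω → charge I (lookup ω j) j) ≤ three * a * x j
        𝔼-charge≤ j = ≤-respˡ (sym (𝔼-lookup ℙ j λ b → charge I b j)) (proj₂ (proj₂ (good j)))

        𝔼-work≤ : ∀ j → 𝔼 ℙ (λ ω → work I (lookup ω j) j) ≤ a * x j
        𝔼-work≤ j = *-cancelˡ-≤ (fromℕ-positive 3) (begin
          three * 𝔼 ℙ (λ ω → work I (lookup ω j) j)   ≈⟨ 𝔼-* ℙ three _ ⟨
          𝔼 ℙ (λ ω → three * work I (lookup ω j) j)   ≤⟨ 𝔼-mono-≤ ℙ ℙ≥0 ℙ≤1 (λ ω → 3work≤charge (lookup ω j) j) ⟩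
          𝔼 ℙ (λ ω → charge I (lookup ω j) j)         ≤⟨ 𝔼-charge≤ j ⟩
          three * a * x j                             ≈⟨ *-assoc three a (x j) ⟩
          three * (a * x j)                           ∎)

        𝔼-costBound≤ : 𝔼 ℙ costBound ≤ 4m (a * sum x) + three * a * pairs λ j i → min (x j) (x i)
        𝔼-costBound≤ = begin
          𝔼 ℙ costBound
            ≈⟨ 𝔼-sum ℙ (λ j ω → 4m (work I (lookup ω j) j) + others j (charged ω j)) ⟩
          sum (λ j → 𝔼 ℙ λ ω → 4m (work I (lookup ω j) j) + others j (charged ω j))
            ≈⟨ sum-cong-≋ (λ j → trans (𝔼-+ ℙ (λ ω → 4m (work I (lookup ω j) j)) (λ ω → others j (charged ω j)))
                 (+-cong (trans (𝔼-* ℙ (fromℕ 4) _) (*-congˡ (𝔼-* ℙ (fromℕ m) _)))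
                         (𝔼-others ℙ j (λ i ω → charged ω j i)))) ⟩
          sum (λ j → 4m (𝔼 ℙ λ ω → work I (lookup ω j) j) + others j (λ i → 𝔼 ℙ λ ω → charged ω j i))
            ≤⟨ sum-mono-≤ (λ j → +-mono-≤
                 (*-monoˡ-≤ (fromℕ-nonneg 4) (*-monoˡ-≤ (fromℕ-nonneg m) (𝔼-work≤ j)))
                 (others-mono-≤ j λ i _ → ≤-respʳ (*-congˡ (x-smaller j i)) (𝔼-charge≤ (smaller j i)))) ⟩
          sum (λ j → 4m (a * x j) + others j (λ i → three * a * min (x j) (x i)))
            ≈⟨ ∑-distrib-+ (λ j → 4m (a * x j)) (λ j → others j (λ i → three * a * min (x j) (x i))) ⟩
          sum (λ j → 4m (a * x j)) + pairs (λ j i → three * a * min (x j) (x i))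
            ≈⟨ +-cong
                 (trans (sym (*-distribˡ-sum (fromℕ 4) (λ j → fromℕ m * (a * x j))))
                   (*-congˡ (trans (sym (*-distribˡ-sum (fromℕ m) (λ j → a * x j)))
                     (*-congˡ (sym (*-distribˡ-sum a x))))))
                 (trans (sum-cong-≋ λ j → others-* j (three * a) (λ i → min (x j) (x i)))
                   (sym (*-distribˡ-sum (three * a) (λ j → others j λ i → min (x j) (x i))))) ⟩
          4m (a * sum x) + three * a * pairs (λ j i → min (x j) (x i)) ∎
          where
          charged : Subset n → Fin n → Fin n → Carrier
          charged ω j i = charge I (lookup ω (smaller j i)) (smaller j i)

        𝔼-cost≤ : (A : Subset n → Schedule m n) → (∀ ω → RPCPM I two ω (A ω)) →
          4m (𝔼 ℙ λ ω → cost I (A ω) ω) ≤ 4m (a * sum x) + three * a * pairs λ j i → min (x j) (x i)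
        𝔼-cost≤ A runs = begin
          4m (𝔼 ℙ λ ω → cost I (A ω) ω)
            ≈⟨ trans (𝔼-* ℙ (fromℕ 4) _) (*-congˡ (𝔼-* ℙ (fromℕ m) _)) ⟨
          𝔼 ℙ (λ ω → 4m (cost I (A ω) ω))
            ≤⟨ 𝔼-mono-≤ ℙ ℙ≥0 ℙ≤1 (λ ω → cost≤costBound ω (A ω) (runs ω)) ⟩
          𝔼 ℙ costBound
            ≤⟨ 𝔼-costBound≤ ⟩
          _ ∎

      module _ {τ} (S : Schedule m n) (feasible : Feasible I S τ) where
        open LowerBound K using (lower-bound; work≤cost)

        optimalWork≤cost : sum x ≤ cost I S τ
        optimalWork≤cost = ≤-trans (sum-mono-≤ λ j → x≤work (lookup τ j) j) (work≤cost I S feasible)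

        -- The lower bound is monotone in the work of each job, and this is at least `x` whichever
        -- jobs OPT tests. The diagonal of the double sum becomes the second `sum x`.
        optimalPairs≤cost : fromℕ m * sum x + (sum x + pairs (λ j i → min (x j) (x i))) ≤
                            fromℕ m * (two * cost I S τ)
        optimalPairs≤cost = ≤-trans (+-mono-≤
          (*-monoˡ-≤ (fromℕ-nonneg m) (sum-mono-≤ λ j → x≤work (lookup τ j) j))
          (begin
            sum x + pairs (λ j i → min (x j) (x i))
              ≈⟨ ∑-distrib-+ x (λ j → others j λ i → min (x j) (x i)) ⟨
            sum (λ j → x j + others j (λ i → min (x j) (x i)))
              ≈⟨ sum-cong-≋ (λ j → trans (+-congʳ (sym (x≤y⇒x⊓y≈x ≤-refl)))
                   (sym (sum-remove-at j λ i → min (x j) (x i)))) ⟩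
            sum (λ j → sum λ i → min (x j) (x i))
              ≤⟨ sum-mono-≤ (λ j → sum-mono-≤ λ i →
                   ⊓-mono-≤ (x≤work (lookup τ j) j) (x≤work (lookup τ i) i)) ⟩
            sum (λ j → sum λ i → min (work I (lookup τ j) j) (work I (lookup τ i) i)) ∎))
          (lower-bound I S feasible)

-- The numerical constants, the competitive ratio and its limit.

module Ratio {c ℓ₁ ℓ₂} (K : ArchimedeanField c ℓ₁ ℓ₂) where
  open Scheduling K
  open OrderedFieldProperties (ArchimedeanField.orderedField K)
  open TestProbability K
  open Competitiveness K
  open ≤-Reasoning poset

  a ρ : Carrier
  a = decimal 1434847 6
  ρ = decimal 2152271 6

  fromℕ-≡ : ∀ {k l} → k ≡ l → fromℕ k ≈ fromℕ l
  fromℕ-≡ eq = reflexive (≡.cong fromℕ eq)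

  0<10^ : ∀ k → 0# < fromℕ (10 ℕ.^ k)
  0<10^ k = fromℕ-positive (10 ℕ.^ k) {{ℕ.m^n≢0 10 k}}

  10^*decimal : ∀ x k → fromℕ (10 ℕ.^ k) * decimal x k ≈ fromℕ x
  10^*decimal x k = trans (solve 3 (λ d x d⁻¹ → d :* (x :* d⁻¹) := d⁻¹ :* (d :* x)) refl
    (fromℕ (10 ℕ.^ k)) (fromℕ x) (fromℕ (10 ℕ.^ k) ⁻¹)) (*⁻¹-cancel (0<10^ k) (fromℕ x))

  decimal-≤ : ∀ p x q y k → p ℕ.* x ℕ.≤ q ℕ.* y → fromℕ p * decimal x k ≤ fromℕ q * decimal y k
  decimal-≤ p x q y k le = *-cancelˡ-≤ (0<10^ k) (begin
    fromℕ (10 ℕ.^ k) * (fromℕ p * decimal x k)  ≈⟨ scale p x ⟩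
    fromℕ (p ℕ.* x)                             ≤⟨ fromℕ-mono-≤ le ⟩
    fromℕ (q ℕ.* y)                             ≈⟨ scale q y ⟨
    fromℕ (10 ℕ.^ k) * (fromℕ q * decimal y k)  ∎)
    where
    scale : ∀ p x → fromℕ (10 ℕ.^ k) * (fromℕ p * decimal x k) ≈ fromℕ (p ℕ.* x)
    scale p x = trans (solve 3 (λ d p x → d :* (p :* x) := p :* (d :* x)) refl _ (fromℕ p) (decimal x k))
      (trans (*-congˡ (10^*decimal x k)) (sym (fromℕ-homo-* p x)))

  decimal-1 : ∀ k → decimal (10 ℕ.^ k) k ≈ 1#
  decimal-1 k = ⁻¹-inverseʳ _ (<⇒≉ (0<10^ k))

  -- The discriminant of 3 (a - 1) x² - (4 a - 1) x + 3 a vanishes at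
  -- a = (14 + 6 √6) / 20, which 1.434847 rounds up.
  quadratic : ∀ N d A B → .{{NonZero A}} → .{{NonZero d}} →
    B ℕ.+ d ≡ 4 ℕ.* N → A ℕ.+ 3 ℕ.* d ≡ 3 ℕ.* N → B ℕ.* B ℕ.≤ 4 ℕ.* (A ℕ.* (3 ℕ.* N)) →
    ∀ {a} → fromℕ d * a ≈ fromℕ N →
    ∀ x → three * (x * x) + fromℕ 4 * (a * x) ≤ a * (three * (x * x) + three) + x
  quadratic N d A B B+d≡4N A+3d≡3N B²≤ {a} da≈N x = *-cancelˡ-≤ (fromℕ-positive d)
    (linear
      (+-mono-≤ (discriminant (fromℕ-positive A) B²≤′ x)
        (≤-reflexive (+-cong (+-cong (*-congʳ {x = x} (sym B+d≈4N)) (*-congʳ {x = x * x} A+3d≈3N))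
          (+-cong (*-congˡ {x = fromℕ 4 * x} da≈N) (*-congˡ {x = three * (x * x) + three} (sym da≈N))))))
      (solve 6 (λ N d A B a x →
          d :* (num 3 :* (x :* x) :+ num 4 :* (a :* x)) :+
            (A :* (x :* x) :+ num 3 :* N :+ ((B :+ d) :* x :+ num 3 :* N :* (x :* x) :+
              (num 4 :* x :* N :+ (num 3 :* (x :* x) :+ num 3) :* (d :* a))))
        := d :* (a :* (num 3 :* (x :* x) :+ num 3) :+ x) :+
            (B :* x :+ (num 4 :* N :* x :+ (A :+ num 3 :* d) :* (x :* x) :+
              (num 4 :* x :* (d :* a) :+ (num 3 :* (x :* x) :+ num 3) :* N))))
        refl (fromℕ N) (fromℕ d) (fromℕ A) (fromℕ B) a x))
    where
    B+d≈4N : fromℕ B + fromℕ d ≈ fromℕ 4 * fromℕ N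
    B+d≈4N = trans (sym (fromℕ-homo-+ B d)) (trans (fromℕ-≡ B+d≡4N) (fromℕ-homo-* 4 N))

    A+3d≈3N : fromℕ A + three * fromℕ d ≈ three * fromℕ N
    A+3d≈3N = trans (trans (+-congˡ (sym (fromℕ-homo-* 3 d))) (sym (fromℕ-homo-+ A (3 ℕ.* d))))
      (trans (fromℕ-≡ A+3d≡3N) (fromℕ-homo-* 3 N))

    B²≤′ : fromℕ B * fromℕ B ≤ fromℕ 4 * (fromℕ A * (three * fromℕ N))
    B²≤′ = begin
      fromℕ B * fromℕ B                        ≈⟨ fromℕ-homo-* B B ⟨
      fromℕ (B ℕ.* B)                          ≤⟨ fromℕ-mono-≤ B²≤ ⟩
      fromℕ (4 ℕ.* (A ℕ.* (3 ℕ.* N)))          ≈⟨ trans (fromℕ-homo-* 4 (A ℕ.* (3 ℕ.* N))) (*-congˡ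
                                                     (trans (fromℕ-homo-* A (3 ℕ.* N)) (*-congˡ (fromℕ-homo-* 3 N)))) ⟩
      fromℕ 4 * (fromℕ A * (three * fromℕ N))  ∎

  4≤3a : fromℕ 4 ≤ three * a
  4≤3a = ≤-respˡ (trans (*-congˡ (decimal-1 6)) (*-identityʳ _))
    (decimal-≤ 4 (10 ℕ.^ 6) 3 1434847 6 (ℕ.≤ᵇ⇒≤ 4000000 4304541 _))

  -- `ρ` is `3 a / 2` rounded up in the sixth decimal.
  3a≤2ρ : three * a ≤ two * ρ
  3a≤2ρ = decimal-≤ 3 1434847 2 2152271 6 (ℕ.≤ᵇ⇒≤ 4304541 4304542 _)

  ρ≤2a : ρ ≤ two * a
  ρ≤2a = ≤-respˡ (trans (*-congʳ (+-identityʳ 1#)) (*-identityˡ ρ))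
    (decimal-≤ 1 2152271 2 1434847 6 (ℕ.≤ᵇ⇒≤ 2152271 2869694 _))

  2a≤ρ+1 : two * a ≤ ρ + 1#
  2a≤ρ+1 = *-cancelˡ-≤ (0<10^ 6) (begin
    fromℕ (10 ℕ.^ 6) * (two * a)
      ≈⟨ solve 2 (λ d a → d :* (num 2 :* a) := num 2 :* (d :* a)) refl (fromℕ (10 ℕ.^ 6)) a ⟩
    two * (fromℕ (10 ℕ.^ 6) * a)
      ≈⟨ *-congˡ (10^*decimal 1434847 6) ⟩
    two * fromℕ 1434847
      ≈⟨ fromℕ-homo-* 2 1434847 ⟨
    fromℕ (2 ℕ.* 1434847)
      ≤⟨ fromℕ-mono-≤ {2 ℕ.* 1434847} {2152271 ℕ.+ 10 ℕ.^ 6} (ℕ.≤ᵇ⇒≤ 2869694 3152271 _) ⟩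
    fromℕ (2152271 ℕ.+ 10 ℕ.^ 6)
      ≈⟨ fromℕ-homo-+ 2152271 (10 ℕ.^ 6) ⟩
    fromℕ 2152271 + fromℕ (10 ℕ.^ 6)
      ≈⟨ +-cong (10^*decimal 2152271 6) (*-identityʳ _) ⟨
    fromℕ (10 ℕ.^ 6) * ρ + fromℕ (10 ℕ.^ 6) * 1#
      ≈⟨ distribˡ _ _ _ ⟨
    fromℕ (10 ℕ.^ 6) * (ρ + 1#) ∎)

  a≤ρ : a ≤ ρ
  a≤ρ = *-cancelˡ-≤ (fromℕ-positive 1) (decimal-≤ 1 1434847 1 2152271 6 (ℕ.≤ᵇ⇒≤ 1434847 2152271 _))

  0≤decimal : ∀ x k → 0# ≤ decimal x k
  0≤decimal x k = *-nonneg (fromℕ-nonneg x) (⁻¹-nonneg (0<10^ k))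

  a-quadratic : ∀ x → three * (x * x) + fromℕ 4 * (a * x) ≤ a * (three * (x * x) + three) + x
  -- 1304541 and 4739388 are `3 (a - 1)` and `4 a - 1`, scaled by a million.
  a-quadratic = quadratic 1434847 (10 ℕ.^ 6) 1304541 4739388 ≡.refl ≡.refl
    (ℕ.≤ᵇ⇒≤ (4739388 ℕ.* 4739388) (4 ℕ.* (1304541 ℕ.* 4304541)) _) (10^*decimal 1434847 6)

  0<2M : ∀ m → .{{_ : NonZero m}} → 0# < two * fromℕ m
  0<2M m = *-positive (fromℕ-positive 2) (fromℕ-positive m)

  -- The ratio with denominators cleared, `4 m R = 2 ρ (m + 1) + 4 a (m - 1)`, stated without
  -- subtraction.
  4m*ratio : ∀ m → .{{_ : NonZero m}} →
    fromℕ 4 * (fromℕ m * ratio m) + fromℕ 4 * a ≈ two * (ρ * (fromℕ m + 1#)) + fromℕ 4 * (a * fromℕ m)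
  4m*ratio m = linear-≈
    (+-cong (+-cong (*-congˡ {x = two * ρ * fromℕ m} two*half) (*-congˡ {x = two * ρ} (⁻¹-inverseʳ _ (<⇒≉ (0<2M m)))))
      (+-cong (*-congˡ {x = fromℕ 4 * a * fromℕ m} (x-y+y≈x 1# (1# / fromℕ m)))
              (*-congˡ {x = fromℕ 4 * a} (sym (⁻¹-inverseʳ _ (<⇒≉ (fromℕ-positive m)))))))
    (solve 7 (λ M ρ a h i q y →
        num 4 :* (M :* (ρ :* (con 1 :* h :+ con 1 :* i) :+ a :* y)) :+ num 4 :* a :+
          (num 2 :* ρ :* M :* con 1 :+ num 2 :* ρ :* con 1 :+
            (num 4 :* a :* M :* con 1 :+ num 4 :* a :* (M :* q)))
      := num 2 :* (ρ :* (M :+ con 1)) :+ num 4 :* (a :* M) :+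
          (num 2 :* ρ :* M :* (num 2 :* h) :+ num 2 :* ρ :* (num 2 :* M :* i) :+
            (num 4 :* a :* M :* (y :+ con 1 :* q) :+ num 4 :* a :* con 1)))
      refl (fromℕ m) ρ a half ((two * fromℕ m) ⁻¹) (fromℕ m ⁻¹) (1# - 1# / fromℕ m))

  ratio-1 : ratio 1 ≈ ρ
  ratio-1 = *-cancelˡ-≈ (fromℕ-positive 4) (linear-≈ (4m*ratio 1)
    (solve 3 (λ R ρ a →
        num 4 :* R :+ (num 2 :* (ρ :* (num 1 :+ con 1)) :+ num 4 :* (a :* num 1))
      := num 4 :* ρ :+ (num 4 :* (num 1 :* R) :+ num 4 :* a)) refl (ratio 1) ρ a))

  ratio-limit : Carrier
  ratio-limit = ρ * half + a

  ∣x-y∣≤ : ∀ {x y δ} → 0# ≤ δ → x + δ ≈ y → ∣ x - y ∣ ≤ δ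
  ∣x-y∣≤ {x} {y} {δ} 0≤δ x+δ≈y = ⊔-lub
    (linear (+-mono-≤ (x≤x+y {x} 0≤δ) (+-mono-≤ 0≤δ (≤-reflexive (+-cong (x-y+y≈x x y) x+δ≈y))))
      (solve 4 (λ z x y δ → z :+ (x :+ δ :+ (δ :+ (x :+ y))) := δ :+ (x :+ (con 0 :+ (z :+ y :+ (x :+ δ)))))
        refl (x - y) x y δ))
    (≤-reflexive (linear-≈ (+-cong (-‿inverseˡ (x - y)) (+-cong (sym (x-y+y≈x x y)) (sym x+δ≈y)))
      (solve 5 (λ n z x y δ → n :+ (con 0 :+ (z :+ y :+ (x :+ δ))) := δ :+ (n :+ z :+ (x :+ y)))
        refl (- (x - y)) (x - y) x y δ)))

  ratio+correction≈limit : ∀ m → .{{_ : NonZero m}} →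
    ratio m + (two * a - ρ) * (two * fromℕ m) ⁻¹ ≈ ratio-limit
  ratio+correction≈limit m = linear-≈
    (+-cong (*-congʳ {x = i} (x-y+y≈x (two * a) ρ))
      (+-cong (*-congˡ {x = a} 2i≈q) (*-congˡ {x = a} (x-y+y≈x 1# (1# / fromℕ m)))))
    (solve 7 (λ ρ a h i q y c →
        ρ :* (con 1 :* h :+ con 1 :* i) :+ a :* y :+ c :* i :+
          (num 2 :* a :* i :+ (a :* q :+ a :* con 1))
      := ρ :* h :+ a :+ ((c :+ ρ) :* i :+ (a :* (num 2 :* i) :+ a :* (y :+ con 1 :* q))))
      refl ρ a half i (fromℕ m ⁻¹) (1# - 1# / fromℕ m) (two * a - ρ))
    where
    i = (two * fromℕ m) ⁻¹

    2i≈q : two * i ≈ fromℕ m ⁻¹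
    2i≈q = *-cancelˡ-≈ (fromℕ-positive m) (trans
      (solve 2 (λ M i → M :* (num 2 :* i) := num 2 :* M :* i) refl (fromℕ m) i)
      (trans (⁻¹-inverseʳ _ (<⇒≉ (0<2M m))) (sym (⁻¹-inverseʳ _ (<⇒≉ (fromℕ-positive m))))))

  ratio-tends : TendsTo ratio ratio-limit
  ratio-tends ε 0<ε = N , close
    where
    -- The error is `(2 a - ρ) / (2 m)`. As `2 a - ρ ≤ 1`, it is at most `1 / (2 m)`, strictly below
    -- `1 / m`, which is at most `ε` once `m ≥ 1 / ε`.
    N = proj₁ (archimedean (ε ⁻¹))

    ε⁻¹≤N : ε ⁻¹ ≤ fromℕ N
    ε⁻¹≤N = proj₂ (archimedean (ε ⁻¹))

    close : ∀ m → .{{_ : NonZero m}} → N ℕ.≤ m → ∣ ratio m - ratio-limit ∣ < ε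
    close m N≤m = ≤-<-trans (≤-trans
        (∣x-y∣≤ {ratio m} {ratio-limit} (*-nonneg (x≤y⇒0≤y-x ρ≤2a) 0≤i) (ratio+correction≈limit m))
        (≤-respʳ (*-identityˡ i) (*-monoʳ-≤ 0≤i 2a-ρ≤1)))
      (<-≤-trans (x<x+y 0<i) i+i≤ε)
      where
      i = (two * fromℕ m) ⁻¹

      0<i : 0# < i
      0<i = ⁻¹-positive (0<2M m)

      0≤i : 0# ≤ i
      0≤i = <⇒≤ 0<i

      2a-ρ≤1 : two * a - ρ ≤ 1#
      2a-ρ≤1 = linear (+-mono-≤ 2a≤ρ+1 (≤-reflexive (x-y+y≈x (two * a) ρ)))
        (solve 3 (λ c ρ a → c :+ (ρ :+ con 1 :+ num 2 :* a) := con 1 :+ (num 2 :* a :+ (c :+ ρ)))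
          refl (two * a - ρ) ρ a)

      1≤mε : 1# ≤ fromℕ m * ε
      1≤mε = begin
        1#           ≈⟨ ⁻¹-inverseʳ ε (<⇒≉ 0<ε) ⟨
        ε * ε ⁻¹     ≤⟨ *-monoˡ-≤ (<⇒≤ 0<ε) (≤-trans ε⁻¹≤N (fromℕ-mono-≤ N≤m)) ⟩
        ε * fromℕ m  ≈⟨ *-comm ε (fromℕ m) ⟩
        fromℕ m * ε  ∎

      i+i≤ε : i + i ≤ ε
      i+i≤ε = *-cancelˡ-≤ (fromℕ-positive m) (≤-respˡ
        (trans (sym (⁻¹-inverseʳ _ (<⇒≉ (0<2M m))))
          (solve 2 (λ M i → num 2 :* M :* i := M :* (i :+ i)) refl (fromℕ m) i)) 1≤mε)

  -- The limit is exactly 2.5109825, half a unit of the sixth decimal below 2.510983. After scaling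
  -- by twice ten million the claim rests on `n₁ + 2 n₂ + 1 = 2 n₃`.
  limit+≈ : ratio-limit + decimal 5 7 ≈ decimal 2510983 6
  limit+≈ = *-cancelˡ-≈ (*-positive (fromℕ-positive 2) (0<10^ 7)) (linear-≈
    (+-cong (+-cong (+-cong (*-congʳ {x = two * (ρ * half + a)} D₇≈) (*-congʳ {x = two * v} (sym D₇≈)))
                    (+-cong (*-congˡ {x = fromℕ 20 * half} (10^*decimal 2152271 6))
                            (*-congˡ {x = fromℕ 10 * n₁} two*half)))
            (+-cong (+-cong (*-congˡ {x = fromℕ 20} (10^*decimal 1434847 6)) (*-congˡ {x = two} (10^*decimal 5 7)))
                    (+-cong (*-congˡ {x = fromℕ 20} (sym (10^*decimal 2510983 6))) (*-congˡ {x = fromℕ 10} numerators))))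
    (solve 10 (λ D₇ D₆ ρ h a w v n₁ n₂ n₃ →
        num 2 :* D₇ :* (ρ :* h :+ a :+ w) :+
          (num 10 :* D₆ :* (num 2 :* (ρ :* h :+ a)) :+ D₇ :* (num 2 :* v) :+
            (num 20 :* h :* n₁ :+ num 10 :* n₁ :* con 1) :+
            (num 20 :* n₂ :+ num 2 :* num 5 :+ (num 20 :* (D₆ :* v) :+ num 10 :* (num 2 :* n₃))))
      := num 2 :* D₇ :* v :+
          (D₇ :* (num 2 :* (ρ :* h :+ a)) :+ num 10 :* D₆ :* (num 2 :* v) :+
            (num 20 :* h :* (D₆ :* ρ) :+ num 10 :* n₁ :* (num 2 :* h)) :+
            (num 20 :* (D₆ :* a) :+ num 2 :* (D₇ :* w) :+
              (num 20 :* n₃ :+ num 10 :* (n₁ :+ num 2 :* n₂ :+ num 1)))))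
      refl (fromℕ (10 ℕ.^ 7)) (fromℕ (10 ℕ.^ 6)) ρ half a (decimal 5 7) v n₁ n₂ n₃))
    where
    v  = decimal 2510983 6
    n₁ = fromℕ 2152271
    n₂ = fromℕ 1434847
    n₃ = fromℕ 2510983

    D₇≈ : fromℕ (10 ℕ.^ 7) ≈ fromℕ 10 * fromℕ (10 ℕ.^ 6)
    D₇≈ = fromℕ-homo-* 10 (10 ℕ.^ 6)

    numerators : n₁ + two * n₂ + fromℕ 1 ≈ two * n₃
    numerators = begin-equality
      n₁ + two * n₂ + fromℕ 1
        ≈⟨ +-congʳ (+-congˡ (fromℕ-homo-* 2 1434847)) ⟨
      n₁ + fromℕ (2 ℕ.* 1434847) + fromℕ 1
        ≈⟨ +-congʳ (fromℕ-homo-+ 2152271 (2 ℕ.* 1434847)) ⟨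
      fromℕ (2152271 ℕ.+ 2 ℕ.* 1434847) + fromℕ 1
        ≈⟨ fromℕ-homo-+ (2152271 ℕ.+ 2 ℕ.* 1434847) 1 ⟨
      fromℕ (2152271 ℕ.+ 2 ℕ.* 1434847 ℕ.+ 1)
        ≈⟨ fromℕ-≡ {2152271 ℕ.+ 2 ℕ.* 1434847 ℕ.+ 1} {2 ℕ.* 2510983} ≡.refl ⟩
      fromℕ (2 ℕ.* 2510983)
        ≈⟨ fromℕ-homo-* 2 2510983 ⟩
      two * n₃ ∎

  -- `E` is the expected cost, `C` the cost of OPT, `X` the total optimal work, `O` the sum of the
  -- minima over ordered pairs of distinct jobs. The number of machines is `1 + k`, so that `m - 1`
  -- is available as `k`.
  competitive-arithmetic : ∀ {k R E C X O} →
    fromℕ 4 * ((1# + k) * E) ≤ fromℕ 4 * ((1# + k) * (a * X)) + three * a * O →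
    (1# + k) * X + (X + O) ≤ (1# + k) * (two * C) →
    X ≤ C → 0# ≤ X → 0# ≤ O → 0# ≤ k →
    fromℕ 4 * ((1# + k) * R) + fromℕ 4 * a ≈ two * (ρ * (1# + k + 1#)) + fromℕ 4 * (a * (1# + k)) →
    E ≤ R * C
  competitive-arithmetic {k} {R} {E} {C} {X} {O} E≤ OPT≥ X≤C 0≤X 0≤O 0≤k ratio≈ =
    *-cancelˡ-≤ (*-positive (fromℕ-positive 4) (+-positive 0<1 0≤k)) (linear
      -- Since `3 a ≤ 2 ρ`, the bound `OPT≥` taken `2 ρ` times eliminates `O`. The coefficient left
      -- at `X` is `2 k (2 a - ρ) - 4 (ρ - a)`: its second part is dropped by `a≤ρ`, its first is
      -- moved to `C` by `X≤C`, and what stands at `C` is then `4 m R`.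
      (+-mono-≤ (+-mono-≤ (+-mono-≤ E≤
          (*-monoˡ-≤ (*-nonneg (fromℕ-nonneg 2) (0≤decimal 2152271 6)) OPT≥))
          (+-mono-≤ (*-monoˡ-≤ (*-nonneg (fromℕ-nonneg 4) 0≤X) a≤ρ)
            (*-monoˡ-≤ (*-nonneg (fromℕ-nonneg 2) 0≤k) (rearrangement ρ≤2a X≤C))))
        (+-mono-≤ (*-monoʳ-≤ 0≤O 3a≤2ρ) (≤-reflexive (*-congʳ {x = C} (sym ratio≈)))))
      (solve 8 (λ k R E C X O a ρ →
          num 4 :* (con 1 :+ k) :* E :+
            (num 4 :* ((con 1 :+ k) :* (a :* X)) :+ num 3 :* a :* O :+
              num 2 :* ρ :* ((con 1 :+ k) :* (num 2 :* C)) :+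
              (num 4 :* X :* ρ :+ num 2 :* k :* (ρ :* X :+ num 2 :* a :* C)) :+
              (num 2 :* ρ :* O :+ (num 4 :* ((con 1 :+ k) :* R) :+ num 4 :* a) :* C))
        := num 4 :* (con 1 :+ k) :* (R :* C) :+
            (num 4 :* ((con 1 :+ k) :* E) :+
              num 2 :* ρ :* ((con 1 :+ k) :* X :+ (X :+ O)) :+
              (num 4 :* X :* a :+ num 2 :* k :* (ρ :* C :+ num 2 :* a :* X)) :+
              (num 3 :* a :* O :+ (num 2 :* (ρ :* (con 1 :+ k :+ con 1)) :+ num 4 :* (a :* (con 1 :+ k))) :* C)))
        refl k R E C X O a ρ))

  competitive : ∀ m → .{{_ : NonZero m}} → ExpectedCompetitiveRatio≤ m two (testProbabilities two) (ratio m)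
  competitive (ℕ.suc k) I A runs τ S feasible = competitive-arithmetic
    (𝔼-cost≤ I {a = a} (testProbabilities two I) (testProbability-good I 4≤3a a-quadratic) A runs)
    (optimalPairs≤cost I S feasible)
    (optimalWork≤cost I S feasible)
    (∑x≥0 I)
    (pairs≥0 I)
    (fromℕ-nonneg k)
    (4m*ratio (ℕ.suc k))

corollary25 : ∀ {c ℓ₁ ℓ₂} (K : ArchimedeanField c ℓ₁ ℓ₂) → let open Scheduling K in
    (∀ m → .{{_ : NonZero m}} →
    ExpectedCompetitiveRatio≤ m two (testProbabilities two) (ratio m)) ×
    (ratio 1 ≈ decimal 2152271 6) ×
    (∃ λ L → TendsTo ratio L × (∣ L - decimal 2510983 6 ∣ ≤ decimal 5 7))
corollary25 K =
  competitive , ratio-1 , ratio-limit , ratio-tends ,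
  ∣x-y∣≤ {ratio-limit} {decimal 2510983 6} (0≤decimal 5 7) limit+≈
  where
  open Scheduling K using (decimal)
  open Ratio K
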